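{- Let $E_2(q)=1-24\sum_{n\ge1}\frac{nq^n}{1-q^n}$ and $\mathcal P=E_2(q^7)$, and let $x,y,z$ be as in the context. Then $$q\frac{dx}{dq}=\frac{x}{12}\left(5y^2+5z^2-7x^2+20yz+52xy+7\mathcal P\right),\quad q\frac{dy}{dq}=\frac{y}{12}\left(5z^2+5x^2-7y^2+20xz+52yz+7\mathcal P\right),$$ $$q\frac{dz}{dq}=\frac{z}{12}\left(5x^2+5y^2-7z^2+20xy+52xz+7\mathcal P\right),$$ $$q\frac{d\mathcal P}{dq}=\frac{7}{12}\left(\mathcal P^2-x^4-4x^3y-12xy^3-y^4-12x^3z-4y^3z-4xz^3-12yz^3-z^4\right).$$
   Context: $|q|<1$, $(a;q)_\infty=\prod_{j\ge0}(1-aq^j)$, $(a_1,\dots,a_r;q)_\infty=\prod_i(a_i;q)_\infty$, and $x=q\frac{(q^2,q^5,q^7,q^7;q^7)_\infty}{(q^3,q^4;q^7)_\infty^2}$, $y=-q\frac{(q,q^6,q^7,q^7;q^7)_\infty}{(q^2,q^5;q^7)_\infty^2}$, $z=\frac{(q^3,q^4,q^7,q^7;q^7)_\infty}{(q,q^6;q^7)_\infty^2}$. -}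

module Defs where

-- Formal power series over ℤ in one variable q, represented by their
-- coefficient functions.  Every series occurring in Theorem 1.4 has
-- integer coefficients and converges for |q| < 1, so the analytic
-- identities are equivalent to the coefficientwise identities below.

open import Data.Nat as ℕ using (ℕ; zero; suc; _≡ᵇ_; _/_)
open import Data.Nat.Divisibility using (_∣?_)
open import Relation.Binary.PropositionalEquality using (_≡_)
open import Data.Integer as ℤ using (ℤ; +_; -_)
open import Data.Vec as Vec using (Vec; []; _∷_; lookup)
open import Data.Fin as Fin using (Fin; toℕ)
open import Data.Bool using (if_then_else_)
open import Relation.Nullary.Decidable using (⌊_⌋)

FPS : Set
FPS = ℕ → ℤ

sumℤ : ℕ → (ℕ → ℤ) → ℤ
sumℤ zero    f = + 0
sumℤ (suc n) f = sumℤ n f ℤ.+ f n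

infixl 6 _⊕_ _⊖_
infixl 7 _⊗_ _⋆_

_⊕_ : FPS → FPS → FPS
(f ⊕ g) n = f n ℤ.+ g n

_⊖_ : FPS → FPS → FPS
(f ⊖ g) n = f n ℤ.- g n

neg : FPS → FPS
neg f n = - f n

_⋆_ : ℤ → FPS → FPS
(c ⋆ f) n = c ℤ.* f n

_⊗_ : FPS → FPS → FPS
(f ⊗ g) n = sumℤ (suc n) (λ i → f i ℤ.* g (n ℕ.∸ i))

mono : ℕ → FPS
mono e n = if n ≡ᵇ e then + 1 else + 0

one : FPS
one = mono 0

θ : FPS → FPS
θ f n = + n ℤ.* f n

sub7 : FPS → FPS
sub7 f n = if ⌊ 7 ∣? n ⌋ then f (n / 7) else + 0

-- Multiplicative inverse of a series with constant term 1
-- (the only case used below): invVec f n = (c_n , c_{n-1} , … , c_0),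
-- where c_0 = 1 and c_{n+1} = - Σ_{k=0}^{n} f_{k+1} c_{n-k}.
invVec : FPS → (n : ℕ) → Vec ℤ (suc n)
invVec f zero    = + 1 ∷ []
invVec f (suc n) =
  let prev = invVec f n
  in  (- sumFin prev) ∷ prev
  where
  sumFin : Vec ℤ (suc n) → ℤ
  sumFin prev = Vec.foldr _ ℤ._+_ (+ 0)
                  (Vec.tabulate (λ (k : Fin (suc n)) → f (suc (toℕ k)) ℤ.* lookup prev k))

inv : FPS → FPS
inv f n = Vec.head (invVec f n)

pochT : ℕ → ℕ → ℕ → FPS
pochT a d zero    = one
pochT a d (suc m) = pochT a d m ⊗ (one ⊖ mono (a ℕ.+ d ℕ.* m))

-- (q^a ; q^d)_∞ for a ≥ 1: the coefficient of q^n only depends on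
-- the factors with j ≤ n, since a + d j ≥ 1 + j > n for j > n (d ≥ 1).
poch : ℕ → ℕ → FPS
poch a d n = pochT a d (suc n) n

xS : FPS
xS = mono 1 ⊗ poch 2 7 ⊗ poch 5 7 ⊗ poch 7 7 ⊗ poch 7 7
       ⊗ inv (poch 3 7 ⊗ poch 4 7 ⊗ poch 3 7 ⊗ poch 4 7)

yS : FPS
yS = neg (mono 1 ⊗ poch 1 7 ⊗ poch 6 7 ⊗ poch 7 7 ⊗ poch 7 7
       ⊗ inv (poch 2 7 ⊗ poch 5 7 ⊗ poch 2 7 ⊗ poch 5 7))

zS : FPS
zS = poch 3 7 ⊗ poch 4 7 ⊗ poch 7 7 ⊗ poch 7 7
       ⊗ inv (poch 1 7 ⊗ poch 6 7 ⊗ poch 1 7 ⊗ poch 6 7)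

-- coefficient of q^m in Σ_{n≥1} n q^n/(1-q^n) = Σ_{n≥1} Σ_{k≥1} n q^{nk},
-- i.e. Σ_{1 ≤ n ≤ m, n ∣ m} n
lambertCoeff : FPS
lambertCoeff m = sumℤ m (λ i → if ⌊ suc i ∣? m ⌋ then + suc i else + 0)

E₂ : FPS
E₂ = one ⊖ (+ 24) ⋆ lambertCoeff

𝒫 : FPS
𝒫 = sub7 E₂

infix 4 _≐_
_≐_ : FPS → FPS → Set
f ≐ g = (n : ℕ) → f n ≡ g n

{-# OPTIONS --safe #-}
-- Let θ_i = (q^i, q^(7-i), q^7; q^7)_∞ and P = (q^7; q^7)_∞, so that x = q P³ θ₂/θ₃², y = - q P³ θ₁/θ₂² and
-- z = P³ θ₃/θ₁². By the triple product identity θ_i is, up to a power of Q = q^(1/56), the series Σ (-1)^n Q^(k²) over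
-- k = 14 n + 2 i - 7, and P³ is essentially the first moment Σ (-1)^n k Q^(k²) for i = 0. Weights k^r amount to
-- derivatives in the elliptic variable, and Q d/dQ raises r by 2: this is the heat equation.
--
-- Summing over (k + l)/2 and (k - l)/2 instead of k and l turns the product of two such series into a 2 × 2 determinant
-- A(u) B(v) - B(u) A(v), also in the presence of weights. The addition formulas of Weierstrass are therefore Plücker
-- relations between the vectors (A, B) and their derivatives. They yield x y + y z + z x = 0; the logarithmic derivatives
-- of the θ_i in the elliptic variable as linear forms in x, y, z; the second derivatives, hence by the heat equation the
-- logarithmic q-derivatives of x, y, z, as quadratic forms plus multiples of the logarithmic derivative of P, which is
-- 𝒫; and, from the analogue of ℘″ = 6 ℘² - g₂/2, the derivative of 𝒫.
module Submission where

open import Defs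
open import Data.Fin as Fin using (Fin; toℕ)
open import Data.Integer as ℤ using (ℤ; +_; -[1+_]; 0ℤ; 1ℤ; -1ℤ; ∣_∣)
import Data.Integer.Properties as ℤP
open import Data.Integer.Tactic.RingSolver using (solve-∀)
open import Data.List using (List; []; _∷_)
import Data.List.Properties as ListP
open import Data.Maybe using (Maybe; just; nothing)
open import Data.Nat as ℕ using (ℕ; zero; suc; z≤n; s≤s; _∸_; NonZero)
import Data.Nat.Divisibility as Div
import Data.Nat.DivMod as DM
import Data.Nat.Properties as ℕP
open import Data.Nat.Tactic.RingSolver using () renaming (solve-∀ to solveℕ-∀)
open import Data.Product using (_,_; _×_; proj₁; proj₂)
import Data.Product.Properties as ProductP
open import Data.Sum using (inj₁; inj₂)
open import Data.Unit using (tt)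
open import Data.Bool using (if_then_else_)
open import Data.Empty using (⊥-elim)
open import Data.Vec as Vec using (Vec; []; _∷_; map; allFin; zipWith; replicate; lookup; _[_]≔_)
import Data.Vec.Properties as VecP
open import Data.Vec.N-ary using (N-ary; Eq; curryⁿ; curryⁿ-cong; _$ⁿ_)
open import Algebra.Bundles using (CommutativeRing)
open import Algebra.Structures using (IsCommutativeRing)
open import Algebra.Solver.Ring.AlmostCommutativeRing using (fromCommutativeRing; _-Raw-AlmostCommutative⟶_)
open import Level using (0ℓ)
open import Relation.Nullary using (Dec; yes; no; ¬_)
open import Relation.Nullary.Decidable using (True; toWitness; ⌊_⌋)
open import Relation.Binary.PropositionalEquality using (_≡_; refl; cong; cong₂)
import Relation.Binary.Reasoning.Setoid as SetoidReasoning

-- Deductions are ideal-membership certificates: the conclusion is a combination of the hypotheses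
-- with explicit cofactors, and the remaining polynomial identity is checked by computing normal
-- forms. Since x, y, z lie on a conic, forms in them are determined only modulo `X Y + Y Z + Z X`;
-- hence the large cofactors.
--
-- The system closes because the level is 7: modulo 7, doubling sends 1 to 2, 2 to 4 = -3 and 3 to 6
-- = -1. Duplication therefore relates the second derivatives of θ₁, θ₂, θ₃ cyclically, by a linear
-- system of determinant 9, and brings in no new functions.
--
-- The determinants come from a parity split: for k = 14 m + β and l = 14 n + γ the half sum lies in
-- one of two classes modulo 14, seven apart, according to the parity of m + n, and (-1)^(m+n) gives
-- the second class a minus sign.
--
-- Fractional exponents are avoided by substituting q^56 for q; the products then have base q^392,
-- where 392 = 7 · 56.

-- Polynomial identities and cancellation in a commutative ring

module RingTools
  (R : CommutativeRing 0ℓ 0ℓ)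
  (ℤ⟶R : CommutativeRing.rawRing ℤP.+-*-commutativeRing -Raw-AlmostCommutative⟶ fromCommutativeRing R)
  where

  open CommutativeRing R hiding (zero; refl)
  open CommutativeRing R using () renaming (refl to ≈-refl)
  open _-Raw-AlmostCommutative⟶_ ℤ⟶R using (+-homo; *-homo; 1-homo) renaming (⟦_⟧ to K)

  private
    coeff-≟ : ∀ c c′ → Maybe (K c ≈ K c′)
    coeff-≟ c c′ with c ℤ.≟ c′
    ... | yes refl = just ≈-refl
    ... | no _     = nothing

  open import Algebra.Solver.Ring (CommutativeRing.rawRing ℤP.+-*-commutativeRing) (fromCommutativeRing R) ℤ⟶R coeff-≟
    as Solver
    using (Polynomial; con; var; _:+_; _:*_; _:-_; :-_; ⟦_⟧) public

  infix 4 _:=_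
  _:=_ : ∀ {n} → Polynomial n → Polynomial n → Polynomial n × Polynomial n
  _:=_ = _,_

  private
    -- Sparse normal forms, since the Horner forms of Algebra.Solver.Ring blow up on identities in ten variables.
    Monomial : ℕ → Set
    Monomial = Vec ℕ

    Sparse : ℕ → Set
    Sparse n = List (Monomial n × ℤ)

    -- Evidence is attached to `equal` alone: merging two terms requires their monomials to agree,
    -- whereas the order only serves to bring equal polynomials to the same list.
    data Comparison {A : Set} : A → A → Set where
      less    : ∀ {x y} → Comparison x y
      equal   : ∀ {x y} → x ≡ y → Comparison x y
      greater : ∀ {x y} → Comparison x y

    compareℕ : ∀ (m n : ℕ) → Comparison m n
    compareℕ zero    zero    = equal refl
    compareℕ zero    (suc n) = less
    compareℕ (suc m) zero    = greater
    compareℕ (suc m) (suc n) with compareℕ m n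
    ... | less    = less
    ... | equal p = equal (cong suc p)
    ... | greater = greater

    compare : ∀ {n} (m m′ : Monomial n) → Comparison m m′
    compare []      []        = equal refl
    compare (i ∷ m) (i′ ∷ m′) with compareℕ i i′
    ... | less    = less
    ... | greater = greater
    ... | equal p with compare m m′
    ...   | less    = less
    ...   | equal q = equal (cong₂ _∷_ p q)
    ...   | greater = greater

    -- `identity` compares normal forms literally, so a term that has cancelled must disappear from
    -- the list.
    cons : ∀ {n} → Monomial n → ℤ → Sparse n → Sparse n
    cons m (+ 0) p = p
    cons m c     p = (m , c) ∷ p

    -- One step of the merge, with the three possible recursive sums as arguments; `select-homo` can
    -- then split on the comparison without unfolding the recursion.
    select : ∀ {n} {m m′ : Monomial n} → Comparison m m′ → ℤ → ℤ → (p₁ p₂ p₃ : Sparse n) → Sparse n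
    select {m = m} less    c c′ p₁ p₂ p₃ = (m , c) ∷ p₁
    select {m = m} (equal _) c c′ p₁ p₂ p₃ = cons m (c ℤ.+ c′) p₂
    select {m′ = m′} greater c c′ p₁ p₂ p₃ = (m′ , c′) ∷ p₃

    infixl 6 _+ˢ_
    _+ˢ_ : ∀ {n} → Sparse n → Sparse n → Sparse n
    []            +ˢ q               = q
    (x ∷ p)       +ˢ []              = x ∷ p
    ((m , c) ∷ p) +ˢ ((m′ , c′) ∷ q) =
      select (compare m m′) c c′ (p +ˢ ((m′ , c′) ∷ q)) (p +ˢ q) (((m , c) ∷ p) +ˢ q)

    scale : ∀ {n} → Monomial n → ℤ → Sparse n → Sparse n
    scale m c []              = []
    scale m c ((m′ , c′) ∷ p) = (zipWith ℕ._+_ m m′ , c ℤ.* c′) ∷ scale m c p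

    infixl 7 _*ˢ_
    _*ˢ_ : ∀ {n} → Sparse n → Sparse n → Sparse n
    []            *ˢ q = []
    ((m , c) ∷ p) *ˢ q = scale m c q +ˢ p *ˢ q

    sparse : ∀ {n} → Polynomial n → Sparse n
    sparse (Solver.op Solver.[+] p q) = sparse p +ˢ sparse q
    sparse (Solver.op Solver.[*] p q) = sparse p *ˢ sparse q
    sparse (con c)                    = cons (replicate _ 0) c []
    sparse (Solver.var i)             = (replicate _ 0 [ i ]≔ 1 , 1ℤ) ∷ []
    sparse (p Solver.:^ zero)         = (replicate _ 0 , 1ℤ) ∷ []
    sparse (p Solver.:^ suc k)        = sparse p *ˢ sparse (p Solver.:^ k)
    sparse (:- p)                     = scale (replicate _ 0) -1ℤ (sparse p)

    pow : Carrier → ℕ → Carrier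
    pow x zero    = K 1ℤ
    pow x (suc n) = x * pow x n

    ⟦_⟧ᵐ : ∀ {n} → Monomial n → Vec Carrier n → Carrier
    ⟦ [] ⟧ᵐ    _       = K 1ℤ
    ⟦ i ∷ m ⟧ᵐ (x ∷ ρ) = pow x i * ⟦ m ⟧ᵐ ρ

    ⟦_⟧ˢ : ∀ {n} → Sparse n → Vec Carrier n → Carrier
    ⟦ [] ⟧ˢ          ρ = K 0ℤ
    ⟦ (m , c) ∷ p ⟧ˢ ρ = K c * ⟦ m ⟧ᵐ ρ + ⟦ p ⟧ˢ ρ

    K1* : ∀ x → K 1ℤ * x ≈ x
    K1* x = trans (*-congʳ 1-homo) (*-identityˡ x)

    pow-+ : ∀ x i j → pow x (i ℕ.+ j) ≈ pow x i * pow x j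
    pow-+ x zero    j = sym (K1* (pow x j))
    pow-+ x (suc i) j = trans (*-congˡ (pow-+ x i j)) (sym (*-assoc x (pow x i) (pow x j)))

    zipWith-homo : ∀ {n} (m m′ : Monomial n) ρ → ⟦ zipWith ℕ._+_ m m′ ⟧ᵐ ρ ≈ ⟦ m ⟧ᵐ ρ * ⟦ m′ ⟧ᵐ ρ
    zipWith-homo []      []        []      = sym (K1* (K 1ℤ))
    zipWith-homo (i ∷ m) (i′ ∷ m′) (x ∷ ρ) = trans (*-cong (pow-+ x i i′) (zipWith-homo m m′ ρ))
      (Solver.solve 4 (λ a b c d → a :* b :* (c :* d) , a :* c :* (b :* d)) ≈-refl
        (pow x i) (pow x i′) (⟦ m ⟧ᵐ ρ) (⟦ m′ ⟧ᵐ ρ))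

    replicate-homo : ∀ {n} (ρ : Vec Carrier n) → ⟦ replicate n 0 ⟧ᵐ ρ ≈ K 1ℤ
    replicate-homo []      = ≈-refl
    replicate-homo (x ∷ ρ) = trans (K1* _) (replicate-homo ρ)

    var-homo : ∀ {n} (i : Fin n) ρ → ⟦ replicate n 0 [ i ]≔ 1 ⟧ᵐ ρ ≈ lookup ρ i
    var-homo Fin.zero    (x ∷ ρ) = trans (*-congˡ (replicate-homo ρ))
      (Solver.solve 1 (λ x → x :* con 1ℤ :* con 1ℤ , x) ≈-refl x)
    var-homo (Fin.suc i) (x ∷ ρ) = trans (K1* _) (var-homo i ρ)

    cons-homo : ∀ {n} m c (p : Sparse n) ρ → ⟦ cons m c p ⟧ˢ ρ ≈ K c * ⟦ m ⟧ᵐ ρ + ⟦ p ⟧ˢ ρ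
    cons-homo m (+ 0)       p ρ = Solver.solve 2 (λ m p → p , con 0ℤ :* m :+ p) ≈-refl (⟦ m ⟧ᵐ ρ) (⟦ p ⟧ˢ ρ)
    cons-homo m (+ (suc _)) p ρ = ≈-refl
    cons-homo m -[1+ _ ]    p ρ = ≈-refl

    select-homo : ∀ {n} {m m′ : Monomial n} (o : Comparison m m′) c c′ p₁ p₂ p₃ p q ρ →
      ⟦ p₁ ⟧ˢ ρ ≈ p + (K c′ * ⟦ m′ ⟧ᵐ ρ + q) → ⟦ p₂ ⟧ˢ ρ ≈ p + q → ⟦ p₃ ⟧ˢ ρ ≈ K c * ⟦ m ⟧ᵐ ρ + p + q →
      ⟦ select o c c′ p₁ p₂ p₃ ⟧ˢ ρ ≈ K c * ⟦ m ⟧ᵐ ρ + p + (K c′ * ⟦ m′ ⟧ᵐ ρ + q)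
    select-homo less c c′ p₁ p₂ p₃ p q ρ h₁ h₂ h₃ = trans (+-congˡ h₁) (sym (+-assoc _ _ _))
    select-homo {m = m} (equal refl) c c′ p₁ p₂ p₃ p q ρ h₁ h₂ h₃ = trans (cons-homo m (c ℤ.+ c′) p₂ ρ)
      (trans (+-cong (*-congʳ (+-homo c c′)) h₂)
        (Solver.solve 5 (λ c c′ m p q → (c :+ c′) :* m :+ (p :+ q) , (c :* m :+ p) :+ (c′ :* m :+ q)) ≈-refl
          (K c) (K c′) (⟦ m ⟧ᵐ ρ) p q))
    select-homo {m = m} {m′} greater c c′ p₁ p₂ p₃ p q ρ h₁ h₂ h₃ = trans (+-congˡ h₃)
      (Solver.solve 4 (λ x p y q → y :+ (x :+ p :+ q) , x :+ p :+ (y :+ q)) ≈-refl (K c * ⟦ m ⟧ᵐ ρ) p (K c′ * ⟦ m′ ⟧ᵐ ρ) q)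

    +ˢ-homo : ∀ {n} (p q : Sparse n) ρ → ⟦ p +ˢ q ⟧ˢ ρ ≈ ⟦ p ⟧ˢ ρ + ⟦ q ⟧ˢ ρ
    +ˢ-homo []      q  ρ = Solver.solve 1 (λ q → q , con 0ℤ :+ q) ≈-refl (⟦ q ⟧ˢ ρ)
    +ˢ-homo (x ∷ p) [] ρ = Solver.solve 1 (λ p → p , p :+ con 0ℤ) ≈-refl (⟦ x ∷ p ⟧ˢ ρ)
    +ˢ-homo ((m , c) ∷ p) ((m′ , c′) ∷ q) ρ = select-homo (compare m m′) c c′ (p +ˢ ((m′ , c′) ∷ q)) (p +ˢ q) (((m , c) ∷ p) +ˢ q) (⟦ p ⟧ˢ ρ) (⟦ q ⟧ˢ ρ) ρ
      (+ˢ-homo p ((m′ , c′) ∷ q) ρ) (+ˢ-homo p q ρ) (+ˢ-homo ((m , c) ∷ p) q ρ)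

    scale-homo : ∀ {n} m c (p : Sparse n) ρ → ⟦ scale m c p ⟧ˢ ρ ≈ K c * ⟦ m ⟧ᵐ ρ * ⟦ p ⟧ˢ ρ
    scale-homo m c []              ρ = Solver.solve 1 (λ x → con 0ℤ , x :* con 0ℤ) ≈-refl (K c * ⟦ m ⟧ᵐ ρ)
    scale-homo m c ((m′ , c′) ∷ p) ρ = trans
      (+-cong (*-cong (*-homo c c′) (zipWith-homo m m′ ρ)) (scale-homo m c p ρ))
      (Solver.solve 5 (λ c c′ m m′ p → c :* c′ :* (m :* m′) :+ c :* m :* p , c :* m :* (c′ :* m′ :+ p)) ≈-refl
        (K c) (K c′) (⟦ m ⟧ᵐ ρ) (⟦ m′ ⟧ᵐ ρ) (⟦ p ⟧ˢ ρ))

    *ˢ-homo : ∀ {n} (p q : Sparse n) ρ → ⟦ p *ˢ q ⟧ˢ ρ ≈ ⟦ p ⟧ˢ ρ * ⟦ q ⟧ˢ ρ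
    *ˢ-homo []            q ρ = Solver.solve 1 (λ q → con 0ℤ , con 0ℤ :* q) ≈-refl (⟦ q ⟧ˢ ρ)
    *ˢ-homo ((m , c) ∷ p) q ρ = trans (+ˢ-homo (scale m c q) (p *ˢ q) ρ)
      (trans (+-cong (scale-homo m c q ρ) (*ˢ-homo p q ρ)) (sym (distribʳ (⟦ q ⟧ˢ ρ) (K c * ⟦ m ⟧ᵐ ρ) (⟦ p ⟧ˢ ρ))))

    sparse-correct : ∀ {n} (p : Polynomial n) ρ → ⟦ sparse p ⟧ˢ ρ ≈ ⟦ p ⟧ ρ
    sparse-correct (Solver.op Solver.[+] p q) ρ =
      trans (+ˢ-homo (sparse p) (sparse q) ρ) (+-cong (sparse-correct p ρ) (sparse-correct q ρ))
    sparse-correct (Solver.op Solver.[*] p q) ρ =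
      trans (*ˢ-homo (sparse p) (sparse q) ρ) (*-cong (sparse-correct p ρ) (sparse-correct q ρ))
    sparse-correct (con c) ρ = trans (cons-homo (replicate _ 0) c [] ρ) (trans (+-congʳ (*-congˡ (replicate-homo ρ)))
      (Solver.solve 1 (λ c → c :* con 1ℤ :+ con 0ℤ , c) ≈-refl (K c)))
    sparse-correct (Solver.var i) ρ = trans (+-congʳ (*-congˡ (var-homo i ρ)))
      (Solver.solve 1 (λ x → con 1ℤ :* x :+ con 0ℤ , x) ≈-refl (lookup ρ i))
    sparse-correct (p Solver.:^ zero) ρ = trans (+-congʳ (*-congˡ (replicate-homo ρ)))
      (trans (Solver.solve 0 (con 1ℤ :* con 1ℤ :+ con 0ℤ , con 1ℤ) ≈-refl) 1-homo)
    sparse-correct (p Solver.:^ suc k) ρ =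
      trans (*ˢ-homo (sparse p) (sparse (p Solver.:^ k)) ρ) (*-cong (sparse-correct p ρ) (sparse-correct (p Solver.:^ k) ρ))
    sparse-correct (:- p) ρ = trans (scale-homo (replicate _ 0) -1ℤ (sparse p) ρ)
      (trans (*-cong (*-congˡ (replicate-homo ρ)) (sparse-correct p ρ))
        (Solver.solve 1 (λ x → con -1ℤ :* con 1ℤ :* x , :- x) ≈-refl (⟦ p ⟧ ρ)))

    close : ∀ {A : Set} n → N-ary n (Polynomial n) A → A
    close n f = f $ⁿ map var (allFin n)

    _≟ˢ_ : ∀ {n} (p q : Sparse n) → Dec (p ≡ q)
    _≟ˢ_ = ListP.≡-dec (ProductP.≡-dec (VecP.≡-dec ℕ._≟_) ℤ._≟_)

  identity : ∀ n (f : N-ary n (Polynomial n) (Polynomial n × Polynomial n)) →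
             {True (sparse (proj₁ (close n f)) ≟ˢ sparse (proj₂ (close n f)))} →
             Eq n _≈_ (curryⁿ ⟦ proj₁ (close n f) ⟧) (curryⁿ ⟦ proj₂ (close n f) ⟧)
  identity n f {ok} = curryⁿ-cong _≈_ ⟦ p ⟧ ⟦ q ⟧ λ ρ →
    trans (sym (sparse-correct p ρ)) (trans (reflexive (cong (λ s → ⟦ s ⟧ˢ ρ) (toWitness ok))) (sparse-correct q ρ))
    where
    p q : Polynomial n
    p = proj₁ (close n f)
    q = proj₂ (close n f)

  -- The shape of a certificate: `x = y + Σ c (l - r)` is a polynomial identity, and each summand
  -- vanishes by a hypothesis `l ≈ r`. `_·_` attaches the cofactor `c` to a hypothesis and `_⊞_`
  -- adds the summands, in the same nesting as in the polynomial identity.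
  by-zero : ∀ {e x y} → e ≈ K 0ℤ → x ≈ y + e → x ≈ y
  by-zero {y = y} h p = trans p (trans (+-congˡ h) (identity 1 (λ y → y :+ con 0ℤ := y) y))

  infixr 4 _⊞_
  _⊞_ : ∀ {e e′} → e ≈ K 0ℤ → e′ ≈ K 0ℤ → e + e′ ≈ K 0ℤ
  p ⊞ q = trans (+-cong p q) (identity 0 (con 0ℤ :+ con 0ℤ := con 0ℤ))

  infixr 5 _·_
  _·_ : ∀ {l r} c → l ≈ r → c * (l + - r) ≈ K 0ℤ
  _·_ {l} {r} c h = trans (*-congˡ (+-congʳ h)) (identity 2 (λ c r → c :* (r :- r) := con 0ℤ) c r)

  -- Non-zero-divisors take the place of units: 14, 9 or a theta series is never inverted, only
  -- removed from both sides.
  record Cancellable (f : Carrier) : Set where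
    field cancel : ∀ g → f * g ≈ K 0ℤ → g ≈ K 0ℤ
  open Cancellable public

  cancelˡ : ∀ {f g h} → Cancellable f → f * g ≈ f * h → g ≈ h
  cancelˡ {f} {g} {h} c p = by-zero
    (cancel c (g + - h) (trans (identity 3 (λ f g h → f :* (g :- h) := con 1ℤ :* (f :* g :- f :* h)) f g h) (K 1ℤ · p)))
    (identity 2 (λ g h → g := h :+ (g :- h)) g h)

  Cancellable-≈ : ∀ {f g} → f ≈ g → Cancellable f → Cancellable g
  cancel (Cancellable-≈ p c) h q = cancel c h (trans (*-congʳ p) q)

  Cancellable-* : ∀ {f g} → Cancellable f → Cancellable g → Cancellable (f * g)
  cancel (Cancellable-* {f} {g} cf cg) h p = cancel cg h (cancel cf (g * h) (trans (sym (*-assoc f g h)) p))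

  -- 2 f₂/f₀ + 2 (f₁/f₀)² - 4 (f₁/f₀) (g₁/g₀) + g₂/g₀ = t₃/t₁, cleared of denominators.
  Duplication : (t₁ t₃ f₀ f₁ f₂ g₀ g₁ g₂ : Carrier) → Set
  Duplication t₁ t₃ f₀ f₁ f₂ g₀ g₁ g₂ =
    (g₂ * t₁ + - (g₀ * t₃)) * (f₀ * f₀) + K (+ 2) * (f₂ * f₀ + f₁ * f₁) * (g₀ * t₁)
    ≈ K (+ 4) * (f₁ * f₀) * (g₁ * t₁)

  -- The differential system, derived from algebraic relations in a differential ring

  module ODE
    (cK : ∀ c → ¬ (c ≡ 0ℤ) → Cancellable (K c))
    (θ : Carrier → Carrier)
    (θ-cong : ∀ {f g} → f ≈ g → θ f ≈ θ g)
    (θ-+ : ∀ f g → θ (f + g) ≈ θ f + θ g)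
    (θ-* : ∀ f g → θ (f * g) ≈ θ f * g + f * θ g)
    (θ-K* : ∀ c f → θ (K c * f) ≈ K c * θ f)
    (a₀ a₁ a₂ a₃ a₄ b₀ b₁ b₂ d₀ d₁ d₂ t₁ t₃ t₅ : Carrier)
    (θa₀ : θ a₀ ≈ a₂) (θa₁ : θ a₁ ≈ a₃) (θa₂ : θ a₂ ≈ a₄) (θb₀ : θ b₀ ≈ b₂) (θd₀ : θ d₀ ≈ d₂)
    (θ-t₁ : θ t₁ ≈ t₃) (θ-t₃ : θ t₃ ≈ t₅)
    (klein : a₀ * a₀ * a₀ * b₀ + d₀ * d₀ * d₀ * a₀ ≈ b₀ * b₀ * b₀ * d₀)
    (zeta₁ : K (+ 2) * a₀ * a₁ * b₀ * d₀ + a₀ * a₀ * (b₀ * d₁ + b₁ * d₀) ≈ b₀ * d₀ * (t₁ * d₀))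
    (zeta₂ : b₀ * b₀ * (a₁ * d₀ + a₀ * d₁) ≈ K (+ 2) * a₀ * b₀ * b₁ * d₀ + a₀ * d₀ * (t₁ * a₀))
    (zeta₃ : a₁ * b₀ * d₀ * d₀ ≈ K (+ 2) * a₀ * b₀ * d₀ * d₁ + a₀ * b₁ * d₀ * d₀ + a₀ * b₀ * (t₁ * b₀))
    (duplication₁ : Duplication t₁ t₃ a₀ a₁ a₂ b₀ b₁ b₂)
    (duplication₂ : Duplication t₁ t₃ b₀ b₁ b₂ d₀ (- d₁) d₂)
    (duplication₃ : Duplication t₁ t₃ d₀ d₁ d₂ a₀ (- a₁) a₂)
    (quartic : K (+ 4) * (t₃ * t₃ + - (t₁ * t₅)) * (a₀ * a₀) + K (+ 16) * (t₁ * t₃) * (a₂ * a₀ + - (a₁ * a₁))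
             ≈ K (+ 4) * (t₁ * t₁) * (a₄ * a₀ + - (K (+ 4) * a₃ * a₁) + K (+ 3) * a₂ * a₂))
    (X Y Z C : Carrier)
    (ca : Cancellable a₀) (cb : Cancellable b₀) (cd : Cancellable d₀) (ct : Cancellable t₁)
    (eX : K (ℤ.- + 14) * X * (d₀ * d₀) ≈ t₁ * b₀)
    (eY : K (+ 14) * Y * (b₀ * b₀) ≈ t₁ * a₀)
    (eZ : K (ℤ.- + 14) * Z * (a₀ * a₀) ≈ t₁ * d₀)
    (et : t₃ ≈ C * t₁)
    where

    -- With `X`, `Y`, `Z` replaced by their quotients, the form times `(a₀ b₀ d₀)²` is `- t₁² / 196`
    -- times the difference of the two sides of Klein's quartic. The number 196 is 14², from the
    -- factors 14 in `eX`, `eY`, `eZ`.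
    conic : X * Y + Y * Z + Z * X ≈ K 0ℤ
    conic = cancelˡ (Cancellable-* (cK (+ 196) (λ ()))
        (Cancellable-* (Cancellable-* (Cancellable-* ca cb) cd) (Cancellable-* (Cancellable-* ca cb) cd)))
      (by-zero
        (- (a₀ * a₀) · *-cong eX eY ⊞ - (d₀ * d₀) · *-cong eY eZ ⊞ b₀ * b₀ · *-cong eZ eX
          ⊞ - (t₁ * t₁) · klein)
        (identity 7 (λ X Y Z a b d t →
            con (+ 196) :* (a :* b :* d :* (a :* b :* d)) :* (X :* Y :+ Y :* Z :+ Z :* X) :=
            con (+ 196) :* (a :* b :* d :* (a :* b :* d)) :* con 0ℤ :+
            (:- (a :* a) :* ((con (ℤ.- + 14) :* X :* (d :* d)) :* (con (+ 14) :* Y :* (b :* b)) :- (t :* b) :* (t :* a)) :+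
            (:- (d :* d) :* ((con (+ 14) :* Y :* (b :* b)) :* (con (ℤ.- + 14) :* Z :* (a :* a)) :- (t :* a) :* (t :* d)) :+
            ((b :* b) :* ((con (ℤ.- + 14) :* Z :* (a :* a)) :* (con (ℤ.- + 14) :* X :* (d :* d)) :- (t :* d) :* (t :* b)) :+
            :- (t :* t) :* (a :* a :* a :* b :+ d :* d :* d :* a :- b :* b :* b :* d)))))
           X Y Z a₀ b₀ d₀ t₁))

    -- e₁, e₂, e₃ are linear equations of determinant 14 for a₁/a₀, b₁/b₀, d₁/d₀, with solution j₁, j₂, j₃.
    e₁ : K (ℤ.- + 14) * Z * (a₀ * b₀ * d₀) ≈ K (+ 2) * a₁ * b₀ * d₀ + a₀ * b₁ * d₀ + a₀ * b₀ * d₁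
    e₁ = cancelˡ ca (by-zero (b₀ * d₀ · eZ ⊞ K -1ℤ · zeta₁)
      (identity 8 (λ a a₁ b b₁ d d₁ t Z →
          a :* (con (ℤ.- + 14) :* Z :* (a :* b :* d)) :=
          a :* (con (+ 2) :* a₁ :* b :* d :+ a :* b₁ :* d :+ a :* b :* d₁) :+
          (b :* d :* (con (ℤ.- + 14) :* Z :* (a :* a) :- t :* d) :+
           con -1ℤ :* (con (+ 2) :* a :* a₁ :* b :* d :+ a :* a :* (b :* d₁ :+ b₁ :* d) :- b :* d :* (t :* d))))
         a₀ a₁ b₀ b₁ d₀ d₁ t₁ Z))

    e₂ : K (ℤ.- + 14) * Y * (a₀ * b₀ * d₀) ≈ K (+ 2) * a₀ * b₁ * d₀ + - (a₁ * b₀ * d₀) + - (a₀ * b₀ * d₁)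
    e₂ = cancelˡ cb (by-zero (- (a₀ * d₀) · eY ⊞ K 1ℤ · zeta₂)
      (identity 8 (λ a a₁ b b₁ d d₁ t Y →
          b :* (con (ℤ.- + 14) :* Y :* (a :* b :* d)) :=
          b :* (con (+ 2) :* a :* b₁ :* d :- a₁ :* b :* d :- a :* b :* d₁) :+
          (:- (a :* d) :* (con (+ 14) :* Y :* (b :* b) :- t :* a) :+
           con 1ℤ :* (b :* b :* (a₁ :* d :+ a :* d₁) :- (con (+ 2) :* a :* b :* b₁ :* d :+ a :* d :* (t :* a)))))
         a₀ a₁ b₀ b₁ d₀ d₁ t₁ Y))

    e₃ : K (+ 14) * X * (a₀ * b₀ * d₀) ≈ K (+ 2) * a₀ * b₀ * d₁ + a₀ * b₁ * d₀ + - (a₁ * b₀ * d₀)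
    e₃ = cancelˡ cd (by-zero (- (a₀ * b₀) · eX ⊞ K 1ℤ · zeta₃)
      (identity 8 (λ a a₁ b b₁ d d₁ t X →
          d :* (con (+ 14) :* X :* (a :* b :* d)) :=
          d :* (con (+ 2) :* a :* b :* d₁ :+ a :* b₁ :* d :- a₁ :* b :* d) :+
          (:- (a :* b) :* (con (ℤ.- + 14) :* X :* (d :* d) :- t :* b) :+
           con 1ℤ :* (a₁ :* b :* d :* d :- (con (+ 2) :* a :* b :* d :* d₁ :+ a :* b₁ :* d :* d :+ a :* b :* (t :* b)))))
         a₀ a₁ b₀ b₁ d₀ d₁ t₁ X))

    j₁ j₂ j₃ : Carrier
    j₁ = K (ℤ.- + 5) * Z + Y + K (ℤ.- + 3) * X
    j₂ = K (ℤ.- + 3) * Z + K (ℤ.- + 5) * Y + X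
    j₃ = - Z + K (+ 3) * Y + K (+ 5) * X

    -- A colon marks the solver term of the expression so named.
    :j₁ :j₂ :j₃ : ∀ {n} → Polynomial n → Polynomial n → Polynomial n → Polynomial n
    :j₁ X Y Z = con (ℤ.- + 5) :* Z :+ Y :+ con (ℤ.- + 3) :* X
    :j₂ X Y Z = con (ℤ.- + 3) :* Z :+ con (ℤ.- + 5) :* Y :+ X
    :j₃ X Y Z = :- Z :+ con (+ 3) :* Y :+ con (+ 5) :* X

    :e₁ :e₂ :e₃ : ∀ {n} (W a a₁ b b₁ d d₁ : Polynomial n) → Polynomial n
    :e₁ W a a₁ b b₁ d d₁ = con (ℤ.- + 14) :* W :* (a :* b :* d) :- (con (+ 2) :* a₁ :* b :* d :+ a :* b₁ :* d :+ a :* b :* d₁)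
    :e₂ W a a₁ b b₁ d d₁ = con (ℤ.- + 14) :* W :* (a :* b :* d) :- (con (+ 2) :* a :* b₁ :* d :- a₁ :* b :* d :- a :* b :* d₁)
    :e₃ W a a₁ b b₁ d d₁ = con (+ 14) :* W :* (a :* b :* d) :- (con (+ 2) :* a :* b :* d₁ :+ a :* b₁ :* d :- a₁ :* b :* d)

    J₁ : a₁ ≈ j₁ * a₀
    J₁ = cancelˡ (Cancellable-* (cK (+ 14) (λ ())) (Cancellable-* cb cd))
      (by-zero (K (ℤ.- + 5) · e₁ ⊞ K 1ℤ · e₂ ⊞ K (+ 3) · e₃)
        (identity 9 (λ a a₁ b b₁ d d₁ X Y Z →
            con (+ 14) :* (b :* d) :* a₁ := con (+ 14) :* (b :* d) :* (:j₁ X Y Z :* a) :+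
            (con (ℤ.- + 5) :* :e₁ Z a a₁ b b₁ d d₁ :+ (con 1ℤ :* :e₂ Y a a₁ b b₁ d d₁ :+ con (+ 3) :* :e₃ X a a₁ b b₁ d d₁)))
           a₀ a₁ b₀ b₁ d₀ d₁ X Y Z))

    J₂ : b₁ ≈ j₂ * b₀
    J₂ = cancelˡ (Cancellable-* (cK (+ 14) (λ ())) (Cancellable-* ca cd))
      (by-zero (K (ℤ.- + 3) · e₁ ⊞ K (ℤ.- + 5) · e₂ ⊞ K -1ℤ · e₃)
        (identity 9 (λ a a₁ b b₁ d d₁ X Y Z →
            con (+ 14) :* (a :* d) :* b₁ := con (+ 14) :* (a :* d) :* (:j₂ X Y Z :* b) :+
            (con (ℤ.- + 3) :* :e₁ Z a a₁ b b₁ d d₁ :+ (con (ℤ.- + 5) :* :e₂ Y a a₁ b b₁ d d₁ :+ con -1ℤ :* :e₃ X a a₁ b b₁ d d₁)))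
           a₀ a₁ b₀ b₁ d₀ d₁ X Y Z))

    J₃ : d₁ ≈ j₃ * d₀
    J₃ = cancelˡ (Cancellable-* (cK (+ 14) (λ ())) (Cancellable-* ca cb))
      (by-zero (K -1ℤ · e₁ ⊞ K (+ 3) · e₂ ⊞ K (ℤ.- + 5) · e₃)
        (identity 9 (λ a a₁ b b₁ d d₁ X Y Z →
            con (+ 14) :* (a :* b) :* d₁ := con (+ 14) :* (a :* b) :* (:j₃ X Y Z :* d) :+
            (con -1ℤ :* :e₁ Z a a₁ b b₁ d d₁ :+ (con (+ 3) :* :e₂ Y a a₁ b b₁ d d₁ :+ con (ℤ.- + 5) :* :e₃ X a a₁ b b₁ d d₁)))
           a₀ a₁ b₀ b₁ d₀ d₁ X Y Z))

    -- The value of `g₂/g₀ + 2 f₂/f₀` given by the duplication formula when `j` and `k` are the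
    -- logarithmic derivatives `f₁/f₀` and `g₁/g₀` and `C` is `t₃/t₁`.
    r : Carrier → Carrier → Carrier
    r j k = C + K (+ 4) * j * k + - (K (+ 2) * j * j)

    :r : ∀ {n} → Polynomial n → Polynomial n → Polynomial n → Polynomial n
    :r C j k = C :+ con (+ 4) :* j :* k :- con (+ 2) :* j :* j

    second : ∀ {f₀ f₁ f₂ g₀ g₁ g₂} j k → Duplication t₁ t₃ f₀ f₁ f₂ g₀ g₁ g₂ → f₁ ≈ j * f₀ → g₁ ≈ k * g₀ →
             Cancellable f₀ → g₂ * f₀ + K (+ 2) * f₂ * g₀ ≈ r j k * (f₀ * g₀)
    second {f₀} {f₁} {f₂} {g₀} {g₁} {g₂} j k dup hf hg cf = cancelˡ (Cancellable-* ct cf)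
      (by-zero (K 1ℤ · dup ⊞ g₀ * (f₀ * f₀) · et
          ⊞ (K (+ 4) * t₁ * f₀ * g₁ + - (K (+ 2) * g₀ * t₁ * (f₁ + j * f₀))) · hf
          ⊞ K (+ 4) * t₁ * (f₀ * f₀) * j · hg)
        (identity 11 (λ f₀ f₁ f₂ g₀ g₁ g₂ j k C t₁ t₃ →
            (t₁ :* f₀) :* (g₂ :* f₀ :+ con (+ 2) :* f₂ :* g₀) := (t₁ :* f₀) :* (:r C j k :* (f₀ :* g₀)) :+
            (con 1ℤ :* (((g₂ :* t₁ :- g₀ :* t₃) :* (f₀ :* f₀) :+ con (+ 2) :* (f₂ :* f₀ :+ f₁ :* f₁) :* (g₀ :* t₁)) :- con (+ 4) :* (f₁ :* f₀) :* (g₁ :* t₁)) :+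
            (g₀ :* (f₀ :* f₀) :* (t₃ :- C :* t₁) :+
            ((con (+ 4) :* t₁ :* f₀ :* g₁ :- con (+ 2) :* g₀ :* t₁ :* (f₁ :+ j :* f₀)) :* (f₁ :- j :* f₀) :+
             con (+ 4) :* t₁ :* (f₀ :* f₀) :* j :* (g₁ :- k :* g₀)))))
           f₀ f₁ f₂ g₀ g₁ g₂ j k C t₁ t₃))

    neg-* : ∀ {g j h} → g ≈ j * h → - g ≈ - j * h
    neg-* {g} {j} {h} p = trans (-‿cong p) (identity 2 (λ j h → :- (j :* h) := :- j :* h)  j h)

    -- Doubling the index leads from `a` to `b`, from `b` to the reflection of `d` and from `d` to
    -- the reflection of `a`. A reflection changes the sign of the logarithmic derivative, hence
    -- `- j₃` and `- j₁`.
    r₁ r₂ r₃ : Carrier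
    r₁ = r j₁ j₂
    r₂ = r j₂ (- j₃)
    r₃ = r j₃ (- j₁)

    u₁ : b₂ * a₀ + K (+ 2) * a₂ * b₀ ≈ r₁ * (a₀ * b₀)
    u₁ = second {a₀} {a₁} {a₂} {b₀} {b₁} {b₂} j₁ j₂ duplication₁ J₁ J₂ ca
    u₂ : d₂ * b₀ + K (+ 2) * b₂ * d₀ ≈ r₂ * (b₀ * d₀)
    u₂ = second {b₀} {b₁} {b₂} {d₀} { - d₁} {d₂} j₂ (- j₃) duplication₂ J₂ (neg-* {j = j₃} J₃) cb
    u₃ : a₂ * d₀ + K (+ 2) * d₂ * a₀ ≈ r₃ * (d₀ * a₀)
    u₃ = second {d₀} {d₁} {d₂} {a₀} { - a₁} {a₂} j₃ (- j₁) duplication₃ J₃ (neg-* {j = j₁} J₁) cd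

    -- The inverse of the circulant system 2 S + S′ = r, 2 S′ + S″ = r′, 2 S″ + S = r″, up to its determinant 9.
    :σ : ∀ {n} → Polynomial n → Polynomial n → Polynomial n → Polynomial n
    :σ r r′ r″ = con (+ 4) :* r :- con (+ 2) :* r′ :+ r″

    σ : Carrier → Carrier → Carrier → Carrier
    σ r r′ r″ = K (+ 4) * r + - (K (+ 2) * r′) + r″

    cyclic : ∀ {f f₂ g g₂ h h₂} r r′ r″ → Cancellable g → Cancellable h →
      g₂ * f + K (+ 2) * f₂ * g ≈ r * (f * g) → h₂ * g + K (+ 2) * g₂ * h ≈ r′ * (g * h) →
      f₂ * h + K (+ 2) * h₂ * f ≈ r″ * (h * f) → K (+ 9) * f₂ ≈ σ r r′ r″ * f
    cyclic {f} {f₂} {g} {g₂} {h} {h₂} r r′ r″ cg ch p q s = cancelˡ (Cancellable-* cg ch)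
      (by-zero (K (+ 4) * h · p ⊞ K (ℤ.- + 2) * f · q ⊞ g · s)
        (identity 9 (λ f f₂ g g₂ h h₂ r r′ r″ →
            g :* h :* (con (+ 9) :* f₂) := g :* h :* (:σ r r′ r″ :* f) :+
            (con (+ 4) :* h :* (g₂ :* f :+ con (+ 2) :* f₂ :* g :- r :* (f :* g)) :+
            (con (ℤ.- + 2) :* f :* (h₂ :* g :+ con (+ 2) :* g₂ :* h :- r′ :* (g :* h)) :+
             g :* (f₂ :* h :+ con (+ 2) :* h₂ :* f :- r″ :* (h :* f)))))
           f f₂ g g₂ h h₂ r r′ r″))

    s₁ : K (+ 9) * a₂ ≈ σ r₁ r₂ r₃ * a₀
    s₁ = cyclic {a₀} {a₂} {b₀} {b₂} {d₀} {d₂} r₁ r₂ r₃ cb cd u₁ u₂ u₃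
    s₂ : K (+ 9) * b₂ ≈ σ r₂ r₃ r₁ * b₀
    s₂ = cyclic {b₀} {b₂} {d₀} {d₂} {a₀} {a₂} r₂ r₃ r₁ cd ca u₂ u₃ u₁
    s₃ : K (+ 9) * d₂ ≈ σ r₃ r₁ r₂ * d₀
    s₃ = cyclic {d₀} {d₂} {a₀} {a₂} {b₀} {b₂} r₃ r₁ r₂ ca cb u₃ u₁ u₂

    θt₁ : θ t₁ ≈ C * t₁
    θt₁ = trans (θ-t₁) et

    -- Logarithmic differentiation of `W = t₁ g / (k f²)`: the factor `t₁` contributes `C`, while
    -- `g` and `f` contribute `g₂/g` and `f₂/f` by the heat equation. The factor 9 is the
    -- determinant left over from `cyclic`.
    logarithmic : ∀ {k W f f₂ g g₂} ρ τ → Cancellable (K k) → Cancellable f →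
      θ f ≈ f₂ → θ g ≈ g₂ →
      K k * W * (f * f) ≈ t₁ * g → K (+ 9) * f₂ ≈ ρ * f → K (+ 9) * g₂ ≈ τ * g →
      K (+ 9) * θ W ≈ W * (K (+ 9) * C + τ + - (K (+ 2) * ρ))
    logarithmic {k} {W} {f} {f₂} {g} {g₂} ρ τ ck cf θf θg h hf hg = cancelˡ (Cancellable-* ck (Cancellable-* cf cf))
      (by-zero (K (+ 9) · h′ ⊞ K (ℤ.- + 2) * K k * W * f · hf ⊞ t₁ · hg ⊞ - (K (+ 9) * C + τ) · h)
        (identity 11 (λ k W W′ f f₂ g g₂ t C ρ τ →
            k :* (f :* f) :* (con (+ 9) :* W′) :=
            k :* (f :* f) :* (W :* (con (+ 9) :* C :+ τ :- con (+ 2) :* ρ)) :+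
            (con (+ 9) :* (k :* (W′ :* (f :* f) :+ W :* (f₂ :* f :+ f :* f₂)) :- (C :* t :* g :+ t :* g₂)) :+
            (con (ℤ.- + 2) :* k :* W :* f :* (con (+ 9) :* f₂ :- ρ :* f) :+
            (t :* (con (+ 9) :* g₂ :- τ :* g) :+
             :- (con (+ 9) :* C :+ τ) :* (k :* W :* (f :* f) :- t :* g)))))
           (K k) W (θ W) f f₂ g g₂ t₁ C ρ τ))
      where
      h′ : K k * (θ W * (f * f) + W * (f₂ * f + f * f₂)) ≈ C * t₁ * g + t₁ * g₂
      h′ = begin
        K k * (θ W * (f * f) + W * (f₂ * f + f * f₂))
          ≈⟨ *-cong ≈-refl (+-cong ≈-refl (*-cong ≈-refl
               (trans (+-cong (*-cong (sym θf) ≈-refl) (*-cong ≈-refl (sym θf))) (sym (θ-* f f))))) ⟩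
        K k * (θ W * (f * f) + W * θ (f * f))
          ≈⟨ *-cong ≈-refl (sym (θ-* W (f * f))) ⟩
        K k * θ (W * (f * f))
          ≈⟨ sym (θ-K* k (W * (f * f))) ⟩
        θ (K k * (W * (f * f)))
          ≈⟨ θ-cong (trans (sym (*-assoc (K k) W (f * f))) h) ⟩
        θ (t₁ * g)
          ≈⟨ θ-* t₁ g ⟩
        θ t₁ * g + t₁ * θ g
          ≈⟨ +-cong (*-cong θt₁ ≈-refl) (*-cong ≈-refl θg) ⟩
        C * t₁ * g + t₁ * g₂ ∎
        where open SetoidReasoning setoid

    form : (U V W p q : Carrier) → Carrier
    form U V W p q = K (+ 5) * (V * V) + K (+ 5) * (W * W) + - (K (+ 7) * (U * U)) + K (+ 20) * p + K (+ 52) * q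

    tX tY tZ : Carrier
    tX = form X Y Z (Y * Z) (X * Y)
    tY = form Y Z X (X * Z) (Y * Z)
    tZ = form Z X Y (X * Y) (X * Z)

    :form : ∀ {n} (U V W p q : Polynomial n) → Polynomial n
    :form U V W p q = con (+ 5) :* (V :* V) :+ con (+ 5) :* (W :* W) :- con (+ 7) :* (U :* U) :+ con (+ 20) :* p :+ con (+ 52) :* q

    :tX :tY :tZ : ∀ {n} → Polynomial n → Polynomial n → Polynomial n → Polynomial n
    :tX X Y Z = :form X Y Z (Y :* Z) (X :* Y)
    :tY X Y Z = :form Y Z X (X :* Z) (Y :* Z)
    :tZ X Y Z = :form Z X Y (X :* Y) (X :* Z)

    :conic : ∀ {n} → Polynomial n → Polynomial n → Polynomial n → Polynomial n
    :conic X Y Z = X :* Y :+ Y :* Z :+ Z :* X :- con 0ℤ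

    :σ₁ :σ₂ :σ₃ : ∀ {n} → Polynomial n → Polynomial n → Polynomial n → Polynomial n → Polynomial n
    :σ₁ X Y Z C = :σ (:r C (:j₁ X Y Z) (:j₂ X Y Z)) (:r C (:j₂ X Y Z) (:- :j₃ X Y Z)) (:r C (:j₃ X Y Z) (:- :j₁ X Y Z))
    :σ₂ X Y Z C = :σ (:r C (:j₂ X Y Z) (:- :j₃ X Y Z)) (:r C (:j₃ X Y Z) (:- :j₁ X Y Z)) (:r C (:j₁ X Y Z) (:j₂ X Y Z))
    :σ₃ X Y Z C = :σ (:r C (:j₃ X Y Z) (:- :j₁ X Y Z)) (:r C (:j₁ X Y Z) (:j₂ X Y Z)) (:r C (:j₂ X Y Z) (:- :j₃ X Y Z))

    -- The quadratic forms supplied by the logarithmic derivatives agree with those below only modulo the conic,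
    -- of which they differ by the multiple -1148.
    ode-X : K (+ 3) * θ X ≈ X * (K (+ 2) * C + K (+ 14) * tX)
    ode-X = cancelˡ (cK (+ 3) (λ ())) (by-zero
      (K 1ℤ · logarithmic (σ r₃ r₁ r₂) (σ r₂ r₃ r₁) (cK (ℤ.- + 14) (λ ())) cd θd₀ θb₀ eX s₃ s₂
        ⊞ K (ℤ.- + 1148) * X · conic)
      (identity 5 (λ X Y Z C X′ →
          con (+ 3) :* (con (+ 3) :* X′) := con (+ 3) :* (X :* (con (+ 2) :* C :+ con (+ 14) :* :tX X Y Z)) :+
          (con 1ℤ :* (con (+ 9) :* X′ :- X :* (con (+ 9) :* C :+ :σ₂ X Y Z C :- con (+ 2) :* :σ₃ X Y Z C)) :+
           con (ℤ.- + 1148) :* X :* :conic X Y Z))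
        X Y Z C (θ X)))

    ode-Y : K (+ 3) * θ Y ≈ Y * (K (+ 2) * C + K (+ 14) * tY)
    ode-Y = cancelˡ (cK (+ 3) (λ ())) (by-zero
      (K 1ℤ · logarithmic (σ r₂ r₃ r₁) (σ r₁ r₂ r₃) (cK (+ 14) (λ ())) cb θb₀ θa₀ eY s₂ s₁
        ⊞ K (ℤ.- + 1148) * Y · conic)
      (identity 5 (λ X Y Z C Y′ →
          con (+ 3) :* (con (+ 3) :* Y′) := con (+ 3) :* (Y :* (con (+ 2) :* C :+ con (+ 14) :* :tY X Y Z)) :+
          (con 1ℤ :* (con (+ 9) :* Y′ :- Y :* (con (+ 9) :* C :+ :σ₁ X Y Z C :- con (+ 2) :* :σ₂ X Y Z C)) :+
           con (ℤ.- + 1148) :* Y :* :conic X Y Z))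
        X Y Z C (θ Y)))

    ode-Z : K (+ 3) * θ Z ≈ Z * (K (+ 2) * C + K (+ 14) * tZ)
    ode-Z = cancelˡ (cK (+ 3) (λ ())) (by-zero
      (K 1ℤ · logarithmic (σ r₁ r₂ r₃) (σ r₃ r₁ r₂) (cK (ℤ.- + 14) (λ ())) ca θa₀ θd₀ eZ s₁ s₃
        ⊞ K (ℤ.- + 1148) * Z · conic)
      (identity 5 (λ X Y Z C Z′ →
          con (+ 3) :* (con (+ 3) :* Z′) := con (+ 3) :* (Z :* (con (+ 2) :* C :+ con (+ 14) :* :tZ X Y Z)) :+
          (con 1ℤ :* (con (+ 9) :* Z′ :- Z :* (con (+ 9) :* C :+ :σ₃ X Y Z C :- con (+ 2) :* :σ₁ X Y Z C)) :+
           con (ℤ.- + 1148) :* Z :* :conic X Y Z))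
        X Y Z C (θ Z)))

    -- 3 τ is σ r₁ r₂ r₃ - 44 (X Y + Y Z + Z X).
    W τ : Carrier
    W = K (ℤ.- + 11) * (X * X) + K (ℤ.- + 44) * (X * Z) + K (ℤ.- + 23) * (Y * Y) + K (+ 92) * (Y * Z) + K (+ 13) * (Z * Z)
    τ = C + K (+ 2) * W

    :W : ∀ {n} → Polynomial n → Polynomial n → Polynomial n → Polynomial n
    :W X Y Z = con (ℤ.- + 11) :* (X :* X) :+ con (ℤ.- + 44) :* (X :* Z) :+ con (ℤ.- + 23) :* (Y :* Y) :+ con (+ 92) :* (Y :* Z) :+ con (+ 13) :* (Z :* Z)

    -- Subtracting 44 times the conic removes the monomial `X Y` from `σ r₁ r₂ r₃` and makes the
    -- remaining coefficients divisible by 3, so that one of the two factors 3 cancels.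
    a₂≈ : K (+ 3) * a₂ ≈ τ * a₀
    a₂≈ = cancelˡ (cK (+ 3) (λ ())) (by-zero (K 1ℤ · s₁ ⊞ K (+ 44) * a₀ · conic)
      (identity 6 (λ X Y Z C a a₂ →
          con (+ 3) :* (con (+ 3) :* a₂) := con (+ 3) :* ((C :+ con (+ 2) :* :W X Y Z) :* a) :+
          (con 1ℤ :* (con (+ 9) :* a₂ :- :σ₁ X Y Z C :* a) :+ con (+ 44) :* a :* :conic X Y Z))
        X Y Z C a₀ a₂))

    -- By the heat equation the derivatives of order 3, 4 and 5 are q-derivatives of those of order
    -- 1, 2 and 3, which are already known multiples of `a₀` and `t₁`. In this way `quartic` becomes
    -- a relation between `C`, `j₁`, `τ` and their q-derivatives.
    a₃≈ : a₃ ≈ θ j₁ * a₀ + j₁ * a₂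
    a₃≈ = trans (sym θa₁) (trans (θ-cong J₁) (trans (θ-* j₁ a₀) (+-congˡ (*-congˡ θa₀))))

    a₄≈ : K (+ 3) * a₄ ≈ θ τ * a₀ + τ * a₂
    a₄≈ = trans (*-congˡ (sym θa₂)) (trans (sym (θ-K* (+ 3) a₂)) (trans (θ-cong a₂≈)
      (trans (θ-* τ a₀) (+-congˡ (*-congˡ θa₀)))))

    t₅≈ : t₅ ≈ (θ C + C * C) * t₁
    t₅≈ = trans (sym θ-t₃) (trans (θ-cong et) (trans (θ-* C t₁) (trans (+-congˡ (*-congˡ θt₁))
      (identity 3 (λ C C′ t → C′ :* t :+ C :* (C :* t) := (C′ :+ C :* C) :* t) C (θ C) t₁))))

    -- The derivative of `C` enters through `t₃² - t₁ t₅ = - t₁² θ C`; the rest is division by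
    -- `4 t₁²`.
    quarticᴬ : K (+ 4) * C * (a₂ * a₀ + - (a₁ * a₁)) + - (θ C * (a₀ * a₀)) ≈ a₄ * a₀ + - (K (+ 4) * a₃ * a₁) + K (+ 3) * a₂ * a₂
    quarticᴬ = cancelˡ (Cancellable-* (cK (+ 4) (λ ())) (Cancellable-* ct ct)) (by-zero
      (K 1ℤ · quartic
        ⊞ - (K (+ 4) * (a₀ * a₀) * (t₃ + C * t₁) + K (+ 16) * t₁ * (a₂ * a₀ + - (a₁ * a₁))) · et
        ⊞ K (+ 4) * t₁ * (a₀ * a₀) · t₅≈)
      (identity 10 (λ C C′ t₃ t₅ t₁ a₃ a₄ a₂ a₁ a →
          con (+ 4) :* (t₁ :* t₁) :* (con (+ 4) :* C :* (a₂ :* a :- a₁ :* a₁) :- C′ :* (a :* a)) :=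
          con (+ 4) :* (t₁ :* t₁) :* (a₄ :* a :- con (+ 4) :* a₃ :* a₁ :+ con (+ 3) :* a₂ :* a₂) :+
          (con 1ℤ :* (con (+ 4) :* (t₃ :* t₃ :- t₁ :* t₅) :* (a :* a) :+ con (+ 16) :* (t₁ :* t₃) :* (a₂ :* a :- a₁ :* a₁)
            :- con (+ 4) :* (t₁ :* t₁) :* (a₄ :* a :- con (+ 4) :* a₃ :* a₁ :+ con (+ 3) :* a₂ :* a₂)) :+
          (:- (con (+ 4) :* (a :* a) :* (t₃ :+ C :* t₁) :+ con (+ 16) :* t₁ :* (a₂ :* a :- a₁ :* a₁)) :* (t₃ :- C :* t₁) :+
           con (+ 4) :* t₁ :* (a :* a) :* (t₅ :- (C′ :+ C :* C) :* t₁))))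
        C (θ C) t₃ t₅ t₁ a₃ a₄ a₂ a₁ a₀))

    quarticᴮ : K (+ 4) * C * (a₂ * a₀ + - (j₁ * j₁ * (a₀ * a₀))) + - (θ C * (a₀ * a₀))
             ≈ a₄ * a₀ + - (K (+ 4) * (θ j₁ * a₀ + j₁ * a₂) * (j₁ * a₀)) + K (+ 3) * a₂ * a₂
    quarticᴮ = by-zero
      (K 1ℤ · quarticᴬ ⊞ (K (+ 4) * C * (a₁ + j₁ * a₀) + - (K (+ 4) * (θ j₁ * a₀ + j₁ * a₂))) · J₁ ⊞ - (K (+ 4) * a₁) · a₃≈)
      (identity 9 (λ C C′ j′ a₃ a₄ j a₁ a₂ a →
          con (+ 4) :* C :* (a₂ :* a :- j :* j :* (a :* a)) :- C′ :* (a :* a) :=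
          a₄ :* a :- con (+ 4) :* (j′ :* a :+ j :* a₂) :* (j :* a) :+ con (+ 3) :* a₂ :* a₂ :+
          (con 1ℤ :* (con (+ 4) :* C :* (a₂ :* a :- a₁ :* a₁) :- C′ :* (a :* a) :- (a₄ :* a :- con (+ 4) :* a₃ :* a₁ :+ con (+ 3) :* a₂ :* a₂)) :+
          ((con (+ 4) :* C :* (a₁ :+ j :* a) :- con (+ 4) :* (j′ :* a :+ j :* a₂)) :* (a₁ :- j :* a) :+
           :- (con (+ 4) :* a₁) :* (a₃ :- (j′ :* a :+ j :* a₂)))))
        C (θ C) (θ j₁) a₃ a₄ j₁ a₁ a₂ a₀)

    -- Division of `quarticᴮ` by `a₀²`. The preceding multiplication by 9 absorbs the denominators 3
    -- of `a₂` and `a₄`.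
    quarticᶜ : K (+ 12) * (C * (τ + - (K (+ 3) * (j₁ * j₁)))) + K (ℤ.- + 9) * θ C
             ≈ K (+ 3) * θ τ + K (+ 4) * (τ * τ) + - (K (+ 36) * (j₁ * θ j₁)) + - (K (+ 12) * (j₁ * j₁ * τ))
    quarticᶜ = cancelˡ (Cancellable-* ca ca) (by-zero
      (K (+ 9) · quarticᴮ
        ⊞ (- (K (+ 12) * C * a₀) + K (+ 4) * τ * a₀ + K (+ 9) * a₂ + - (K (+ 12) * (j₁ * j₁) * a₀)) · a₂≈
        ⊞ K (+ 3) * a₀ · a₄≈)
      (identity 9 (λ C′ j′ τ′ a₄ C j τ a₂ a →
          a :* a :* (con (+ 12) :* (C :* (τ :- con (+ 3) :* (j :* j))) :+ con (ℤ.- + 9) :* C′) :=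
          a :* a :* (con (+ 3) :* τ′ :+ con (+ 4) :* (τ :* τ) :- con (+ 36) :* (j :* j′) :- con (+ 12) :* (j :* j :* τ)) :+
          (con (+ 9) :* (con (+ 4) :* C :* (a₂ :* a :- j :* j :* (a :* a)) :- C′ :* (a :* a)
            :- (a₄ :* a :- con (+ 4) :* (j′ :* a :+ j :* a₂) :* (j :* a) :+ con (+ 3) :* a₂ :* a₂)) :+
          ((:- (con (+ 12) :* C :* a) :+ con (+ 4) :* τ :* a :+ con (+ 9) :* a₂ :- con (+ 12) :* (j :* j) :* a) :* (con (+ 3) :* a₂ :- τ :* a) :+
           con (+ 3) :* a :* (con (+ 3) :* a₄ :- (τ′ :* a :+ τ :* a₂)))))
        (θ C) (θ j₁) (θ τ) a₄ C j₁ τ a₂ a₀))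

    θ-K*² : ∀ c f g → θ (K c * (f * g)) ≈ K c * (θ f * g + f * θ g)
    θ-K*² c f g = trans (θ-K* c (f * g)) (*-congˡ (θ-* f g))

    θj₁ : θ j₁ ≈ K (ℤ.- + 5) * θ Z + θ Y + K (ℤ.- + 3) * θ X
    θj₁ = trans (θ-+ _ _) (+-cong (trans (θ-+ _ _) (+-congʳ (θ-K* (ℤ.- + 5) Z))) (θ-K* (ℤ.- + 3) X))

    θτ : θ τ ≈ θ C + K (+ 2) * (K (ℤ.- + 11) * (θ X * X + X * θ X) + K (ℤ.- + 44) * (θ X * Z + X * θ Z)
           + K (ℤ.- + 23) * (θ Y * Y + Y * θ Y) + K (+ 92) * (θ Y * Z + Y * θ Z) + K (+ 13) * (θ Z * Z + Z * θ Z))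
    θτ = trans (θ-+ _ _) (+-congˡ (trans (θ-K* (+ 2) W) (*-congˡ
      (trans (θ-+ _ _) (+-cong
        (trans (θ-+ _ _) (+-cong
          (trans (θ-+ _ _) (+-cong
            (trans (θ-+ _ _) (+-cong (θ-K*² (ℤ.- + 11) X X) (θ-K*² (ℤ.- + 44) X Z)))
            (θ-K*² (ℤ.- + 23) Y Y)))
          (θ-K*² (+ 92) Y Z)))
        (θ-K*² (+ 13) Z Z))))))

    F : Carrier
    F = X * X * X * X + K (+ 4) * X * X * X * Y + K (+ 12) * X * Y * Y * Y + Y * Y * Y * Y + K (+ 12) * X * X * X * Z
      + K (+ 4) * Y * Y * Y * Z + K (+ 4) * X * Z * Z * Z + K (+ 12) * Y * Z * Z * Z + Z * Z * Z * Z

    :F : ∀ {n} → Polynomial n → Polynomial n → Polynomial n → Polynomial n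
    :F X Y Z = X :* X :* X :* X :+ con (+ 4) :* X :* X :* X :* Y :+ con (+ 12) :* X :* Y :* Y :* Y :+ Y :* Y :* Y :* Y :+ con (+ 12) :* X :* X :* X :* Z
      :+ con (+ 4) :* Y :* Y :* Y :* Z :+ con (+ 4) :* X :* Z :* Z :* Z :+ con (+ 12) :* Y :* Z :* Z :* Z :+ Z :* Z :* Z :* Z

    -- The last cofactor is the quotient by X Y + Y Z + Z X of the difference of the two sides, after elimination of
    -- all derivatives.
    ode-C : K (+ 3) * θ C ≈ K (+ 2) * (C * C) + - (K (+ 4802) * F)
    ode-C = cancelˡ (cK (+ 4) (λ ())) (by-zero
      (K -1ℤ · quarticᶜ
        ⊞ K (ℤ.- + 3) · θτ ⊞ K (+ 36) * j₁ · θj₁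
        -- The cofactors of `ode-X`, `ode-Y` and `ode-Z` are minus one third of the coefficients
        -- with which `θ X`, `θ Y` and `θ Z` occur once `θ τ` and `θ j₁` are expanded.
        ⊞ (K (+ 12) * j₁ * K (ℤ.- + 3) + - (K (+ 2) * (K (ℤ.- + 22) * X + K (ℤ.- + 44) * Z))) · ode-X
        ⊞ (K (+ 12) * j₁ + - (K (+ 2) * (K (ℤ.- + 46) * Y + K (+ 92) * Z))) · ode-Y
        ⊞ (K (+ 12) * j₁ * K (ℤ.- + 5) + - (K (+ 2) * (K (ℤ.- + 44) * X + K (+ 92) * Y + K (+ 26) * Z))) · ode-Z
        ⊞ (K (+ 190080) * (X * X) + K (ℤ.- + 21616) * (X * Y) + K (+ 161232) * (X * Z)
             + K (+ 234816) * (Y * Y) + K (ℤ.- + 314416) * (Y * Z) + K (+ 251136) * (Z * Z)) · conic)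
      (identity 10 (λ X Y Z C X′ Y′ Z′ C′ τ′ j′ → let τ = C :+ con (+ 2) :* :W X Y Z ; j = :j₁ X Y Z in
          con (+ 4) :* (con (+ 3) :* C′) := con (+ 4) :* (con (+ 2) :* (C :* C) :- con (+ 4802) :* :F X Y Z) :+
          (con -1ℤ :* (con (+ 12) :* (C :* (τ :- con (+ 3) :* (j :* j))) :+ con (ℤ.- + 9) :* C′
             :- (con (+ 3) :* τ′ :+ con (+ 4) :* (τ :* τ) :- con (+ 36) :* (j :* j′) :- con (+ 12) :* (j :* j :* τ))) :+
          (con (ℤ.- + 3) :* (τ′ :- (C′ :+ con (+ 2) :* (con (ℤ.- + 11) :* (X′ :* X :+ X :* X′) :+ con (ℤ.- + 44) :* (X′ :* Z :+ X :* Z′)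
             :+ con (ℤ.- + 23) :* (Y′ :* Y :+ Y :* Y′) :+ con (+ 92) :* (Y′ :* Z :+ Y :* Z′) :+ con (+ 13) :* (Z′ :* Z :+ Z :* Z′)))) :+
          (con (+ 36) :* j :* (j′ :- (con (ℤ.- + 5) :* Z′ :+ Y′ :+ con (ℤ.- + 3) :* X′)) :+
          ((con (+ 12) :* j :* con (ℤ.- + 3) :- con (+ 2) :* (con (ℤ.- + 22) :* X :+ con (ℤ.- + 44) :* Z)) :*
             (con (+ 3) :* X′ :- X :* (con (+ 2) :* C :+ con (+ 14) :* :tX X Y Z)) :+
          ((con (+ 12) :* j :- con (+ 2) :* (con (ℤ.- + 46) :* Y :+ con (+ 92) :* Z)) :*
             (con (+ 3) :* Y′ :- Y :* (con (+ 2) :* C :+ con (+ 14) :* :tY X Y Z)) :+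
          ((con (+ 12) :* j :* con (ℤ.- + 5) :- con (+ 2) :* (con (ℤ.- + 44) :* X :+ con (+ 92) :* Y :+ con (+ 26) :* Z)) :*
             (con (+ 3) :* Z′ :- Z :* (con (+ 2) :* C :+ con (+ 14) :* :tZ X Y Z)) :+
           (con (+ 190080) :* (X :* X) :+ con (ℤ.- + 21616) :* (X :* Y) :+ con (+ 161232) :* (X :* Z)
             :+ con (+ 234816) :* (Y :* Y) :+ con (ℤ.- + 314416) :* (Y :* Z) :+ con (+ 251136) :* (Z :* Z)) :* :conic X Y Z)))))))
        X Y Z C (θ X) (θ Y) (θ Z) (θ C) (θ τ) (θ j₁)))

open import Relation.Binary.PropositionalEquality using (sym; trans; subst; module ≡-Reasoning)

-- Formal power series over ℤ as a commutative ring

sum-cong : ∀ n {f g : ℕ → ℤ} → (∀ i → i ℕ.< n → f i ≡ g i) → sumℤ n f ≡ sumℤ n g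
sum-cong zero    _ = refl
sum-cong (suc n) h = cong₂ ℤ._+_ (sum-cong n (λ i i<n → h i (ℕP.m<n⇒m<1+n i<n))) (h n ℕP.≤-refl)

sum-0 : ∀ n → sumℤ n (λ _ → 0ℤ) ≡ 0ℤ
sum-0 zero    = refl
sum-0 (suc n) = trans (ℤP.+-identityʳ _) (sum-0 n)

sum-+ : ∀ n f g → sumℤ n (λ i → f i ℤ.+ g i) ≡ sumℤ n f ℤ.+ sumℤ n g
sum-+ zero    f g = refl
sum-+ (suc n) f g = trans (cong (λ e → e ℤ.+ (f n ℤ.+ g n)) (sum-+ n f g)) (lem (sumℤ n f) (sumℤ n g) (f n) (g n))
  where
  lem : ∀ a b c d → (a ℤ.+ b) ℤ.+ (c ℤ.+ d) ≡ (a ℤ.+ c) ℤ.+ (b ℤ.+ d)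
  lem = solve-∀

sum-*ˡ : ∀ n c f → sumℤ n (λ i → c ℤ.* f i) ≡ c ℤ.* sumℤ n f
sum-*ˡ zero    c f = sym (ℤP.*-zeroʳ c)
sum-*ˡ (suc n) c f = trans (cong (λ e → e ℤ.+ c ℤ.* f n) (sum-*ˡ n c f)) (sym (ℤP.*-distribˡ-+ c (sumℤ n f) (f n)))

sum-shift : ∀ n f → sumℤ (suc n) f ≡ f 0 ℤ.+ sumℤ n (λ i → f (suc i))
sum-shift zero    f = ℤP.+-comm 0ℤ (f 0)
sum-shift (suc n) f = trans (cong (λ e → e ℤ.+ f (suc n)) (sum-shift n f))
                          (ℤP.+-assoc (f 0) (sumℤ n (λ i → f (suc i))) (f (suc n)))

tail : FPS → FPS
tail f n = f (suc n)

-- Splitting off the constant term of one factor gives a recursion through `tail`. Commutativity,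
-- associativity and cancellation all follow by induction on the index of the coefficient, with the
-- series generalised.
⊗-suc : ∀ f g n → (f ⊗ g) (suc n) ≡ f 0 ℤ.* g (suc n) ℤ.+ (tail f ⊗ g) n
⊗-suc f g n = sum-shift (suc n) (λ i → f i ℤ.* g (suc n ∸ i))

⊗-sucʳ : ∀ f g n → (f ⊗ g) (suc n) ≡ (f ⊗ tail g) n ℤ.+ f (suc n) ℤ.* g 0
⊗-sucʳ f g n = cong₂ ℤ._+_
  (sum-cong (suc n) (λ { i (s≤s i≤n) → cong (λ k → f i ℤ.* g k) (ℕP.+-∸-assoc 1 i≤n) }))
  (cong (λ k → f (suc n) ℤ.* g k) (ℕP.n∸n≡0 n))

-- A record, so that f and g can be inferred from a proof of f ≈ g.
infix 4 _≈_
record _≈_ (f g : FPS) : Set where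
  constructor coeffs
  field coeff : f ≐ g
open _≈_ public

≈-refl : ∀ {f} → f ≈ f
≈-refl = coeffs (λ _ → refl)

≈-sym : ∀ {f g} → f ≈ g → g ≈ f
≈-sym p = coeffs (λ n → sym (coeff p n))

≈-trans : ∀ {f g h} → f ≈ g → g ≈ h → f ≈ h
≈-trans p q = coeffs (λ n → trans (coeff p n) (coeff q n))

⊗-cong-≤ : ∀ {f f′ g g′} n → (∀ i → i ℕ.≤ n → f i ≡ f′ i) → (∀ i → i ℕ.≤ n → g i ≡ g′ i) →
           (f ⊗ g) n ≡ (f′ ⊗ g′) n
⊗-cong-≤ n p q = sum-cong (suc n) (λ { i (s≤s i≤n) → cong₂ ℤ._*_ (p i i≤n) (q (n ∸ i) (ℕP.m∸n≤m n i)) })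

⊗-cong : ∀ {f f′ g g′} → f ≈ f′ → g ≈ g′ → f ⊗ g ≈ f′ ⊗ g′
⊗-cong p q = coeffs (λ n → ⊗-cong-≤ n (λ i _ → coeff p i) (λ i _ → coeff q i))

⊗-comm : ∀ f g → f ⊗ g ≈ g ⊗ f
⊗-comm f g = coeffs (go f g)
  where
  go : ∀ f g → f ⊗ g ≐ g ⊗ f
  go f g zero    = cong (λ e → 0ℤ ℤ.+ e) (ℤP.*-comm (f 0) (g 0))
  go f g (suc n) = begin
    (f ⊗ g) (suc n)                          ≡⟨ ⊗-suc f g n ⟩
    f 0 ℤ.* g (suc n) ℤ.+ (tail f ⊗ g) n     ≡⟨ cong₂ ℤ._+_ (ℤP.*-comm (f 0) _) (go (tail f) g n) ⟩
    g (suc n) ℤ.* f 0 ℤ.+ (g ⊗ tail f) n     ≡⟨ ℤP.+-comm (g (suc n) ℤ.* f 0) _ ⟩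
    (g ⊗ tail f) n ℤ.+ g (suc n) ℤ.* f 0     ≡⟨ sym (⊗-sucʳ g f n) ⟩
    (g ⊗ f) (suc n)                          ∎
    where open ≡-Reasoning

⊗-distribʳ : ∀ h f g → (f ⊕ g) ⊗ h ≈ f ⊗ h ⊕ g ⊗ h
⊗-distribʳ h f g = coeffs (λ n → trans
  (sum-cong (suc n) (λ i _ → ℤP.*-distribʳ-+ (h (n ∸ i)) (f i) (g i)))
  (sum-+ (suc n) (λ i → f i ℤ.* h (n ∸ i)) (λ i → g i ℤ.* h (n ∸ i))))

⋆-⊗ : ∀ c f g → (c ⋆ f) ⊗ g ≈ c ⋆ (f ⊗ g)
⋆-⊗ c f g = coeffs (λ n → trans
  (sum-cong (suc n) (λ i _ → ℤP.*-assoc c (f i) (g (n ∸ i))))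
  (sum-*ˡ (suc n) c (λ i → f i ℤ.* g (n ∸ i))))

⊗-assoc : ∀ f g h → (f ⊗ g) ⊗ h ≈ f ⊗ (g ⊗ h)
⊗-assoc f g h = coeffs (go f g h)
  where
  lem₀ : ∀ a b c → 0ℤ ℤ.+ (0ℤ ℤ.+ a ℤ.* b) ℤ.* c ≡ 0ℤ ℤ.+ a ℤ.* (0ℤ ℤ.+ b ℤ.* c)
  lem₀ = solve-∀
  lem : ∀ a b c d e → (0ℤ ℤ.+ a ℤ.* b) ℤ.* c ℤ.+ (a ℤ.* d ℤ.+ e) ≡ a ℤ.* (b ℤ.* c ℤ.+ d) ℤ.+ e
  lem = solve-∀
  go : ∀ f g h → (f ⊗ g) ⊗ h ≐ f ⊗ (g ⊗ h)
  go f g h zero    = lem₀ (f 0) (g 0) (h 0)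
  go f g h (suc n) = begin
    ((f ⊗ g) ⊗ h) (suc n)
      ≡⟨ ⊗-suc (f ⊗ g) h n ⟩
    (f ⊗ g) 0 ℤ.* h (suc n) ℤ.+ (tail (f ⊗ g) ⊗ h) n
      ≡⟨ cong (λ e → (f ⊗ g) 0 ℤ.* h (suc n) ℤ.+ e) (begin
           (tail (f ⊗ g) ⊗ h) n
             ≡⟨ coeff (⊗-cong {g = h} (coeffs (⊗-suc f g)) ≈-refl) n ⟩
           (((f 0 ⋆ tail g) ⊕ (tail f ⊗ g)) ⊗ h) n
             ≡⟨ coeff (⊗-distribʳ h (f 0 ⋆ tail g) (tail f ⊗ g)) n ⟩
           ((f 0 ⋆ tail g) ⊗ h) n ℤ.+ ((tail f ⊗ g) ⊗ h) n
             ≡⟨ cong₂ ℤ._+_ (coeff (⋆-⊗ (f 0) (tail g) h) n) (go (tail f) g h n) ⟩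
           f 0 ℤ.* (tail g ⊗ h) n ℤ.+ (tail f ⊗ (g ⊗ h)) n ∎) ⟩
    (f ⊗ g) 0 ℤ.* h (suc n) ℤ.+ (f 0 ℤ.* (tail g ⊗ h) n ℤ.+ (tail f ⊗ (g ⊗ h)) n)
      ≡⟨ lem (f 0) (g 0) (h (suc n)) _ _ ⟩
    f 0 ℤ.* (g 0 ℤ.* h (suc n) ℤ.+ (tail g ⊗ h) n) ℤ.+ (tail f ⊗ (g ⊗ h)) n
      ≡⟨ cong (λ e → f 0 ℤ.* e ℤ.+ (tail f ⊗ (g ⊗ h)) n) (sym (⊗-suc g h n)) ⟩
    f 0 ℤ.* (g ⊗ h) (suc n) ℤ.+ (tail f ⊗ (g ⊗ h)) n
      ≡⟨ sym (⊗-suc f (g ⊗ h) n) ⟩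
    (f ⊗ (g ⊗ h)) (suc n) ∎
    where open ≡-Reasoning

zeroS : FPS
zeroS _ = 0ℤ

zeroˡ : ∀ f → zeroS ⊗ f ≈ zeroS
zeroˡ f = coeffs (λ n → sum-0 (suc n))

⊗-identityˡ : ∀ f → one ⊗ f ≈ f
⊗-identityˡ f = coeffs λ
  { zero    → trans (ℤP.+-identityˡ _) (ℤP.*-identityˡ (f 0))
  ; (suc n) → trans (⊗-suc one f n)
                (trans (cong₂ ℤ._+_ (ℤP.*-identityˡ (f (suc n))) (coeff (zeroˡ f) n))
                       (ℤP.+-identityʳ (f (suc n)))) }

FPS-isCommutativeRing : IsCommutativeRing _≈_ _⊕_ _⊗_ neg zeroS one
FPS-isCommutativeRing = record
  { isRing = record
    { +-isAbelianGroup = record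
      { isGroup = record
        { isMonoid = record
          { isSemigroup = record
            { isMagma = record
              { isEquivalence = record { refl = ≈-refl ; sym = ≈-sym ; trans = ≈-trans }
              ; ∙-cong = λ p q → coeffs (λ n → cong₂ ℤ._+_ (coeff p n) (coeff q n)) }
            ; assoc = λ f g h → coeffs (λ n → ℤP.+-assoc (f n) (g n) (h n)) }
          ; identity = (λ f → coeffs (λ n → ℤP.+-identityˡ (f n)))
                     , (λ f → coeffs (λ n → ℤP.+-identityʳ (f n))) }
        ; inverse = (λ f → coeffs (λ n → ℤP.+-inverseˡ (f n)))
                  , (λ f → coeffs (λ n → ℤP.+-inverseʳ (f n)))
        ; ⁻¹-cong = λ p → coeffs (λ n → cong ℤ.-_ (coeff p n)) }
      ; comm = λ f g → coeffs (λ n → ℤP.+-comm (f n) (g n)) }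
    ; *-cong = ⊗-cong
    ; *-assoc = ⊗-assoc
    ; *-identity = ⊗-identityˡ , (λ f → ≈-trans (⊗-comm f one) (⊗-identityˡ f))
    ; distrib = (λ h f g → ≈-trans (⊗-comm h (f ⊕ g)) (≈-trans (⊗-distribʳ h f g)
                   (coeffs (λ n → cong₂ ℤ._+_ (coeff (⊗-comm f h) n) (coeff (⊗-comm g h) n)))))
              , ⊗-distribʳ }
  ; *-comm = ⊗-comm }

FPS-commutativeRing : CommutativeRing 0ℓ 0ℓ
FPS-commutativeRing = record { isCommutativeRing = FPS-isCommutativeRing }

open CommutativeRing FPS-commutativeRing public
  using ()
  renaming (setoid to FPS-setoid; +-cong to ⊕-cong; -‿cong to neg-cong; *-identityʳ to ⊗-identityʳ)

K : ℤ → FPS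
K c = c ⋆ one

⋆-K : ∀ c f → c ⋆ f ≈ K c ⊗ f
⋆-K c f = ≈-sym (≈-trans (⋆-⊗ c one f) (coeffs (λ n → cong (c ℤ.*_) (coeff (⊗-identityˡ f) n))))

⋆-cong : ∀ c {f g} → f ≈ g → c ⋆ f ≈ c ⋆ g
⋆-cong c p = coeffs (λ n → cong (c ℤ.*_) (coeff p n))

K-morphism : CommutativeRing.rawRing ℤP.+-*-commutativeRing
             -Raw-AlmostCommutative⟶ fromCommutativeRing FPS-commutativeRing
K-morphism = record
  { ⟦_⟧    = K
  ; +-homo = λ a b → coeffs (λ n → ℤP.*-distribʳ-+ (one n) a b)
  ; *-homo = λ a b → ≈-trans (coeffs (λ n → ℤP.*-assoc a b (one n))) (⋆-K a (K b))
  ; -‿homo = λ a → coeffs (λ n → sym (ℤP.neg-distribˡ-* a (one n)))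
  ; 0-homo = coeffs (λ n → ℤP.*-zeroˡ (one n))
  ; 1-homo = coeffs (λ n → ℤP.*-identityˡ (one n))
  }

open RingTools FPS-commutativeRing K-morphism public

module ≈-Reasoning = SetoidReasoning FPS-setoid

-- Monomials, the derivation q d/dq and cancellable series

mono-suc-⊗ : ∀ a f n → (mono (suc a) ⊗ f) (suc n) ≡ (mono a ⊗ f) n
mono-suc-⊗ a f n = trans (⊗-suc (mono (suc a)) f n) (ℤP.+-identityˡ _)

mono-⊗-< : ∀ a f {n} → n ℕ.< a → (mono a ⊗ f) n ≡ 0ℤ
mono-⊗-< (suc a) f {zero}  _         = refl
mono-⊗-< (suc a) f {suc n} (s≤s n<a) = trans (mono-suc-⊗ a f n) (mono-⊗-< a f n<a)

mono-⊗-+ : ∀ a f n → (mono a ⊗ f) (a ℕ.+ n) ≡ f n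
mono-⊗-+ zero    f n = coeff (⊗-identityˡ f) n
mono-⊗-+ (suc a) f n = trans (mono-suc-⊗ a f (a ℕ.+ n)) (mono-⊗-+ a f n)

mono-mono : ∀ a b → mono a ⊗ mono b ≈ mono (a ℕ.+ b)
mono-mono a b = coeffs (go a)
  where
  go : ∀ a n → (mono a ⊗ mono b) n ≡ mono (a ℕ.+ b) n
  go zero    n       = coeff (⊗-identityˡ (mono b)) n
  go (suc a) zero    = refl
  go (suc a) (suc n) = trans (mono-suc-⊗ a (mono b) n) (go a n)

mono-self : ∀ e → mono e e ≡ 1ℤ
mono-self zero    = refl
mono-self (suc e) = mono-self e

mono-≢ : ∀ {e n} → ¬ (n ≡ e) → mono e n ≡ 0ℤ
mono-≢ {zero}  {zero}  n≢e = ⊥-elim (n≢e refl)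
mono-≢ {zero}  {suc n} n≢e = refl
mono-≢ {suc e} {zero}  n≢e = refl
mono-≢ {suc e} {suc n} n≢e = mono-≢ {e} {n} (λ p → n≢e (cong suc p))

θ-cong : ∀ {f g} → f ≈ g → θ f ≈ θ g
θ-cong p = coeffs (λ n → cong (λ e → + n ℤ.* e) (coeff p n))

θ-⊕ : ∀ f g → θ (f ⊕ g) ≈ θ f ⊕ θ g
θ-⊕ f g = coeffs (λ n → ℤP.*-distribˡ-+ (+ n) (f n) (g n))

θ-neg : ∀ f → θ (neg f) ≈ neg (θ f)
θ-neg f = coeffs (λ n → sym (ℤP.neg-distribʳ-* (+ n) (f n)))

θ-⋆ : ∀ c f → θ (c ⋆ f) ≈ c ⋆ θ f
θ-⋆ c f = coeffs (λ n → lem (+ n) c (f n))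
  where
  lem : ∀ n c x → n ℤ.* (c ℤ.* x) ≡ c ℤ.* (n ℤ.* x)
  lem = solve-∀

θ-⊗ : ∀ f g → θ (f ⊗ g) ≈ θ f ⊗ g ⊕ f ⊗ θ g
θ-⊗ f g = coeffs λ n → begin
  + n ℤ.* (f ⊗ g) n
    ≡⟨ sym (sum-*ˡ (suc n) (+ n) (λ i → f i ℤ.* g (n ∸ i))) ⟩
  sumℤ (suc n) (λ i → + n ℤ.* (f i ℤ.* g (n ∸ i)))
    ≡⟨ sum-cong (suc n) (λ { i (s≤s i≤n) →
         trans (cong (λ e → e ℤ.* (f i ℤ.* g (n ∸ i)))
                     (trans (cong +_ (sym (ℕP.m+[n∸m]≡n i≤n))) (ℤP.pos-+ i (n ∸ i))))
               (lem (+ i) (+ (n ∸ i)) (f i) (g (n ∸ i))) }) ⟩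
  sumℤ (suc n) (λ i → θ f i ℤ.* g (n ∸ i) ℤ.+ f i ℤ.* θ g (n ∸ i))
    ≡⟨ sum-+ (suc n) (λ i → θ f i ℤ.* g (n ∸ i)) (λ i → f i ℤ.* θ g (n ∸ i)) ⟩
  (θ f ⊗ g ⊕ f ⊗ θ g) n ∎
  where
  open ≡-Reasoning
  lem : ∀ i j x y → (i ℤ.+ j) ℤ.* (x ℤ.* y) ≡ i ℤ.* x ℤ.* y ℤ.+ x ℤ.* (j ℤ.* y)
  lem = solve-∀

θ-mono : ∀ e → θ (mono e) ≈ K (+ e) ⊗ mono e
θ-mono e = ≈-trans (coeffs go) (⋆-K (+ e) (mono e))
  where
  go : ∀ n → + n ℤ.* mono e n ≡ + e ℤ.* mono e n
  go n with n ℕ.≟ e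
  ... | yes refl = refl
  ... | no n≢e rewrite mono-≢ n≢e = trans (ℤP.*-zeroʳ (+ n)) (sym (ℤP.*-zeroʳ (+ e)))

θ-K : ∀ c → θ (K c) ≈ zeroS
θ-K c = coeffs λ
  { zero    → ℤP.*-zeroˡ (K c 0)
  ; (suc n) → trans (cong (λ e → + suc n ℤ.* e) (ℤP.*-zeroʳ c)) (ℤP.*-zeroʳ (+ suc n)) }

K0 : ∀ n → K 0ℤ n ≡ 0ℤ
K0 n = ℤP.*-zeroˡ (one n)

Cancellable-mono : ∀ e → Cancellable (mono e)
cancel (Cancellable-mono e) g p = coeffs (λ n → trans (sym (mono-⊗-+ e g n))
  (trans (coeff p (e ℕ.+ n)) (trans (K0 (e ℕ.+ n)) (sym (K0 n)))))

-- Since ℤ has no zero divisors, `f 0` nonzero and `f ⊗ g = 0` force `g 0 = 0`; then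
-- `f ⊗ tail g = 0`, and the argument repeats. The constant term may thus be any nonzero integer,
-- such as 14.
Cancellable-unit : ∀ {f} → ¬ (f 0 ≡ 0ℤ) → Cancellable f
cancel (Cancellable-unit {f} f₀≢0) g p = coeffs (λ n → trans (go n g (λ m → trans (coeff p m) (K0 m))) (sym (K0 n)))
  where
  head : ∀ g → f ⊗ g ≐ zeroS → g 0 ≡ 0ℤ
  head g p with ℤP.i*j≡0⇒i≡0∨j≡0 (f 0) (trans (sym (ℤP.+-identityˡ _)) (p 0))
  ... | inj₁ f₀≡0 = ⊥-elim (f₀≢0 f₀≡0)
  ... | inj₂ g₀≡0 = g₀≡0
  go : ∀ n g → f ⊗ g ≐ zeroS → g n ≡ 0ℤ
  go zero    g p = head g p
  go (suc n) g p = go n (tail g) λ m → begin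
    (f ⊗ tail g) m                           ≡⟨ sym (ℤP.+-identityʳ _) ⟩
    (f ⊗ tail g) m ℤ.+ 0ℤ                    ≡⟨ cong (λ e → (f ⊗ tail g) m ℤ.+ e) (sym (ℤP.*-zeroʳ (f (suc m)))) ⟩
    (f ⊗ tail g) m ℤ.+ f (suc m) ℤ.* 0ℤ      ≡⟨ cong (λ e → (f ⊗ tail g) m ℤ.+ f (suc m) ℤ.* e) (sym (head g p)) ⟩
    (f ⊗ tail g) m ℤ.+ f (suc m) ℤ.* g 0     ≡⟨ sym (⊗-sucʳ f g m) ⟩
    (f ⊗ g) (suc m)                          ≡⟨ p (suc m) ⟩
    0ℤ                                       ∎
    where open ≡-Reasoning

Cancellable-K : ∀ {c} → ¬ (c ≡ 0ℤ) → Cancellable (K c)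
Cancellable-K {c} c≢0 = Cancellable-unit {K c} (λ p → c≢0 (trans (sym (ℤP.*-identityʳ c)) p))

-- Congruence modulo a power of q, and the substitution of q^d for q

infix 4 _≈[_]_
record _≈[_]_ (f : FPS) (N : ℕ) (g : FPS) : Set where
  constructor modulo
  field coeff-< : ∀ n → n ℕ.< N → f n ≡ g n
open _≈[_]_ public

≈⇒≈[] : ∀ {N f g} → f ≈ g → f ≈[ N ] g
≈⇒≈[] p = modulo (λ n _ → coeff p n)

≈[]-weaken : ∀ {M N f g} → M ℕ.≤ N → f ≈[ N ] g → f ≈[ M ] g
≈[]-weaken M≤N p = modulo (λ n n<M → coeff-< p n (ℕP.<-≤-trans n<M M≤N))

⊗-cong-mod : ∀ {N f f′ g g′} → f ≈[ N ] f′ → g ≈[ N ] g′ → f ⊗ g ≈[ N ] f′ ⊗ g′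
⊗-cong-mod p q = modulo (λ n n<N → ⊗-cong-≤ n (λ i i≤n → coeff-< p i (ℕP.≤-<-trans i≤n n<N))
                                              (λ i i≤n → coeff-< q i (ℕP.≤-<-trans i≤n n<N)))

-- The series `f(q^d)`. The body repeats that of `sub7`, so that `𝒫` and `dil 7 E₂` have the same
-- coefficients by `refl`.
dil : (d : ℕ) .{{_ : NonZero d}} → FPS → FPS
dil d f n = if ⌊ d Div.∣? n ⌋ then f (n ℕ./ d) else 0ℤ

module _ (d : ℕ) .{{_ : NonZero d}} where

  dil-* : ∀ f m → dil d f (m ℕ.* d) ≡ f m
  dil-* f m with d Div.∣? (m ℕ.* d)
  ... | yes _ = cong f (DM.m*n/n≡m m d)
  ... | no ∤ = ⊥-elim (∤ (Div.n∣m*n m))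

  dil-∤ : ∀ f {n} → ¬ d Div.∣ n → dil d f n ≡ 0ℤ
  dil-∤ f {n} ∤ with d Div.∣? n
  ... | yes d∣n = ⊥-elim (∤ d∣n)
  ... | no _ = refl

  dil-unique : ∀ {f h} → (∀ m → h (m ℕ.* d) ≡ f m) → (∀ n → ¬ d Div.∣ n → h n ≡ 0ℤ) → dil d f ≈ h
  dil-unique {f} {h} p q = coeffs go
    where
    go : dil d f ≐ h
    go n with d Div.∣? n
    ... | yes (Div.divides m refl) = trans (cong f (DM.m*n/n≡m m d)) (sym (p m))
    ... | no ∤ = sym (q n ∤)

  dil-cong : ∀ {f g} → f ≈ g → dil d f ≈ dil d g
  dil-cong {f} {g} p = dil-unique (λ m → trans (dil-* g m) (sym (coeff p m))) (λ n → dil-∤ g)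

  dil-injective : ∀ {f g} → dil d f ≈ dil d g → f ≈ g
  dil-injective {f} {g} p = coeffs (λ m → trans (sym (dil-* f m)) (trans (coeff p (m ℕ.* d)) (dil-* g m)))

  dil-⊕ : ∀ f g → dil d (f ⊕ g) ≈ dil d f ⊕ dil d g
  dil-⊕ f g = dil-unique (λ m → cong₂ ℤ._+_ (dil-* f m) (dil-* g m))
                         (λ n ∤ → cong₂ ℤ._+_ (dil-∤ f ∤) (dil-∤ g ∤))

  dil-neg : ∀ f → dil d (neg f) ≈ neg (dil d f)
  dil-neg f = dil-unique (λ m → cong ℤ.-_ (dil-* f m)) (λ n ∤ → cong ℤ.-_ (dil-∤ f ∤))

  dil-⋆ : ∀ c f → dil d (c ⋆ f) ≈ c ⋆ dil d f
  dil-⋆ c f = dil-unique (λ m → cong (λ e → c ℤ.* e) (dil-* f m))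
                         (λ n ∤ → trans (cong (λ e → c ℤ.* e) (dil-∤ f ∤)) (ℤP.*-zeroʳ c))

  dil-mono : ∀ e → dil d (mono e) ≈ mono (e ℕ.* d)
  dil-mono e = dil-unique onMultiples (λ n ∤ → mono-≢ {e ℕ.* d} {n} (λ { refl → ∤ (Div.n∣m*n e) }))
    where
    onMultiples : ∀ m → mono (e ℕ.* d) (m ℕ.* d) ≡ mono e m
    onMultiples m with m ℕ.≟ e
    ... | yes refl = trans (mono-self (e ℕ.* d)) (sym (mono-self e))
    ... | no m≢e = trans (mono-≢ {e ℕ.* d} (λ p → m≢e (ℕP.*-cancelʳ-≡ m e d p))) (sym (mono-≢ m≢e))

  dil-θ : ∀ f → θ (dil d f) ≈ (+ d) ⋆ dil d (θ f)
  dil-θ f = ≈-sym (≈-trans (≈-sym (dil-⋆ (+ d) (θ f)))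
    (dil-unique
      (λ m → trans (cong₂ ℤ._*_ (trans (cong +_ (ℕP.*-comm m d)) (ℤP.pos-* d m)) (dil-* f m))
                   (ℤP.*-assoc (+ d) (+ m) (f m)))
      (λ n ∤ → trans (cong (λ e → + n ℤ.* e) (dil-∤ f ∤)) (ℤP.*-zeroʳ (+ n)))))

  -- The indices strictly between two consecutive multiples of `d` contribute nothing. This is what
  -- makes `dil d` multiplicative, a Cauchy product at `m * d` being a sum over all indices up to
  -- `m * d`.
  sum-sparse : ∀ h → (∀ i → ¬ d Div.∣ i → h i ≡ 0ℤ) →
               ∀ m → sumℤ (suc (m ℕ.* d)) h ≡ sumℤ (suc m) (λ j → h (j ℕ.* d))
  sum-sparse h sparse zero    = refl
  sum-sparse h sparse (suc m) = cong (λ e → e ℤ.+ h (suc m ℕ.* d)) (trans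
    (block (suc m ℕ.* d ∸ suc (m ℕ.* d)) (ℕP.∸-monoʳ-< {suc m ℕ.* d} (ℕP.n<1+n _) lt)
           (sym (ℕP.m∸n+n≡m lt)))
    (sum-sparse h sparse m))
    where
    lt : suc (m ℕ.* d) ℕ.≤ suc m ℕ.* d
    lt = ℕP.+-monoˡ-≤ (m ℕ.* d) (ℕ.>-nonZero⁻¹ d)
    block : ∀ r → r ℕ.< suc m ℕ.* d ∸ m ℕ.* d → ∀ {N} → N ≡ r ℕ.+ suc (m ℕ.* d) →
            sumℤ N h ≡ sumℤ (suc (m ℕ.* d)) h
    block zero    _   refl = refl
    block (suc r) r<d refl = trans
      (cong₂ ℤ._+_ (block r (ℕP.<-trans (ℕP.n<1+n r) r<d) refl) (sparse (r ℕ.+ suc (m ℕ.* d)) ∤))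
      (ℤP.+-identityʳ _)
      where
      ∤ : ¬ d Div.∣ r ℕ.+ suc (m ℕ.* d)
      ∤ p = ℕP.<⇒≱ (subst (suc r ℕ.<_) (ℕP.m+n∸n≡m d (m ℕ.* d)) r<d)
              (Div.∣⇒≤ (Div.∣m+n∣m⇒∣n
                 (subst (d Div.∣_) (trans (ℕP.+-suc r (m ℕ.* d)) (ℕP.+-comm (suc r) (m ℕ.* d))) p)
                 (Div.n∣m*n m)))

  dil-⊗ : ∀ f g → dil d (f ⊗ g) ≈ dil d f ⊗ dil d g
  dil-⊗ f g = dil-unique onMultiples offMultiples
    where
    onMultiples : ∀ m → (dil d f ⊗ dil d g) (m ℕ.* d) ≡ (f ⊗ g) m
    onMultiples m = trans
      (sum-sparse (λ i → dil d f i ℤ.* dil d g (m ℕ.* d ∸ i))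
        (λ i ∤ → trans (cong (λ e → e ℤ.* dil d g (m ℕ.* d ∸ i)) (dil-∤ f ∤)) (ℤP.*-zeroˡ (dil d g (m ℕ.* d ∸ i)))) m)
      (sum-cong (suc m) (λ j _ → cong₂ ℤ._*_ (dil-* f j)
        (trans (cong (dil d g) (sym (ℕP.*-distribʳ-∸ d m j))) (dil-* g (m ∸ j)))))
    offMultiples : ∀ n → ¬ d Div.∣ n → (dil d f ⊗ dil d g) n ≡ 0ℤ
    offMultiples n ∤ = trans (sum-cong (suc n) vanish) (sum-0 (suc n))
      where
      vanish : ∀ i → i ℕ.< suc n → dil d f i ℤ.* dil d g (n ∸ i) ≡ 0ℤ
      vanish i (s≤s i≤n) with d Div.∣? i
      ... | no _ = ℤP.*-zeroˡ (dil d g (n ∸ i))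
      ... | yes d∣i = trans (cong (λ e → f (i ℕ./ d) ℤ.* e)
              (dil-∤ g (λ d∣n∸i → ∤ (subst (d Div.∣_) (ℕP.m+[n∸m]≡n i≤n) (Div.∣m∣n⇒∣m+n d∣i d∣n∸i)))))
              (ℤP.*-zeroʳ (f (i ℕ./ d)))

  dil-one : dil d one ≈ one
  dil-one = dil-mono 0

-- Inverse series and q-Pochhammer products

sum-tabulate : ∀ n h → Vec.foldr (λ _ → ℤ) ℤ._+_ 0ℤ (Vec.tabulate {n = n} (λ k → h (toℕ k))) ≡ sumℤ n h
sum-tabulate zero    h = refl
sum-tabulate (suc n) h = trans (cong (λ e → h 0 ℤ.+ e) (sum-tabulate n (λ i → h (suc i)))) (sym (sum-shift n h))

lookup-invVec : ∀ f n k → lookup (invVec f n) k ≡ inv f (n ∸ toℕ k)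
lookup-invVec f zero    Fin.zero    = refl
lookup-invVec f (suc n) Fin.zero    = refl
lookup-invVec f (suc n) (Fin.suc k) = lookup-invVec f n k

⊗-inv : ∀ f → f 0 ≡ 1ℤ → f ⊗ inv f ≈ one
⊗-inv f f₀ = coeffs λ
  { zero    → trans (ℤP.+-identityˡ _) (trans (ℤP.*-identityʳ (f 0)) f₀)
  ; (suc n) → begin
      (f ⊗ inv f) (suc n)
        ≡⟨ ⊗-suc f (inv f) n ⟩
      f 0 ℤ.* inv f (suc n) ℤ.+ (tail f ⊗ inv f) n
        ≡⟨ cong₂ (λ a b → a ℤ.* inv f (suc n) ℤ.+ b) f₀
             (trans (sym (sum-tabulate (suc n) (λ k → f (suc k) ℤ.* inv f (n ∸ k))))
                    (cong (Vec.foldr (λ _ → ℤ) ℤ._+_ 0ℤ)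
                      (VecP.tabulate-cong (λ k → cong (λ e → f (suc (toℕ k)) ℤ.* e) (sym (lookup-invVec f n k)))))) ⟩
      1ℤ ℤ.* inv f (suc n) ℤ.+ Vec.foldr (λ _ → ℤ) ℤ._+_ 0ℤ (Vec.tabulate (λ (k : Fin (suc n)) → f (suc (toℕ k)) ℤ.* lookup (invVec f n) k))
        ≡⟨ cong (λ e → e ℤ.+ S n) (ℤP.*-identityˡ (inv f (suc n))) ⟩
      inv f (suc n) ℤ.+ S n
        ≡⟨ ℤP.+-inverseˡ (S n) ⟩
      0ℤ ∎ }
  where
  open ≡-Reasoning
  S : ℕ → ℤ
  S n = Vec.foldr (λ _ → ℤ) ℤ._+_ 0ℤ (Vec.tabulate (λ (k : Fin (suc n)) → f (suc (toℕ k)) ℤ.* lookup (invVec f n) k))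

pochT-suc : ∀ a d m {n} → n ℕ.< a ℕ.+ d ℕ.* m → pochT a d (suc m) n ≡ pochT a d m n
pochT-suc a d m {n} n< = begin
  (pochT a d m ⊗ (one ⊖ mono e)) n
    ≡⟨ coeff (identity 3 (λ p u x → p :* (u :- x) := p :* u :- x :* p) (pochT a d m) one (mono e)) n ⟩
  (pochT a d m ⊗ one) n ℤ.- (mono e ⊗ pochT a d m) n
    ≡⟨ cong (λ c → c ℤ.- (mono e ⊗ pochT a d m) n) (coeff (⊗-identityʳ (pochT a d m)) n) ⟩
  pochT a d m n ℤ.- (mono e ⊗ pochT a d m) n
    ≡⟨ cong (λ c → pochT a d m n ℤ.- c) (mono-⊗-< e (pochT a d m) n<) ⟩
  pochT a d m n ℤ.- 0ℤ
    ≡⟨ ℤP.+-identityʳ _ ⟩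
  pochT a d m n ∎
  where
  open ≡-Reasoning
  e = a ℕ.+ d ℕ.* m

-- Later factors are `1 - q^(a + d j)` with `j ≥ M`, so they leave the coefficients below `q^M`
-- unchanged. Identities between finite products pass to infinite ones by this congruence.
poch-mod : ∀ a d .{{_ : NonZero a}} .{{_ : NonZero d}} M → pochT a d M ≈[ M ] poch a d
poch-mod a d M = modulo (λ n n<M → go (ℕP.≤⇒≤′ n<M))
  where
  go : ∀ {n M} → suc n ℕ.≤′ M → pochT a d M n ≡ pochT a d (suc n) n
  go ℕ.≤′-refl = refl
  go {n} {suc M} (ℕ.≤′-step p) = trans (pochT-suc a d M (ℕP.+-mono-≤ (ℕ.>-nonZero⁻¹ a)
    (ℕP.≤-trans (ℕP.≤-trans (ℕP.n≤1+n n) (ℕP.≤′⇒≤ p)) (ℕP.m≤n*m M d)))) (go p)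

pochT-0 : ∀ a d .{{_ : NonZero a}} m → pochT a d m 0 ≡ 1ℤ
pochT-0 a d zero = refl
pochT-0 a d (suc m) = trans (pochT-suc a d m (ℕP.≤-trans (ℕ.>-nonZero⁻¹ a) (ℕP.m≤m+n a _))) (pochT-0 a d m)

≡⇒≈ : ∀ {f g : FPS} → f ≡ g → f ≈ g
≡⇒≈ refl = ≈-refl

⊖-cong : ∀ {f f′ g g′} → f ≈ f′ → g ≈ g′ → f ⊖ g ≈ f′ ⊖ g′
⊖-cong p q = coeffs (λ n → cong₂ ℤ._-_ (coeff p n) (coeff q n))

module _ (c : ℕ) .{{_ : NonZero c}} where

  dil-⊖ : ∀ f g → dil c (f ⊖ g) ≈ dil c f ⊖ dil c g
  dil-⊖ f g = ≈-trans (dil-⊕ c f (neg g)) (⊕-cong (≈-refl {dil c f}) (dil-neg c g))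

  dil-pochT : ∀ a d m → dil c (pochT a d m) ≈ pochT (a ℕ.* c) (d ℕ.* c) m
  dil-pochT a d zero    = dil-one c
  dil-pochT a d (suc m) = ≈-trans (dil-⊗ c (pochT a d m) (one ⊖ mono (a ℕ.+ d ℕ.* m))) (⊗-cong (dil-pochT a d m)
    (≈-trans (dil-⊖ one (mono (a ℕ.+ d ℕ.* m))) (⊖-cong (dil-one c)
      (≈-trans (dil-mono c (a ℕ.+ d ℕ.* m)) (≡⇒≈ (cong mono eq))))))
    where
    lem : ∀ a d m c → (a ℕ.+ d ℕ.* m) ℕ.* c ≡ a ℕ.* c ℕ.+ d ℕ.* c ℕ.* m
    lem = solveℕ-∀
    eq : (a ℕ.+ d ℕ.* m) ℕ.* c ≡ a ℕ.* c ℕ.+ d ℕ.* c ℕ.* m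
    eq = lem a d m c

  dil-poch : ∀ a d .{{_ : NonZero a}} .{{_ : NonZero d}} → dil c (poch a d) ≈ poch (a ℕ.* c) (d ℕ.* c)
  dil-poch a d = coeffs go
    where
    go : dil c (poch a d) ≐ poch (a ℕ.* c) (d ℕ.* c)
    go n = trans go′ (coeff (dil-pochT a d (suc n)) n)
      where
      go′ : dil c (poch a d) n ≡ dil c (pochT a d (suc n)) n
      go′ with c Div.∣? n
      ... | yes _ = sym (coeff-< (poch-mod a d (suc n)) (n ℕ./ c) (s≤s (DM.m/n≤m n c)))
      ... | no  _ = refl

-- Sums over ℤ and ℤ²

-- Symmetric windows from -B to B make the reflection of the index free of boundary terms; shifts
-- then only need finite support and a sufficiently large window.
sumZ : ℕ → (ℤ → ℤ) → ℤ
sumZ zero    f = f 0ℤ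
sumZ (suc B) f = sumZ B f ℤ.+ (f (+ suc B) ℤ.+ f -[1+ B ])

sumZ-cong : ∀ B {f g} → (∀ ν → ∣ ν ∣ ℕ.≤ B → f ν ≡ g ν) → sumZ B f ≡ sumZ B g
sumZ-cong zero    h = h 0ℤ z≤n
sumZ-cong (suc B) h = cong₂ ℤ._+_ (sumZ-cong B (λ ν p → h ν (ℕP.m≤n⇒m≤1+n p)))
  (cong₂ ℤ._+_ (h (+ suc B) ℕP.≤-refl) (h -[1+ B ] ℕP.≤-refl))

sumZ-+ : ∀ B f g → sumZ B (λ ν → f ν ℤ.+ g ν) ≡ sumZ B f ℤ.+ sumZ B g
sumZ-+ zero    f g = refl
sumZ-+ (suc B) f g = trans
  (cong (λ e → e ℤ.+ ((f (+ suc B) ℤ.+ g (+ suc B)) ℤ.+ (f -[1+ B ] ℤ.+ g -[1+ B ]))) (sumZ-+ B f g))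
  (lem (sumZ B f) (sumZ B g) (f (+ suc B)) (g (+ suc B)) (f -[1+ B ]) (g -[1+ B ]))
  where
  lem : ∀ a b c d x y → a ℤ.+ b ℤ.+ (c ℤ.+ d ℤ.+ (x ℤ.+ y)) ≡ a ℤ.+ (c ℤ.+ x) ℤ.+ (b ℤ.+ (d ℤ.+ y))
  lem = solve-∀

sumZ-*ˡ : ∀ B c f → sumZ B (λ ν → c ℤ.* f ν) ≡ c ℤ.* sumZ B f
sumZ-*ˡ zero    c f = refl
sumZ-*ˡ (suc B) c f = trans
  (cong (λ e → e ℤ.+ (c ℤ.* f (+ suc B) ℤ.+ c ℤ.* f -[1+ B ])) (sumZ-*ˡ B c f))
  (lem c (sumZ B f) (f (+ suc B)) (f -[1+ B ]))
  where
  lem : ∀ c x y z → c ℤ.* x ℤ.+ (c ℤ.* y ℤ.+ c ℤ.* z) ≡ c ℤ.* (x ℤ.+ (y ℤ.+ z))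
  lem = solve-∀

sumZ-0 : ∀ B {f} → (∀ ν → ∣ ν ∣ ℕ.≤ B → f ν ≡ 0ℤ) → sumZ B f ≡ 0ℤ
sumZ-0 zero    h = h 0ℤ z≤n
sumZ-0 (suc B) h = cong₂ ℤ._+_ (sumZ-0 B (λ ν p → h ν (ℕP.m≤n⇒m≤1+n p)))
  (cong₂ ℤ._+_ (h (+ suc B) ℕP.≤-refl) (h -[1+ B ] ℕP.≤-refl))

sumZ-swap : ∀ A B (f : ℤ → ℤ → ℤ) → sumZ A (λ i → sumZ B (f i)) ≡ sumZ B (λ j → sumZ A (λ i → f i j))
sumZ-swap zero    B f = refl
sumZ-swap (suc A) B f = begin
  sumZ A (λ i → sumZ B (f i)) ℤ.+ (sumZ B (f (+ suc A)) ℤ.+ sumZ B (f -[1+ A ]))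
    ≡⟨ cong₂ ℤ._+_ (sumZ-swap A B f) (sym (sumZ-+ B (f (+ suc A)) (f -[1+ A ]))) ⟩
  sumZ B (λ j → sumZ A (λ i → f i j)) ℤ.+ sumZ B (λ j → f (+ suc A) j ℤ.+ f -[1+ A ] j)
    ≡⟨ sym (sumZ-+ B (λ j → sumZ A (λ i → f i j)) (λ j → f (+ suc A) j ℤ.+ f -[1+ A ] j)) ⟩
  sumZ B (λ j → sumZ (suc A) (λ i → f i j)) ∎
  where open ≡-Reasoning

sum-sumZ-swap : ∀ n B (f : ℕ → ℤ → ℤ) → sumℤ n (λ i → sumZ B (f i)) ≡ sumZ B (λ ν → sumℤ n (λ i → f i ν))
sum-sumZ-swap zero    B f = sym (sumZ-0 B (λ _ _ → refl))
sum-sumZ-swap (suc n) B f = trans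
  (cong (λ e → e ℤ.+ sumZ B (f n)) (sum-sumZ-swap n B f))
  (sym (sumZ-+ B (λ ν → sumℤ n (λ i → f i ν)) (f n)))

Supp : (ℤ → ℤ) → ℕ → Set
Supp f B = ∀ ν → B ℕ.< ∣ ν ∣ → f ν ≡ 0ℤ

sumZ-extend : ∀ {f B W} → Supp f B → B ℕ.≤ W → sumZ W f ≡ sumZ B f
sumZ-extend {f} {B} supp B≤W = go (ℕP.≤⇒≤′ B≤W)
  where
  go : ∀ {W} → B ℕ.≤′ W → sumZ W f ≡ sumZ B f
  go ℕ.≤′-refl = refl
  go {suc W} (ℕ.≤′-step p) = trans
    (cong₂ ℤ._+_ (go p) (cong₂ ℤ._+_ (supp (+ suc W) (s≤s (ℕP.≤′⇒≤ p))) (supp -[1+ W ] (s≤s (ℕP.≤′⇒≤ p)))))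
    (ℤP.+-identityʳ _)

sumZ-neg : ∀ B f → sumZ B (λ ν → f (ℤ.- ν)) ≡ sumZ B f
sumZ-neg zero    f = refl
sumZ-neg (suc B) f = cong₂ ℤ._+_ (sumZ-neg B f) (ℤP.+-comm (f -[1+ B ]) (f (+ suc B)))

sumZ-suc : ∀ B f → sumZ B (λ ν → f (ν ℤ.+ 1ℤ)) ℤ.+ f (ℤ.- (+ B)) ≡ sumZ B f ℤ.+ f (+ suc B)
sumZ-suc zero    f = ℤP.+-comm (f 1ℤ) (f 0ℤ)
sumZ-suc (suc B) f = begin
  sumZ B f′ ℤ.+ (f (+ suc (B ℕ.+ 1)) ℤ.+ f (-[1+ B ] ℤ.+ 1ℤ)) ℤ.+ f -[1+ B ]
    ≡⟨ cong₂ (λ a b → sumZ B f′ ℤ.+ (f a ℤ.+ f b) ℤ.+ f -[1+ B ]) (cong (λ k → + suc k) (ℕP.+-comm B 1)) (pred B) ⟩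
  sumZ B f′ ℤ.+ (f (+ suc (suc B)) ℤ.+ f (ℤ.- (+ B))) ℤ.+ f -[1+ B ]
    ≡⟨ lem (sumZ B f′) (f (+ suc (suc B))) (f (ℤ.- (+ B))) (f -[1+ B ]) ⟩
  sumZ B f′ ℤ.+ f (ℤ.- (+ B)) ℤ.+ (f -[1+ B ] ℤ.+ f (+ suc (suc B)))
    ≡⟨ cong (λ e → e ℤ.+ (f -[1+ B ] ℤ.+ f (+ suc (suc B)))) (sumZ-suc B f) ⟩
  sumZ B f ℤ.+ f (+ suc B) ℤ.+ (f -[1+ B ] ℤ.+ f (+ suc (suc B)))
    ≡⟨ lem′ (sumZ B f) (f (+ suc B)) (f -[1+ B ]) (f (+ suc (suc B))) ⟩
  sumZ (suc B) f ℤ.+ f (+ suc (suc B)) ∎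
  where
  open ≡-Reasoning
  f′ : ℤ → ℤ
  f′ ν = f (ν ℤ.+ 1ℤ)
  pred : ∀ B → -[1+ B ] ℤ.+ 1ℤ ≡ ℤ.- (+ B)
  pred zero    = refl
  pred (suc B) = refl
  lem : ∀ a b c d → a ℤ.+ (b ℤ.+ c) ℤ.+ d ≡ a ℤ.+ c ℤ.+ (d ℤ.+ b)
  lem = solve-∀
  lem′ : ∀ a b c d → a ℤ.+ b ℤ.+ (c ℤ.+ d) ≡ a ℤ.+ (b ℤ.+ c) ℤ.+ d
  lem′ = solve-∀

Supp-suc : ∀ {f B} → Supp f B → Supp (λ ν → f (ν ℤ.+ 1ℤ)) (suc B)
Supp-suc supp ν lt = supp (ν ℤ.+ 1ℤ) (ℕP.+-cancelʳ-< 1 _ _ (ℕP.≤-trans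
  (subst (λ k → suc k ℕ.≤ ∣ ν ∣) (ℕP.+-comm 1 _) lt)
  (subst (λ k → ∣ k ∣ ℕ.≤ ∣ ν ℤ.+ 1ℤ ∣ ℕ.+ 1) (lem ν) (ℤP.∣i-j∣≤∣i∣+∣j∣ (ν ℤ.+ 1ℤ) 1ℤ))))
  where
  lem : ∀ ν → ν ℤ.+ 1ℤ ℤ.- 1ℤ ≡ ν
  lem = solve-∀

sumZ-shift⁺ : ∀ {B W} c f → Supp f B → c ℕ.+ B ℕ.≤ W → sumZ W (λ ν → f (ν ℤ.+ + c)) ≡ sumZ W f
sumZ-shift⁺ {W = W} zero f supp le = sumZ-cong W (λ ν _ → cong f (ℤP.+-identityʳ ν))
sumZ-shift⁺ {B} {W} (suc c) f supp le = begin
  sumZ W (λ ν → f (ν ℤ.+ + suc c))      ≡⟨ sumZ-cong W (λ ν _ → cong f (lem ν (+ c))) ⟩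
  sumZ W (λ ν → f′ (ν ℤ.+ + c))         ≡⟨ sumZ-shift⁺ c f′ (Supp-suc {f} supp) (subst (ℕ._≤ W) (sym (ℕP.+-suc c B)) le) ⟩
  sumZ W f′                             ≡⟨ sym (ℤP.+-identityʳ _) ⟩
  sumZ W f′ ℤ.+ 0ℤ                      ≡⟨ cong (λ e → sumZ W f′ ℤ.+ e) (sym (supp (ℤ.- (+ W)) (subst (B ℕ.<_) (sym (ℤP.∣-i∣≡∣i∣ (+ W))) B<W))) ⟩
  sumZ W f′ ℤ.+ f (ℤ.- (+ W))           ≡⟨ sumZ-suc W f ⟩
  sumZ W f ℤ.+ f (+ suc W)              ≡⟨ cong (λ e → sumZ W f ℤ.+ e) (supp (+ suc W) (ℕP.m<n⇒m<1+n B<W)) ⟩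
  sumZ W f ℤ.+ 0ℤ                       ≡⟨ ℤP.+-identityʳ _ ⟩
  sumZ W f                              ∎
  where
  open ≡-Reasoning
  f′ : ℤ → ℤ
  f′ ν = f (ν ℤ.+ 1ℤ)
  B<W : B ℕ.< W
  B<W = ℕP.≤-trans (s≤s (ℕP.m≤n+m B c)) le
  lem : ∀ ν c → ν ℤ.+ (1ℤ ℤ.+ c) ≡ ν ℤ.+ c ℤ.+ 1ℤ
  lem = solve-∀

sumZ-shift : ∀ {B W} c f → Supp f B → ∣ c ∣ ℕ.+ B ℕ.≤ W → sumZ W (λ ν → f (ν ℤ.+ c)) ≡ sumZ W f
sumZ-shift (+ c) f supp le = sumZ-shift⁺ c f supp le
sumZ-shift {B} {W} -[1+ c ] f supp le = begin
  sumZ W (λ ν → f (ν ℤ.+ -[1+ c ]))           ≡⟨ sym (sumZ-neg W _) ⟩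
  sumZ W (λ ν → f (ℤ.- ν ℤ.+ -[1+ c ]))       ≡⟨ sumZ-cong W (λ ν _ → cong f (sym (ℤP.neg-distrib-+ ν (+ suc c)))) ⟩
  sumZ W (λ ν → f (ℤ.- (ν ℤ.+ + suc c)))      ≡⟨ sumZ-shift⁺ (suc c) (λ ν → f (ℤ.- ν)) (λ ν lt → supp (ℤ.- ν) (subst (B ℕ.<_) (sym (ℤP.∣-i∣≡∣i∣ ν)) lt)) le ⟩
  sumZ W (λ ν → f (ℤ.- ν))                    ≡⟨ sumZ-neg W f ⟩
  sumZ W f                                    ∎
  where open ≡-Reasoning

-- The extra term makes the range run from -2B to 2B + 1, and these integers form the pairs 2ν, 2ν +
-- 1 with ν from -B to B.
sumZ-parity : ∀ B f → sumZ (B ℕ.+ B) f ℤ.+ f (+ suc (B ℕ.+ B)) ≡ sumZ B (λ ν → f (ν ℤ.+ ν) ℤ.+ f (ν ℤ.+ ν ℤ.+ 1ℤ))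
sumZ-parity zero    f = refl
sumZ-parity (suc B) f rewrite ℕP.+-suc B B | ℕP.+-comm (B ℕ.+ B) 1 = trans
  (lem (sumZ (B ℕ.+ B) f) (f (+ suc (B ℕ.+ B))) (f -[1+ B ℕ.+ B ]) (f (+ suc (suc (B ℕ.+ B)))) (f -[1+ suc (B ℕ.+ B) ]) (f (+ suc (suc (suc (B ℕ.+ B))))))
  (cong (λ e → e ℤ.+ (f (+ suc (suc (B ℕ.+ B))) ℤ.+ f (+ suc (suc (suc (B ℕ.+ B)))) ℤ.+ (f -[1+ suc (B ℕ.+ B) ] ℤ.+ f -[1+ B ℕ.+ B ])))
    (sumZ-parity B f))
  where
  lem : ∀ s a b c d e → s ℤ.+ (a ℤ.+ b) ℤ.+ (c ℤ.+ d) ℤ.+ e ≡ s ℤ.+ a ℤ.+ (c ℤ.+ e ℤ.+ (d ℤ.+ b))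
  lem = solve-∀

-- Every (m , n) is uniquely (i + j , i - j) or (i + j , i - j + 1).
sumZ-rotate : ∀ N (G : ℤ → ℤ → ℤ) →
  (∀ m n → N ℕ.< ∣ m ∣ → G m n ≡ 0ℤ) → (∀ m n → N ℕ.< ∣ n ∣ → G m n ≡ 0ℤ) →
  sumZ N (λ m → sumZ N (G m)) ≡
  sumZ N (λ i → sumZ (N ℕ.+ N) (λ j → G (i ℤ.+ j) (i ℤ.- j) ℤ.+ G (i ℤ.+ j) (i ℤ.- j ℤ.+ 1ℤ)))
sumZ-rotate N G suppˡ suppʳ = begin
  sumZ N (λ m → sumZ N (G m))                     ≡⟨ sumZ-cong N rows ⟩
  sumZ N (λ m → sumZ N (λ i → H i m))             ≡⟨ sumZ-swap N N (λ m i → H i m) ⟩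
  sumZ N (λ i → sumZ N (H i))                     ≡⟨ sumZ-cong N columns ⟩
  sumZ N (λ i → sumZ (N ℕ.+ N) (λ j → G (i ℤ.+ j) (i ℤ.- j) ℤ.+ G (i ℤ.+ j) (i ℤ.- j ℤ.+ 1ℤ))) ∎
  where
  open ≡-Reasoning
  -- Here `i` is half of `m + n`, rounded down; the two summands are the two parities of `m + n`.
  H : ℤ → ℤ → ℤ
  H i m = G m (i ℤ.+ i ℤ.- m) ℤ.+ G m (i ℤ.+ i ℤ.+ 1ℤ ℤ.- m)
  N≤2N : N ℕ.≤ N ℕ.+ N
  N≤2N = ℕP.m≤m+n N N
  rows : ∀ m → ∣ m ∣ ℕ.≤ N → sumZ N (G m) ≡ sumZ N (λ i → H i m)
  rows m m≤N = begin
    sumZ N (G m)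
      ≡⟨ sym (sumZ-extend (suppʳ m) N≤2N) ⟩
    sumZ (N ℕ.+ N) (G m)
      ≡⟨ sym (sumZ-shift (ℤ.- m) (G m) (suppʳ m) (ℕP.+-monoˡ-≤ N (subst (ℕ._≤ N) (sym (ℤP.∣-i∣≡∣i∣ m)) m≤N))) ⟩
    sumZ (N ℕ.+ N) (λ n → G m (n ℤ.- m))
      ≡⟨ sym (ℤP.+-identityʳ _) ⟩
    sumZ (N ℕ.+ N) (λ n → G m (n ℤ.- m)) ℤ.+ 0ℤ
      ≡⟨ cong (λ e → sumZ (N ℕ.+ N) (λ n → G m (n ℤ.- m)) ℤ.+ e) (sym (suppʳ m (+ suc (N ℕ.+ N) ℤ.- m) far)) ⟩
    sumZ (N ℕ.+ N) (λ n → G m (n ℤ.- m)) ℤ.+ G m (+ suc (N ℕ.+ N) ℤ.- m)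
      ≡⟨ sumZ-parity N (λ n → G m (n ℤ.- m)) ⟩
    sumZ N (λ i → H i m) ∎
    where
    far : N ℕ.< ∣ + suc (N ℕ.+ N) ℤ.- m ∣
    far = ℕP.+-cancelʳ-≤ N (suc N) _ (ℕP.≤-trans
      (subst (ℕ._≤ ∣ + suc (N ℕ.+ N) ℤ.- m ∣ ℕ.+ ∣ m ∣) (cong ∣_∣ (lem (+ suc (N ℕ.+ N)) m))
        (ℤP.∣i+j∣≤∣i∣+∣j∣ (+ suc (N ℕ.+ N) ℤ.- m) m))
      (ℕP.+-monoʳ-≤ _ m≤N))
      where
      lem : ∀ a b → a ℤ.- b ℤ.+ b ≡ a
      lem = solve-∀
  columns : ∀ i → ∣ i ∣ ℕ.≤ N → sumZ N (H i) ≡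
            sumZ (N ℕ.+ N) (λ j → G (i ℤ.+ j) (i ℤ.- j) ℤ.+ G (i ℤ.+ j) (i ℤ.- j ℤ.+ 1ℤ))
  columns i i≤N = begin
    sumZ N (H i)                            ≡⟨ sym (sumZ-extend supp N≤2N) ⟩
    sumZ (N ℕ.+ N) (H i)                    ≡⟨ sym (sumZ-shift i (H i) supp (ℕP.+-monoˡ-≤ N i≤N)) ⟩
    sumZ (N ℕ.+ N) (λ j → H i (j ℤ.+ i))    ≡⟨ sumZ-cong (N ℕ.+ N) (λ j _ → cong₂ ℤ._+_
                                                 (cong₂ G (ℤP.+-comm j i) (lem i j))
                                                 (cong₂ G (ℤP.+-comm j i) (lem′ i j))) ⟩
    sumZ (N ℕ.+ N) (λ j → G (i ℤ.+ j) (i ℤ.- j) ℤ.+ G (i ℤ.+ j) (i ℤ.- j ℤ.+ 1ℤ)) ∎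
    where
    supp : Supp (H i) N
    supp m lt = cong₂ ℤ._+_ (suppˡ m (i ℤ.+ i ℤ.- m) lt) (suppˡ m (i ℤ.+ i ℤ.+ 1ℤ ℤ.- m) lt)
    lem : ∀ i j → i ℤ.+ i ℤ.- (j ℤ.+ i) ≡ i ℤ.- j
    lem = solve-∀
    lem′ : ∀ i j → i ℤ.+ i ℤ.+ 1ℤ ℤ.- (j ℤ.+ i) ≡ i ℤ.- j ℤ.+ 1ℤ
    lem′ = solve-∀

-- Σ_ν c(ν) q^e(ν); properness of e makes the truncation |ν| ≤ n harmless.
Proper : (ℤ → ℕ) → Set
Proper e = ∀ ν → ∣ ν ∣ ℕ.≤ e ν

series : (ℤ → ℕ) → (ℤ → ℤ) → FPS
series e c n = sumZ n (λ ν → c ν ℤ.* mono (e ν) n)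

mono-< : ∀ {e n} → n ℕ.< e → mono e n ≡ 0ℤ
mono-< {e} {n} n<e = mono-≢ {e} {n} (λ { refl → ℕP.<-irrefl refl n<e })

term-0 : ∀ c {e n} → n ℕ.< e → c ℤ.* mono e n ≡ 0ℤ
term-0 c n<e = trans (cong (λ x → c ℤ.* x) (mono-< n<e)) (ℤP.*-zeroʳ c)

series-supp : ∀ {e} → Proper e → ∀ (c : ℤ → ℤ) n → Supp (λ ν → c ν ℤ.* mono (e ν) n) n
series-supp pe c n ν lt = term-0 (c ν) (ℕP.<-≤-trans lt (pe ν))

series-window : ∀ {e} → Proper e → ∀ c {n W} → n ℕ.≤ W → series e c n ≡ sumZ W (λ ν → c ν ℤ.* mono (e ν) n)
series-window pe c {n} n≤W = sym (sumZ-extend (series-supp pe c n) n≤W)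

series-cong : ∀ {e e′ c c′} → (∀ ν → e ν ≡ e′ ν) → (∀ ν → c ν ≡ c′ ν) → series e c ≈ series e′ c′
series-cong p q = coeffs (λ n → sumZ-cong n (λ ν _ → cong₂ (λ a b → a ℤ.* mono b n) (q ν) (p ν)))

series-neg : ∀ e c → series (λ ν → e (ℤ.- ν)) (λ ν → c (ℤ.- ν)) ≈ series e c
series-neg e c = coeffs (λ n → sumZ-neg n (λ ν → c ν ℤ.* mono (e ν) n))

series-suc : ∀ {e} → Proper e → Proper (λ ν → e (ν ℤ.+ 1ℤ)) → ∀ c →
             series (λ ν → e (ν ℤ.+ 1ℤ)) (λ ν → c (ν ℤ.+ 1ℤ)) ≈ series e c
series-suc {e} pe pe′ c = coeffs (λ n → trans
  (series-window pe′ (λ ν → c (ν ℤ.+ 1ℤ)) (ℕP.n≤1+n n))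
  (trans (sumZ-shift 1ℤ (λ ν → c ν ℤ.* mono (e ν) n) (series-supp pe c n) ℕP.≤-refl)
         (sym (series-window pe c (ℕP.n≤1+n n)))))

series-⋆ : ∀ k e c → series e (λ ν → k ℤ.* c ν) ≈ k ⋆ series e c
series-⋆ k e c = coeffs (λ n → trans
  (sumZ-cong n (λ ν _ → ℤP.*-assoc k (c ν) (mono (e ν) n)))
  (sumZ-*ˡ n k (λ ν → c ν ℤ.* mono (e ν) n)))

θ-series : ∀ e c → θ (series e c) ≈ series e (λ ν → c ν ℤ.* + e ν)
θ-series e c = coeffs (λ n → trans
  (sym (sumZ-*ˡ n (+ n) (λ ν → c ν ℤ.* mono (e ν) n)))
  (sumZ-cong n (λ ν _ → go n (e ν) (c ν))))
  where
  lem : ∀ n c x → n ℤ.* (c ℤ.* x) ≡ c ℤ.* (n ℤ.* x)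
  lem = solve-∀
  go : ∀ n e c → + n ℤ.* (c ℤ.* mono e n) ≡ c ℤ.* + e ℤ.* mono e n
  go n e c = trans (lem (+ n) c (mono e n)) (trans
    (cong (λ x → c ℤ.* x) (trans (coeff (θ-mono e) n) (sym (coeff (⋆-K (+ e) (mono e)) n))))
    (sym (ℤP.*-assoc c (+ e) (mono e n))))

Proper₂ : (ℤ → ℤ → ℕ) → Set
Proper₂ E = ∀ m n → ∣ m ∣ ℕ.≤ E m n × ∣ n ∣ ℕ.≤ E m n

series₂ : (ℤ → ℤ → ℕ) → (ℤ → ℤ → ℤ) → FPS
series₂ E g N = sumZ N (λ m → sumZ N (λ n → g m n ℤ.* mono (E m n) N))

series₂-cong : ∀ {E E′ g g′} → (∀ m n → E m n ≡ E′ m n) → (∀ m n → g m n ≡ g′ m n) → series₂ E g ≈ series₂ E′ g′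
series₂-cong p q = coeffs (λ N → sumZ-cong N (λ m _ → sumZ-cong N (λ n _ →
  cong₂ (λ a b → a ℤ.* mono b N) (q m n) (p m n))))

series₂-⊕ : ∀ E g h → series₂ E (λ m n → g m n ℤ.+ h m n) ≈ series₂ E g ⊕ series₂ E h
series₂-⊕ E g h = coeffs (λ N → trans
  (sumZ-cong N (λ m _ → trans
    (sumZ-cong N (λ n _ → ℤP.*-distribʳ-+ (mono (E m n) N) (g m n) (h m n)))
    (sumZ-+ N (λ n → g m n ℤ.* mono (E m n) N) (λ n → h m n ℤ.* mono (E m n) N))))
  (sumZ-+ N (λ m → sumZ N (λ n → g m n ℤ.* mono (E m n) N)) (λ m → sumZ N (λ n → h m n ℤ.* mono (E m n) N))))

series₂-⋆ : ∀ k E g → series₂ E (λ m n → k ℤ.* g m n) ≈ k ⋆ series₂ E g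
series₂-⋆ k E g = coeffs (λ N → trans
  (sumZ-cong N (λ m _ → trans
    (sumZ-cong N (λ n _ → ℤP.*-assoc k (g m n) (mono (E m n) N)))
    (sumZ-*ˡ N k (λ n → g m n ℤ.* mono (E m n) N))))
  (sumZ-*ˡ N k (λ m → sumZ N (λ n → g m n ℤ.* mono (E m n) N))))

series-⊗ : ∀ {e e′} → Proper e → Proper e′ → ∀ c d →
           series e c ⊗ series e′ d ≈ series₂ (λ m n → e m ℕ.+ e′ n) (λ m n → c m ℤ.* d n)
series-⊗ {e} {e′} pe pe′ c d = coeffs λ N → begin
  sumℤ (suc N) (λ i → series e c i ℤ.* series e′ d (N ∸ i))
    ≡⟨ sum-cong (suc N) (λ { i (s≤s i≤N) → begin
         series e c i ℤ.* series e′ d (N ∸ i)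
           ≡⟨ cong₂ ℤ._*_ (series-window pe c i≤N) (series-window pe′ d (ℕP.m∸n≤m N i)) ⟩
         sumZ N (x i) ℤ.* sumZ N (y (N ∸ i))
           ≡⟨ ℤP.*-comm (sumZ N (x i)) (sumZ N (y (N ∸ i))) ⟩
         sumZ N (y (N ∸ i)) ℤ.* sumZ N (x i)
           ≡⟨ sym (sumZ-*ˡ N (sumZ N (y (N ∸ i))) (x i)) ⟩
         sumZ N (λ m → sumZ N (y (N ∸ i)) ℤ.* x i m)
           ≡⟨ sumZ-cong N (λ m _ → trans (ℤP.*-comm (sumZ N (y (N ∸ i))) (x i m)) (sym (sumZ-*ˡ N (x i m) (y (N ∸ i))))) ⟩
         sumZ N (λ m → sumZ N (λ n → x i m ℤ.* y (N ∸ i) n)) ∎ }) ⟩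
  sumℤ (suc N) (λ i → sumZ N (λ m → sumZ N (λ n → x i m ℤ.* y (N ∸ i) n)))
    ≡⟨ sum-sumZ-swap (suc N) N (λ i m → sumZ N (λ n → x i m ℤ.* y (N ∸ i) n)) ⟩
  sumZ N (λ m → sumℤ (suc N) (λ i → sumZ N (λ n → x i m ℤ.* y (N ∸ i) n)))
    ≡⟨ sumZ-cong N (λ m _ → trans
         (sum-sumZ-swap (suc N) N (λ i n → x i m ℤ.* y (N ∸ i) n))
         (sumZ-cong N (λ n _ → trans
           (sum-cong (suc N) (λ i _ → lem (c m) (d n) (mono (e m) i) (mono (e′ n) (N ∸ i))))
           (trans (sum-*ˡ (suc N) (c m ℤ.* d n) (λ i → mono (e m) i ℤ.* mono (e′ n) (N ∸ i)))
                  (cong (λ z → c m ℤ.* d n ℤ.* z) (coeff (mono-mono (e m) (e′ n)) N)))))) ⟩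
  series₂ (λ m n → e m ℕ.+ e′ n) (λ m n → c m ℤ.* d n) N ∎
  where
  open ≡-Reasoning
  x y : ℕ → ℤ → ℤ
  x i m = c m ℤ.* mono (e m) i
  y j n = d n ℤ.* mono (e′ n) j
  lem : ∀ c d x y → c ℤ.* x ℤ.* (d ℤ.* y) ≡ c ℤ.* d ℤ.* (x ℤ.* y)
  lem = solve-∀

-- Properness in the old and in both kinds of new indices allows the same window N on either side:
-- `sumZ-rotate` lets `j` run up to 2N, and properness cuts it back to N.
series₂-rotate : ∀ E g → Proper₂ E →
  Proper₂ (λ i j → E (i ℤ.+ j) (i ℤ.- j)) → Proper₂ (λ i j → E (i ℤ.+ j) (i ℤ.- j ℤ.+ 1ℤ)) →
  series₂ E g ≈ series₂ (λ i j → E (i ℤ.+ j) (i ℤ.- j)) (λ i j → g (i ℤ.+ j) (i ℤ.- j))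
              ⊕ series₂ (λ i j → E (i ℤ.+ j) (i ℤ.- j ℤ.+ 1ℤ)) (λ i j → g (i ℤ.+ j) (i ℤ.- j ℤ.+ 1ℤ))
series₂-rotate E g pE p₀ p₁ = coeffs go
  where
  open ≡-Reasoning
  G G₀ G₁ : ℕ → ℤ → ℤ → ℤ
  G N m n = g m n ℤ.* mono (E m n) N
  G₀ N i j = G N (i ℤ.+ j) (i ℤ.- j)
  G₁ N i j = G N (i ℤ.+ j) (i ℤ.- j ℤ.+ 1ℤ)
  go : ∀ N → sumZ N (λ m → sumZ N (G N m)) ≡
             sumZ N (λ i → sumZ N (G₀ N i)) ℤ.+ sumZ N (λ i → sumZ N (G₁ N i))
  go N = begin
    sumZ N (λ m → sumZ N (G N m))
      ≡⟨ sumZ-rotate N (G N)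
           (λ m n lt → term-0 (g m n) (ℕP.<-≤-trans lt (proj₁ (pE m n))))
           (λ m n lt → term-0 (g m n) (ℕP.<-≤-trans lt (proj₂ (pE m n)))) ⟩
    sumZ N (λ i → sumZ (N ℕ.+ N) (λ j → G₀ N i j ℤ.+ G₁ N i j))
      ≡⟨ sumZ-cong N (λ i _ → trans
           (sumZ-extend {f = λ j → G₀ N i j ℤ.+ G₁ N i j} (λ j lt → cong₂ ℤ._+_
              (term-0 (g (i ℤ.+ j) (i ℤ.- j)) (ℕP.<-≤-trans lt (proj₂ (p₀ i j))))
              (term-0 (g (i ℤ.+ j) (i ℤ.- j ℤ.+ 1ℤ)) (ℕP.<-≤-trans lt (proj₂ (p₁ i j)))))
              (ℕP.m≤m+n N N))
           (sumZ-+ N (G₀ N i) (G₁ N i))) ⟩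
    sumZ N (λ i → sumZ N (G₀ N i) ℤ.+ sumZ N (G₁ N i))
      ≡⟨ sumZ-+ N (λ i → sumZ N (G₀ N i)) (λ i → sumZ N (G₁ N i)) ⟩
    sumZ N (λ i → sumZ N (G₀ N i)) ℤ.+ sumZ N (λ i → sumZ N (G₁ N i)) ∎

-- Theta series

sgℕ : ℕ → ℤ
sgℕ zero    = 1ℤ
sgℕ (suc n) = ℤ.- sgℕ n

sg : ℤ → ℤ
sg ν = sgℕ ∣ ν ∣

sg-neg : ∀ ν → sg (ℤ.- ν) ≡ sg ν
sg-neg ν = cong sgℕ (ℤP.∣-i∣≡∣i∣ ν)

sg-suc : ∀ ν → sg (ν ℤ.+ 1ℤ) ≡ ℤ.- sg ν
sg-suc (+ n)          = cong sgℕ (ℕP.+-comm n 1)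
sg-suc -[1+ zero ]    = refl
sg-suc -[1+ suc n ]   = sym (ℤP.neg-involutive (sgℕ (suc n)))

sg-+ : ∀ m n → sg (m ℤ.+ n) ≡ sg m ℤ.* sg n
sg-+ m (+ n) = go n
  where
  go : ∀ n → sg (m ℤ.+ + n) ≡ sg m ℤ.* sgℕ n
  go zero    = trans (cong sg (ℤP.+-identityʳ m)) (sym (ℤP.*-identityʳ (sg m)))
  go (suc n) = trans (cong sg (lem m (+ n))) (trans (sg-suc (m ℤ.+ + n)) (trans (cong ℤ.-_ (go n)) (ℤP.neg-distribʳ-* (sg m) (sgℕ n))))
    where
    lem : ∀ m n → m ℤ.+ (1ℤ ℤ.+ n) ≡ m ℤ.+ n ℤ.+ 1ℤ
    lem = solve-∀
sg-+ m -[1+ n ] = trans (sym (sg-neg (m ℤ.+ -[1+ n ])))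
  (trans (cong sg (ℤP.neg-distrib-+ m -[1+ n ])) (trans (sg-+ (ℤ.- m) (+ suc n)) (cong (λ e → e ℤ.* sgℕ (suc n)) (sg-neg m))))

sg²≡1 : ∀ ν → sg ν ℤ.* sg ν ≡ 1ℤ
sg²≡1 ν = go ∣ ν ∣
  where
  lem : ∀ x → (ℤ.- x) ℤ.* (ℤ.- x) ≡ x ℤ.* x
  lem = solve-∀
  go : ∀ n → sgℕ n ℤ.* sgℕ n ≡ 1ℤ
  go zero    = refl
  go (suc n) = trans (lem (sgℕ n)) (go n)

sq : ℤ → ℕ
sq x = ∣ x ∣ ℕ.* ∣ x ∣

+sq : ∀ x → + sq x ≡ x ℤ.* x
+sq (+ n)    = ℤP.pos-* n n
+sq -[1+ n ] = refl

+-sum : ∀ {x y z} → + x ≡ z → + y ≡ z → x ≡ y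
+-sum p q = ℤP.+-injective (trans p (sym q))

lin : ℤ → ℤ → ℤ
lin β ν = + 14 ℤ.* ν ℤ.+ β

-- Below 14, so that |ν| ≤ |14 ν + β|.
Small : ℤ → Set
Small β = True (∣ β ∣ ℕ.≤? 13)

sq-proper : ∀ {β} → Small β → Proper (λ ν → sq (lin β ν))
sq-proper {β} small ν = ℕP.≤-trans ≤lin (n≤n*n ∣ lin β ν ∣)
  where
  n≤n*n : ∀ n → n ℕ.≤ n ℕ.* n
  n≤n*n zero    = z≤n
  n≤n*n (suc n) = ℕP.m≤m+n (suc n) (n ℕ.* suc n)
  lem : ∀ a b → a ℤ.+ b ℤ.- b ≡ a
  lem = solve-∀
  bound : 14 ℕ.* ∣ ν ∣ ℕ.≤ ∣ lin β ν ∣ ℕ.+ 13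
  bound = ℕP.≤-trans (subst (ℕ._≤ ∣ lin β ν ∣ ℕ.+ ∣ β ∣)
      (trans (cong ∣_∣ (lem (+ 14 ℤ.* ν) β)) (ℤP.abs-* (+ 14) ν))
      (ℤP.∣i-j∣≤∣i∣+∣j∣ (lin β ν) β))
    (ℕP.+-monoʳ-≤ ∣ lin β ν ∣ (toWitness small))
  fromBound : ∀ a b → 14 ℕ.* a ℕ.≤ b ℕ.+ 13 → a ℕ.≤ b
  fromBound zero    b le = z≤n
  fromBound (suc a) b le = ℕP.+-cancelʳ-≤ 13 (suc a) b (ℕP.≤-trans
    (ℕP.+-monoʳ-≤ (suc a) (ℕP.m≤m*n 13 (suc a)))
    le)
  ≤lin : ∣ ν ∣ ℕ.≤ ∣ lin β ν ∣
  ≤lin = fromBound ∣ ν ∣ ∣ lin β ν ∣ bound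

-- r counts derivatives in the elliptic variable.
Θ : ℤ → ℕ → FPS
Θ β r = series (λ ν → sq (lin β ν)) (λ ν → sg ν ℤ.* lin β ν ℤ.^ r)

-- For k = x + y and l = x - y one has k² + l² = 2x² + 2y², k + l = 2x and k - l = 2y. Hence the
-- doubled square as exponent and the doubled linear form as weight of the series `Φ`.
quad : ℤ → ℤ → ℕ
quad β ν = sq (lin β ν) ℕ.+ sq (lin β ν)

moment : ℤ → ℕ → ℤ → ℤ
moment β r ν = (lin β ν ℤ.+ lin β ν) ℤ.^ r

Φ : ℤ → ℕ → FPS
Φ β r = series (quad β) (moment β r)

Φ-proper : ∀ {β} → Small β → Proper (quad β)
Φ-proper small ν = ℕP.≤-trans (sq-proper small ν) (ℕP.m≤m+n _ _)

^-neg : ∀ x r → (ℤ.- x) ℤ.^ r ≡ sgℕ r ℤ.* x ℤ.^ r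
^-neg x zero    = refl
^-neg x (suc r) = trans (cong (λ e → (ℤ.- x) ℤ.* e) (^-neg x r)) (lem x (sgℕ r) (x ℤ.^ r))
  where
  lem : ∀ x s y → (ℤ.- x) ℤ.* (s ℤ.* y) ≡ (ℤ.- s) ℤ.* (x ℤ.* y)
  lem = solve-∀

Θ-neg : ∀ β r → Θ (ℤ.- β) r ≈ sgℕ r ⋆ Θ β r
Θ-neg β r = ≈-trans
  (≈-trans (≈-sym (series-neg (λ ν → sq (lin (ℤ.- β) ν)) (λ ν → sg ν ℤ.* lin (ℤ.- β) ν ℤ.^ r)))
    (series-cong
      (λ ν → trans (cong sq (lin-neg ν)) (cong (λ a → a ℕ.* a) (ℤP.∣-i∣≡∣i∣ (lin β ν))))
      (λ ν → trans (cong₂ (λ s x → s ℤ.* x ℤ.^ r) (sg-neg ν) (lin-neg ν))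
               (trans (cong (λ x → sg ν ℤ.* x) (^-neg (lin β ν) r)) (lem (sg ν) (sgℕ r) (lin β ν ℤ.^ r))))))
  (series-⋆ (sgℕ r) (λ ν → sq (lin β ν)) (λ ν → sg ν ℤ.* lin β ν ℤ.^ r))
  where
  lem : ∀ a b c → a ℤ.* (b ℤ.* c) ≡ b ℤ.* (a ℤ.* c)
  lem = solve-∀
  lem′ : ∀ β ν → + 14 ℤ.* (ℤ.- ν) ℤ.+ (ℤ.- β) ≡ ℤ.- (+ 14 ℤ.* ν ℤ.+ β)
  lem′ = solve-∀
  lin-neg : ∀ ν → lin (ℤ.- β) (ℤ.- ν) ≡ ℤ.- lin β ν
  lin-neg = lem′ β

-- Replacing ν by ν + 1 adds 14 to the linear form and flips the sign. The weights are powers of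
-- that same form, so all derivatives obey one law and no quasi-period correction appears.
Θ-shift : ∀ β r → Small β → Small (β ℤ.+ + 14) → Θ (β ℤ.+ + 14) r ≈ -1ℤ ⋆ Θ β r
Θ-shift β r small small′ = ≈-trans
  (series-cong {e′ = λ ν → sq (lin β (ν ℤ.+ 1ℤ))} {c′ = λ ν → -1ℤ ℤ.* (sg (ν ℤ.+ 1ℤ) ℤ.* lin β (ν ℤ.+ 1ℤ) ℤ.^ r)}
    (λ ν → cong sq (lin-suc ν))
    (λ ν → trans (cong (λ x → sg ν ℤ.* x ℤ.^ r) (lin-suc ν))
             (trans (lem (sg ν) (lin β (ν ℤ.+ 1ℤ) ℤ.^ r))
                    (cong (λ s → -1ℤ ℤ.* (s ℤ.* lin β (ν ℤ.+ 1ℤ) ℤ.^ r)) (sym (sg-suc ν))))))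
  (≈-trans (series-⋆ -1ℤ (λ ν → sq (lin β (ν ℤ.+ 1ℤ))) (λ ν → sg (ν ℤ.+ 1ℤ) ℤ.* lin β (ν ℤ.+ 1ℤ) ℤ.^ r))
    (⋆-cong -1ℤ (series-suc (sq-proper small)
      (λ ν → subst (λ x → ∣ ν ∣ ℕ.≤ sq x) (lin-suc ν) (sq-proper small′ ν))
      (λ ν → sg ν ℤ.* lin β ν ℤ.^ r))))
  where
  lem : ∀ s x → s ℤ.* x ≡ -1ℤ ℤ.* ((ℤ.- s) ℤ.* x)
  lem = solve-∀
  lem′ : ∀ β ν → + 14 ℤ.* ν ℤ.+ (β ℤ.+ + 14) ≡ + 14 ℤ.* (ν ℤ.+ 1ℤ) ℤ.+ β
  lem′ = solve-∀
  lin-suc : ∀ ν → lin (β ℤ.+ + 14) ν ≡ lin β (ν ℤ.+ 1ℤ)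
  lin-suc = lem′ β

-- The heat equation.
θ-Θ : ∀ β r → θ (Θ β r) ≈ Θ β (suc (suc r))
θ-Θ β r = ≈-trans (θ-series (λ ν → sq (lin β ν)) (λ ν → sg ν ℤ.* lin β ν ℤ.^ r))
  (series-cong {e′ = λ ν → sq (lin β ν)} (λ ν → refl) (λ ν → trans
    (cong (λ x → sg ν ℤ.* lin β ν ℤ.^ r ℤ.* x) (+sq (lin β ν)))
    (lem (sg ν) (lin β ν) (lin β ν ℤ.^ r))))
  where
  lem : ∀ s x y → s ℤ.* y ℤ.* (x ℤ.* x) ≡ s ℤ.* (x ℤ.* (x ℤ.* y))
  lem = solve-∀

-- The bracket of the vectors (Φ s , Φ (s + 7)) and (Φ (d - 7) , Φ d).
⟨_,_∣_,_⟩ : ℤ → ℕ → ℤ → ℕ → FPS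
⟨ s , i ∣ d , j ⟩ = Φ s i ⊗ Φ d j ⊕ neg (Φ (s ℤ.+ + 7) i ⊗ Φ (d ℤ.- + 7) j)

-- Products of two theta series as determinants

module Bilinear (s d : ℤ)
  {p₁ : Small (s ℤ.+ d)} {p₂ : Small (s ℤ.- d)} {p₃ : Small s} {p₄ : Small d}
  {p₅ : Small (s ℤ.+ + 7)} {p₆ : Small (d ℤ.- + 7)} where

  k l : ℤ → ℤ
  k = lin (s ℤ.+ d)
  l = lin (s ℤ.- d)

  E : ℤ → ℤ → ℕ
  E m n = sq (k m) ℕ.+ sq (l n)

  E-proper : Proper₂ E
  E-proper m n = ℕP.≤-trans (sq-proper p₁ m) (ℕP.m≤m+n _ _) , ℕP.≤-trans (sq-proper p₂ n) (ℕP.m≤n+m _ _)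

  sq-parallelogram : ∀ {x y} a b → x ≡ a ℤ.+ b → y ≡ a ℤ.- b → sq x ℕ.+ sq y ≡ (sq a ℕ.+ sq a) ℕ.+ (sq b ℕ.+ sq b)
  sq-parallelogram a b refl refl = +-sum
    (trans (ℤP.pos-+ (sq (a ℤ.+ b)) _) (cong₂ ℤ._+_ (+sq (a ℤ.+ b)) (+sq (a ℤ.- b))))
    (trans (ℤP.pos-+ (sq a ℕ.+ sq a) _) (trans (cong₂ ℤ._+_ (double a) (double b)) (lem a b)))
    where
    double : ∀ a → + (sq a ℕ.+ sq a) ≡ a ℤ.* a ℤ.+ a ℤ.* a
    double a = trans (ℤP.pos-+ (sq a) (sq a)) (cong₂ ℤ._+_ (+sq a) (+sq a))
    lem : ∀ a b → a ℤ.* a ℤ.+ a ℤ.* a ℤ.+ (b ℤ.* b ℤ.+ b ℤ.* b) ≡ (a ℤ.+ b) ℤ.* (a ℤ.+ b) ℤ.+ (a ℤ.- b) ℤ.* (a ℤ.- b)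
    lem = solve-∀

  -- For indices `(i + j, i - j)` the half sum and half difference of `k` and `l` are `14 i + s` and
  -- `14 j + d`; for `(i + j, i - j + 1)` they move by 7 and -7, half of the modulus. This produces
  -- the second components of the two vectors.
  k-even : ∀ s d i j → + 14 ℤ.* (i ℤ.+ j) ℤ.+ (s ℤ.+ d) ≡ + 14 ℤ.* i ℤ.+ s ℤ.+ (+ 14 ℤ.* j ℤ.+ d)
  k-even = solve-∀
  l-even : ∀ s d i j → + 14 ℤ.* (i ℤ.- j) ℤ.+ (s ℤ.- d) ≡ + 14 ℤ.* i ℤ.+ s ℤ.- (+ 14 ℤ.* j ℤ.+ d)
  l-even = solve-∀
  k-odd : ∀ s d i j → + 14 ℤ.* (i ℤ.+ j) ℤ.+ (s ℤ.+ d) ≡ + 14 ℤ.* i ℤ.+ (s ℤ.+ + 7) ℤ.+ (+ 14 ℤ.* j ℤ.+ (d ℤ.- + 7))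
  k-odd = solve-∀
  l-odd : ∀ s d i j → + 14 ℤ.* (i ℤ.- j ℤ.+ 1ℤ) ℤ.+ (s ℤ.- d) ≡ + 14 ℤ.* i ℤ.+ (s ℤ.+ + 7) ℤ.- (+ 14 ℤ.* j ℤ.+ (d ℤ.- + 7))
  l-odd = solve-∀

  weight : ℕ → ℕ → ℤ → ℤ → ℤ
  weight i j m n = sg m ℤ.* sg n ℤ.* ((k m ℤ.+ l n) ℤ.^ i ℤ.* (k m ℤ.- l n) ℤ.^ j)

  half-weights : ∀ {x y c} a b i j → c ≡ 1ℤ → x ≡ a ℤ.+ b → y ≡ a ℤ.- b →
                 c ℤ.* ((x ℤ.+ y) ℤ.^ i ℤ.* (x ℤ.- y) ℤ.^ j) ≡ (a ℤ.+ a) ℤ.^ i ℤ.* (b ℤ.+ b) ℤ.^ j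
  half-weights a b i j refl refl refl = trans (ℤP.*-identityˡ _)
    (cong₂ (λ u v → u ℤ.^ i ℤ.* v ℤ.^ j) (lem a b) (lem′ a b))
    where
    lem : ∀ a b → a ℤ.+ b ℤ.+ (a ℤ.- b) ≡ a ℤ.+ a
    lem = solve-∀
    lem′ : ∀ a b → a ℤ.+ b ℤ.- (a ℤ.- b) ≡ b ℤ.+ b
    lem′ = solve-∀

  sg-even : ∀ i j → sg (i ℤ.+ j) ℤ.* sg (i ℤ.- j) ≡ 1ℤ
  sg-even i j = trans (cong₂ ℤ._*_ (sg-+ i j) (trans (sg-+ i (ℤ.- j)) (cong (λ e → sg i ℤ.* e) (sg-neg j))))
    (trans (lem (sg i) (sg j)) (cong₂ ℤ._*_ (sg²≡1 i) (sg²≡1 j)))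
    where
    lem : ∀ x y → x ℤ.* y ℤ.* (x ℤ.* y) ≡ x ℤ.* x ℤ.* (y ℤ.* y)
    lem = solve-∀

  -- The opposite signs of the two parity classes are what makes the sum of two products a
  -- determinant.
  sg-odd : ∀ i j → sg (i ℤ.+ j) ℤ.* sg (i ℤ.- j ℤ.+ 1ℤ) ≡ -1ℤ
  sg-odd i j = trans (cong (λ e → sg (i ℤ.+ j) ℤ.* e) (sg-suc (i ℤ.- j)))
    (trans (sym (ℤP.neg-distribʳ-* (sg (i ℤ.+ j)) (sg (i ℤ.- j)))) (cong ℤ.-_ (sg-even i j)))

  bracket : ∀ i j → ⟨ s , i ∣ d , j ⟩ ≈ series₂ E (weight i j)
  bracket i j = ≈-sym (≈-trans
    (series₂-rotate E (weight i j) E-proper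
      (λ a b → proper (sq-even a b) (Φ-proper p₃ a) (Φ-proper p₄ b))
      (λ a b → proper (sq-odd a b) (Φ-proper p₅ a) (Φ-proper p₆ b)))
    (⊕-cong
      (≈-trans (series₂-cong sq-even (λ a b → half-weights (lin s a) (lin d b) i j (sg-even a b) (k-even s d a b) (l-even s d a b)))
        (≈-sym (series-⊗ (Φ-proper p₃) (Φ-proper p₄) (moment s i) (moment d j))))
      (≈-trans (series₂-cong {g′ = λ a b → -1ℤ ℤ.* (moment (s ℤ.+ + 7) i a ℤ.* moment (d ℤ.- + 7) j b)} sq-odd
        (λ a b → odd-weights (sg-odd a b) (half-weights (lin (s ℤ.+ + 7) a) (lin (d ℤ.- + 7) b) i j refl (k-odd s d a b) (l-odd s d a b))))
        (≈-trans (series₂-⋆ -1ℤ (λ a b → quad (s ℤ.+ + 7) a ℕ.+ quad (d ℤ.- + 7) b)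
                                 (λ a b → moment (s ℤ.+ + 7) i a ℤ.* moment (d ℤ.- + 7) j b))
          (≈-trans (⋆-cong -1ℤ (≈-sym (series-⊗ (Φ-proper p₅) (Φ-proper p₆) (moment (s ℤ.+ + 7) i) (moment (d ℤ.- + 7) j))))
            (coeffs (λ n → ℤP.-1*i≡-i _)))))))
    where
    sq-even : ∀ a b → E (a ℤ.+ b) (a ℤ.- b) ≡ quad s a ℕ.+ quad d b
    sq-even a b = sq-parallelogram (lin s a) (lin d b) (k-even s d a b) (l-even s d a b)
    sq-odd : ∀ a b → E (a ℤ.+ b) (a ℤ.- b ℤ.+ 1ℤ) ≡ quad (s ℤ.+ + 7) a ℕ.+ quad (d ℤ.- + 7) b
    sq-odd a b = sq-parallelogram (lin (s ℤ.+ + 7) a) (lin (d ℤ.- + 7) b) (k-odd s d a b) (l-odd s d a b)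
    proper : ∀ {a b x y z} → z ≡ x ℕ.+ y → a ℕ.≤ x → b ℕ.≤ y → a ℕ.≤ z × b ℕ.≤ z
    proper refl p q = ℕP.≤-trans p (ℕP.m≤m+n _ _) , ℕP.≤-trans q (ℕP.m≤n+m _ _)
    odd-weights : ∀ {c u v} → c ≡ -1ℤ → 1ℤ ℤ.* u ≡ v → c ℤ.* u ≡ -1ℤ ℤ.* v
    odd-weights {u = u} refl refl = cong (λ e → -1ℤ ℤ.* e) (sym (ℤP.*-identityˡ u))

  -- An entry `(c , a , b)` stands for `c k^a l^b`, and the lists used below are the expansions of
  -- `(k + l)^i (k - l)^j`. Each monomial separates into a product of two one-dimensional series.
  monomials : List (ℤ × ℕ × ℕ) → ℤ → ℤ → ℤ
  monomials []                 m n = 0ℤ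
  monomials ((c , a , b) ∷ ts) m n = c ℤ.* (sg m ℤ.* k m ℤ.^ a ℤ.* (sg n ℤ.* l n ℤ.^ b)) ℤ.+ monomials ts m n

  products : List (ℤ × ℕ × ℕ) → FPS
  products []                 = K 0ℤ
  products ((c , a , b) ∷ ts) = K c ⊗ (Θ (s ℤ.+ d) a ⊗ Θ (s ℤ.- d) b) ⊕ products ts

  series₂-monomials : ∀ ts → series₂ E (monomials ts) ≈ products ts
  series₂-monomials [] = coeffs (λ N → trans
    (sumZ-0 N (λ m _ → sumZ-0 N (λ n _ → ℤP.*-zeroˡ (mono (E m n) N)))) (sym (ℤP.*-zeroˡ (one N))))
  series₂-monomials ((c , a , b) ∷ ts) = ≈-trans
    (series₂-⊕ E (λ m n → c ℤ.* (sg m ℤ.* k m ℤ.^ a ℤ.* (sg n ℤ.* l n ℤ.^ b))) (monomials ts))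
    (⊕-cong (≈-trans (series₂-⋆ c E (λ m n → sg m ℤ.* k m ℤ.^ a ℤ.* (sg n ℤ.* l n ℤ.^ b)))
              (≈-trans (⋆-cong c (≈-sym (series-⊗ (sq-proper p₁) (sq-proper p₂) (λ m → sg m ℤ.* k m ℤ.^ a) (λ n → sg n ℤ.* l n ℤ.^ b))))
                (⋆-K c (Θ (s ℤ.+ d) a ⊗ Θ (s ℤ.- d) b))))
            (series₂-monomials ts))

  expand : ∀ i j ts → (∀ m n → weight i j m n ≡ monomials ts m n) → ⟨ s , i ∣ d , j ⟩ ≈ products ts
  expand i j ts h = ≈-trans (bracket i j) (≈-trans (series₂-cong {E} (λ _ _ → refl) h) (series₂-monomials ts))

  A B : ℕ → FPS
  A = Θ (s ℤ.+ d)
  B = Θ (s ℤ.- d)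

  add : ∀ c {f f′ g g′ r r′} → f ≈ f′ → g ≈ g′ → r ≈ r′ → K c ⊗ (f ⊗ g) ⊕ r ≈ K c ⊗ (f′ ⊗ g′) ⊕ r′
  add c p q r = ⊕-cong (⊗-cong (≈-refl {K c}) (⊗-cong p q)) r

  -- The hypotheses allow the values of `A` and `B` to be given in normal form: reduced to the
  -- indices -7, -5, -3, -1 by reflection and shift, or replaced by 0.
  bracket₀₀ : ∀ {u0 v0} → A 0 ≈ u0 → B 0 ≈ v0 →
              ⟨ s , 0 ∣ d , 0 ⟩ ≈ u0 ⊗ v0
  bracket₀₀ {u0} {v0} h0 g0 = ≈-trans
    (expand 0 0 ((+ 1 , 0 , 0) ∷ []) (λ m n → lem (sg m) (sg n) (k m) (l n)))
    (≈-trans (add (+ 1) h0 g0 ≈-refl)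
      (identity 2 (λ u0 v0 → con (+ 1) :* (u0 :* v0) :+ (con 0ℤ) := u0 :* v0) u0 v0))
    where
    lem : ∀ (x y k l : ℤ) → x ℤ.* y ℤ.* (1ℤ ℤ.* 1ℤ) ≡
          + 1 ℤ.* (x ℤ.* 1ℤ ℤ.* (y ℤ.* 1ℤ)) ℤ.+ 0ℤ
    lem = solve-∀

  bracket₁₀ : ∀ {u1 u0 v1 v0} → A 1 ≈ u1 → A 0 ≈ u0 → B 1 ≈ v1 → B 0 ≈ v0 →
              ⟨ s , 1 ∣ d , 0 ⟩ ≈ u1 ⊗ v0 ⊕ u0 ⊗ v1
  bracket₁₀ {u1} {u0} {v1} {v0} h1 h0 g1 g0 = ≈-trans
    (expand 1 0 ((+ 1 , 1 , 0) ∷ (+ 1 , 0 , 1) ∷ []) (λ m n → lem (sg m) (sg n) (k m) (l n)))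
    (≈-trans (add (+ 1) h1 g0 (add (+ 1) h0 g1 ≈-refl))
      (identity 4 (λ u1 u0 v1 v0 → con (+ 1) :* (u1 :* v0) :+ (con (+ 1) :* (u0 :* v1) :+ (con 0ℤ)) := u1 :* v0 :+ u0 :* v1) u1 u0 v1 v0))
    where
    lem : ∀ x y k l → x ℤ.* y ℤ.* (((k ℤ.+ l) ℤ.* 1ℤ) ℤ.* 1ℤ) ≡
          + 1 ℤ.* (x ℤ.* (k ℤ.* 1ℤ) ℤ.* (y ℤ.* 1ℤ)) ℤ.+ (+ 1 ℤ.* (x ℤ.* 1ℤ ℤ.* (y ℤ.* (l ℤ.* 1ℤ))) ℤ.+ 0ℤ)
    lem = solve-∀

  bracket₂₀ : ∀ {u2 u1 u0 v2 v1 v0} → A 2 ≈ u2 → A 1 ≈ u1 → A 0 ≈ u0 → B 2 ≈ v2 → B 1 ≈ v1 → B 0 ≈ v0 →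
              ⟨ s , 2 ∣ d , 0 ⟩ ≈ u2 ⊗ v0 ⊕ K (+ 2) ⊗ u1 ⊗ v1 ⊕ u0 ⊗ v2
  bracket₂₀ {u2} {u1} {u0} {v2} {v1} {v0} h2 h1 h0 g2 g1 g0 = ≈-trans
    (expand 2 0 ((+ 1 , 2 , 0) ∷ (+ 2 , 1 , 1) ∷ (+ 1 , 0 , 2) ∷ []) (λ m n → lem (sg m) (sg n) (k m) (l n)))
    (≈-trans (add (+ 1) h2 g0 (add (+ 2) h1 g1 (add (+ 1) h0 g2 ≈-refl)))
      (identity 6 (λ u2 u1 u0 v2 v1 v0 → con (+ 1) :* (u2 :* v0) :+ (con (+ 2) :* (u1 :* v1) :+ (con (+ 1) :* (u0 :* v2) :+ (con 0ℤ))) := u2 :* v0 :+ con (+ 2) :* u1 :* v1 :+ u0 :* v2) u2 u1 u0 v2 v1 v0))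
    where
    lem : ∀ x y k l → x ℤ.* y ℤ.* (((k ℤ.+ l) ℤ.* ((k ℤ.+ l) ℤ.* 1ℤ)) ℤ.* 1ℤ) ≡
          + 1 ℤ.* (x ℤ.* (k ℤ.* (k ℤ.* 1ℤ)) ℤ.* (y ℤ.* 1ℤ)) ℤ.+ (+ 2 ℤ.* (x ℤ.* (k ℤ.* 1ℤ) ℤ.* (y ℤ.* (l ℤ.* 1ℤ))) ℤ.+ (+ 1 ℤ.* (x ℤ.* 1ℤ ℤ.* (y ℤ.* (l ℤ.* (l ℤ.* 1ℤ)))) ℤ.+ 0ℤ))
    lem = solve-∀

  bracket₂₁ : ∀ {u3 u2 u1 u0 v3 v2 v1 v0} → A 3 ≈ u3 → A 2 ≈ u2 → A 1 ≈ u1 → A 0 ≈ u0 → B 3 ≈ v3 → B 2 ≈ v2 → B 1 ≈ v1 → B 0 ≈ v0 →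
              ⟨ s , 2 ∣ d , 1 ⟩ ≈ u3 ⊗ v0 ⊕ u2 ⊗ v1 ⊕ neg (u1 ⊗ v2) ⊕ neg (u0 ⊗ v3)
  bracket₂₁ {u3} {u2} {u1} {u0} {v3} {v2} {v1} {v0} h3 h2 h1 h0 g3 g2 g1 g0 = ≈-trans
    (expand 2 1 ((+ 1 , 3 , 0) ∷ (+ 1 , 2 , 1) ∷ (ℤ.- + 1 , 1 , 2) ∷ (ℤ.- + 1 , 0 , 3) ∷ []) (λ m n → lem (sg m) (sg n) (k m) (l n)))
    (≈-trans (add (+ 1) h3 g0 (add (+ 1) h2 g1 (add (ℤ.- + 1) h1 g2 (add (ℤ.- + 1) h0 g3 ≈-refl))))
      (identity 8 (λ u3 u2 u1 u0 v3 v2 v1 v0 → con (+ 1) :* (u3 :* v0) :+ (con (+ 1) :* (u2 :* v1) :+ (con (ℤ.- + 1) :* (u1 :* v2) :+ (con (ℤ.- + 1) :* (u0 :* v3) :+ (con 0ℤ)))) := u3 :* v0 :+ u2 :* v1 :- u1 :* v2 :- u0 :* v3) u3 u2 u1 u0 v3 v2 v1 v0))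
    where
    lem : ∀ x y k l → x ℤ.* y ℤ.* (((k ℤ.+ l) ℤ.* ((k ℤ.+ l) ℤ.* 1ℤ)) ℤ.* ((k ℤ.- l) ℤ.* 1ℤ)) ≡
          + 1 ℤ.* (x ℤ.* (k ℤ.* (k ℤ.* (k ℤ.* 1ℤ))) ℤ.* (y ℤ.* 1ℤ)) ℤ.+ (+ 1 ℤ.* (x ℤ.* (k ℤ.* (k ℤ.* 1ℤ)) ℤ.* (y ℤ.* (l ℤ.* 1ℤ))) ℤ.+ ((ℤ.- + 1) ℤ.* (x ℤ.* (k ℤ.* 1ℤ) ℤ.* (y ℤ.* (l ℤ.* (l ℤ.* 1ℤ)))) ℤ.+ ((ℤ.- + 1) ℤ.* (x ℤ.* 1ℤ ℤ.* (y ℤ.* (l ℤ.* (l ℤ.* (l ℤ.* 1ℤ))))) ℤ.+ 0ℤ)))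
    lem = solve-∀

  bracket₀₂ : ∀ {u2 u1 u0 v2 v1 v0} → A 2 ≈ u2 → A 1 ≈ u1 → A 0 ≈ u0 → B 2 ≈ v2 → B 1 ≈ v1 → B 0 ≈ v0 →
              ⟨ s , 0 ∣ d , 2 ⟩ ≈ u2 ⊗ v0 ⊕ neg (K (+ 2) ⊗ u1 ⊗ v1) ⊕ u0 ⊗ v2
  bracket₀₂ {u2} {u1} {u0} {v2} {v1} {v0} h2 h1 h0 g2 g1 g0 = ≈-trans
    (expand 0 2 ((+ 1 , 2 , 0) ∷ (ℤ.- + 2 , 1 , 1) ∷ (+ 1 , 0 , 2) ∷ []) (λ m n → lem (sg m) (sg n) (k m) (l n)))
    (≈-trans (add (+ 1) h2 g0 (add (ℤ.- + 2) h1 g1 (add (+ 1) h0 g2 ≈-refl)))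
      (identity 6 (λ u2 u1 u0 v2 v1 v0 → con (+ 1) :* (u2 :* v0) :+ (con (ℤ.- + 2) :* (u1 :* v1) :+ (con (+ 1) :* (u0 :* v2) :+ (con 0ℤ))) := u2 :* v0 :- con (+ 2) :* u1 :* v1 :+ u0 :* v2) u2 u1 u0 v2 v1 v0))
    where
    lem : ∀ x y k l → x ℤ.* y ℤ.* (1ℤ ℤ.* ((k ℤ.- l) ℤ.* ((k ℤ.- l) ℤ.* 1ℤ))) ≡
          + 1 ℤ.* (x ℤ.* (k ℤ.* (k ℤ.* 1ℤ)) ℤ.* (y ℤ.* 1ℤ)) ℤ.+ ((ℤ.- + 2) ℤ.* (x ℤ.* (k ℤ.* 1ℤ) ℤ.* (y ℤ.* (l ℤ.* 1ℤ))) ℤ.+ (+ 1 ℤ.* (x ℤ.* 1ℤ ℤ.* (y ℤ.* (l ℤ.* (l ℤ.* 1ℤ)))) ℤ.+ 0ℤ))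
    lem = solve-∀

  bracket₀₄ : ∀ {u4 u3 u2 u1 u0 v4 v3 v2 v1 v0} → A 4 ≈ u4 → A 3 ≈ u3 → A 2 ≈ u2 → A 1 ≈ u1 → A 0 ≈ u0 → B 4 ≈ v4 → B 3 ≈ v3 → B 2 ≈ v2 → B 1 ≈ v1 → B 0 ≈ v0 →
              ⟨ s , 0 ∣ d , 4 ⟩ ≈ u4 ⊗ v0 ⊕ neg (K (+ 4) ⊗ u3 ⊗ v1) ⊕ K (+ 6) ⊗ u2 ⊗ v2 ⊕ neg (K (+ 4) ⊗ u1 ⊗ v3) ⊕ u0 ⊗ v4
  bracket₀₄ {u4} {u3} {u2} {u1} {u0} {v4} {v3} {v2} {v1} {v0} h4 h3 h2 h1 h0 g4 g3 g2 g1 g0 = ≈-trans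
    (expand 0 4 ((+ 1 , 4 , 0) ∷ (ℤ.- + 4 , 3 , 1) ∷ (+ 6 , 2 , 2) ∷ (ℤ.- + 4 , 1 , 3) ∷ (+ 1 , 0 , 4) ∷ []) (λ m n → lem (sg m) (sg n) (k m) (l n)))
    (≈-trans (add (+ 1) h4 g0 (add (ℤ.- + 4) h3 g1 (add (+ 6) h2 g2 (add (ℤ.- + 4) h1 g3 (add (+ 1) h0 g4 ≈-refl)))))
      (identity 10 (λ u4 u3 u2 u1 u0 v4 v3 v2 v1 v0 → con (+ 1) :* (u4 :* v0) :+ (con (ℤ.- + 4) :* (u3 :* v1) :+ (con (+ 6) :* (u2 :* v2) :+ (con (ℤ.- + 4) :* (u1 :* v3) :+ (con (+ 1) :* (u0 :* v4) :+ (con 0ℤ))))) := u4 :* v0 :- con (+ 4) :* u3 :* v1 :+ con (+ 6) :* u2 :* v2 :- con (+ 4) :* u1 :* v3 :+ u0 :* v4) u4 u3 u2 u1 u0 v4 v3 v2 v1 v0))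
    where
    lem : ∀ x y k l → x ℤ.* y ℤ.* (1ℤ ℤ.* ((k ℤ.- l) ℤ.* ((k ℤ.- l) ℤ.* ((k ℤ.- l) ℤ.* ((k ℤ.- l) ℤ.* 1ℤ))))) ≡
          + 1 ℤ.* (x ℤ.* (k ℤ.* (k ℤ.* (k ℤ.* (k ℤ.* 1ℤ)))) ℤ.* (y ℤ.* 1ℤ)) ℤ.+ ((ℤ.- + 4) ℤ.* (x ℤ.* (k ℤ.* (k ℤ.* (k ℤ.* 1ℤ))) ℤ.* (y ℤ.* (l ℤ.* 1ℤ))) ℤ.+ (+ 6 ℤ.* (x ℤ.* (k ℤ.* (k ℤ.* 1ℤ)) ℤ.* (y ℤ.* (l ℤ.* (l ℤ.* 1ℤ)))) ℤ.+ ((ℤ.- + 4) ℤ.* (x ℤ.* (k ℤ.* 1ℤ) ℤ.* (y ℤ.* (l ℤ.* (l ℤ.* (l ℤ.* 1ℤ))))) ℤ.+ (+ 1 ℤ.* (x ℤ.* 1ℤ ℤ.* (y ℤ.* (l ℤ.* (l ℤ.* (l ℤ.* (l ℤ.* 1ℤ)))))) ℤ.+ 0ℤ))))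
    lem = solve-∀

  bracket₂₄ : ∀ {u6 u5 u4 u3 u2 u1 u0 v6 v5 v4 v3 v2 v1 v0} → A 6 ≈ u6 → A 5 ≈ u5 → A 4 ≈ u4 → A 3 ≈ u3 → A 2 ≈ u2 → A 1 ≈ u1 → A 0 ≈ u0 → B 6 ≈ v6 → B 5 ≈ v5 → B 4 ≈ v4 → B 3 ≈ v3 → B 2 ≈ v2 → B 1 ≈ v1 → B 0 ≈ v0 →
              ⟨ s , 2 ∣ d , 4 ⟩ ≈ u6 ⊗ v0 ⊕ neg (K (+ 2) ⊗ u5 ⊗ v1) ⊕ neg (u4 ⊗ v2) ⊕ K (+ 4) ⊗ u3 ⊗ v3 ⊕ neg (u2 ⊗ v4) ⊕ neg (K (+ 2) ⊗ u1 ⊗ v5) ⊕ u0 ⊗ v6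
  bracket₂₄ {u6} {u5} {u4} {u3} {u2} {u1} {u0} {v6} {v5} {v4} {v3} {v2} {v1} {v0} h6 h5 h4 h3 h2 h1 h0 g6 g5 g4 g3 g2 g1 g0 = ≈-trans
    (expand 2 4 ((+ 1 , 6 , 0) ∷ (ℤ.- + 2 , 5 , 1) ∷ (ℤ.- + 1 , 4 , 2) ∷ (+ 4 , 3 , 3) ∷ (ℤ.- + 1 , 2 , 4) ∷ (ℤ.- + 2 , 1 , 5) ∷ (+ 1 , 0 , 6) ∷ []) (λ m n → lem (sg m) (sg n) (k m) (l n)))
    (≈-trans (add (+ 1) h6 g0 (add (ℤ.- + 2) h5 g1 (add (ℤ.- + 1) h4 g2 (add (+ 4) h3 g3 (add (ℤ.- + 1) h2 g4 (add (ℤ.- + 2) h1 g5 (add (+ 1) h0 g6 ≈-refl)))))))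
      (identity 14 (λ u6 u5 u4 u3 u2 u1 u0 v6 v5 v4 v3 v2 v1 v0 → con (+ 1) :* (u6 :* v0) :+ (con (ℤ.- + 2) :* (u5 :* v1) :+ (con (ℤ.- + 1) :* (u4 :* v2) :+ (con (+ 4) :* (u3 :* v3) :+ (con (ℤ.- + 1) :* (u2 :* v4) :+ (con (ℤ.- + 2) :* (u1 :* v5) :+ (con (+ 1) :* (u0 :* v6) :+ (con 0ℤ))))))) := u6 :* v0 :- con (+ 2) :* u5 :* v1 :- u4 :* v2 :+ con (+ 4) :* u3 :* v3 :- u2 :* v4 :- con (+ 2) :* u1 :* v5 :+ u0 :* v6) u6 u5 u4 u3 u2 u1 u0 v6 v5 v4 v3 v2 v1 v0))
    where
    lem : ∀ x y k l → x ℤ.* y ℤ.* (((k ℤ.+ l) ℤ.* ((k ℤ.+ l) ℤ.* 1ℤ)) ℤ.* ((k ℤ.- l) ℤ.* ((k ℤ.- l) ℤ.* ((k ℤ.- l) ℤ.* ((k ℤ.- l) ℤ.* 1ℤ))))) ≡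
          + 1 ℤ.* (x ℤ.* (k ℤ.* (k ℤ.* (k ℤ.* (k ℤ.* (k ℤ.* (k ℤ.* 1ℤ)))))) ℤ.* (y ℤ.* 1ℤ)) ℤ.+ ((ℤ.- + 2) ℤ.* (x ℤ.* (k ℤ.* (k ℤ.* (k ℤ.* (k ℤ.* (k ℤ.* 1ℤ))))) ℤ.* (y ℤ.* (l ℤ.* 1ℤ))) ℤ.+ ((ℤ.- + 1) ℤ.* (x ℤ.* (k ℤ.* (k ℤ.* (k ℤ.* (k ℤ.* 1ℤ)))) ℤ.* (y ℤ.* (l ℤ.* (l ℤ.* 1ℤ)))) ℤ.+ (+ 4 ℤ.* (x ℤ.* (k ℤ.* (k ℤ.* (k ℤ.* 1ℤ))) ℤ.* (y ℤ.* (l ℤ.* (l ℤ.* (l ℤ.* 1ℤ))))) ℤ.+ ((ℤ.- + 1) ℤ.* (x ℤ.* (k ℤ.* (k ℤ.* 1ℤ)) ℤ.* (y ℤ.* (l ℤ.* (l ℤ.* (l ℤ.* (l ℤ.* 1ℤ)))))) ℤ.+ ((ℤ.- + 2) ℤ.* (x ℤ.* (k ℤ.* 1ℤ) ℤ.* (y ℤ.* (l ℤ.* (l ℤ.* (l ℤ.* (l ℤ.* (l ℤ.* 1ℤ))))))) ℤ.+ (+ 1 ℤ.* (x ℤ.* 1ℤ ℤ.* (y ℤ.* (l ℤ.* (l ℤ.* (l ℤ.* (l ℤ.* (l ℤ.* (l ℤ.* 1ℤ)))))))) ℤ.+ 0ℤ))))))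
    lem = solve-∀

-- Plücker relations between theta functions

-- Four vectors `(vᵢ , uᵢ)` in the plane. The minors are taken in evaluated form, so that the
-- conclusion is directly a relation between theta series.
plücker : ∀ v₁ u₁ v₂ u₂ v₃ u₃ v₄ u₄ {p₁₂ p₃₄ p₁₃ p₂₄ p₁₄ p₂₃} →
  v₁ ⊗ u₂ ⊕ neg (u₁ ⊗ v₂) ≈ p₁₂ → v₃ ⊗ u₄ ⊕ neg (u₃ ⊗ v₄) ≈ p₃₄ →
  v₁ ⊗ u₃ ⊕ neg (u₁ ⊗ v₃) ≈ p₁₃ → v₂ ⊗ u₄ ⊕ neg (u₂ ⊗ v₄) ≈ p₂₄ →
  v₁ ⊗ u₄ ⊕ neg (u₁ ⊗ v₄) ≈ p₁₄ → v₂ ⊗ u₃ ⊕ neg (u₂ ⊗ v₃) ≈ p₂₃ →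
  p₁₂ ⊗ p₃₄ ⊕ neg (p₁₃ ⊗ p₂₄) ⊕ p₁₄ ⊗ p₂₃ ≈ K 0ℤ
plücker v₁ u₁ v₂ u₂ v₃ u₃ v₄ u₄ h₁₂ h₃₄ h₁₃ h₂₄ h₁₄ h₂₃ = ≈-trans
  (≈-sym (⊕-cong (⊕-cong (⊗-cong h₁₂ h₃₄) (neg-cong (⊗-cong h₁₃ h₂₄))) (⊗-cong h₁₄ h₂₃)))
  (identity 8 (λ v₁ u₁ v₂ u₂ v₃ u₃ v₄ u₄ →
      (v₁ :* u₂ :- u₁ :* v₂) :* (v₃ :* u₄ :- u₃ :* v₄) :-
      (v₁ :* u₃ :- u₁ :* v₃) :* (v₂ :* u₄ :- u₂ :* v₄) :+
      (v₁ :* u₄ :- u₁ :* v₄) :* (v₂ :* u₃ :- u₂ :* v₃) := con 0ℤ)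
    v₁ u₁ v₂ u₂ v₃ u₃ v₄ u₄)

-- Up to powers of q, t 1 is -14 (q^7 ; q^7)³ and a 0, b 0, d 0 are (q^i , q^(7-i) , q^7 ; q^7) for i = 1, 2, 3,
-- all with q replaced by q^56.
t a b d : ℕ → FPS
t = Θ (ℤ.- + 7)
a = Θ (ℤ.- + 5)
b = Θ (ℤ.- + 3)
d = Θ (ℤ.- + 1)

⋆1 : ∀ f → 1ℤ ⋆ f ≈ f
⋆1 f = coeffs (λ n → ℤP.*-identityˡ (f n))

⋆-1 : ∀ f → -1ℤ ⋆ f ≈ neg f
⋆-1 f = coeffs (λ n → ℤP.-1*i≡-i (f n))

flip₀ : ∀ β → Θ (ℤ.- β) 0 ≈ Θ β 0
flip₀ β = ≈-trans (Θ-neg β 0) (⋆1 (Θ β 0))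

flip₁ : ∀ β → Θ (ℤ.- β) 1 ≈ neg (Θ β 1)
flip₁ β = ≈-trans (Θ-neg β 1) (⋆-1 (Θ β 1))

flip₂ : ∀ β → Θ (ℤ.- β) 2 ≈ Θ β 2
flip₂ β = ≈-trans (Θ-neg β 2) (⋆1 (Θ β 2))

module _ (β : ℤ) {small : Small β} {small′ : Small (β ℤ.+ + 14)} where

  turn : ∀ r → Θ β r ≈ neg (Θ (β ℤ.+ + 14) r)
  turn r = ≈-trans (identity 1 (λ x → x := :- (:- x)) (Θ β r))
    (neg-cong (≈-sym (≈-trans (Θ-shift β r small small′) (⋆-1 (Θ β r)))))

  -- Needed for the indices -9, -11 and -13, which differences of points produce; they return to -5,
  -- -3 and -1.
  turn₀ : Θ β 0 ≈ neg (Θ (ℤ.- (β ℤ.+ + 14)) 0)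
  turn₀ = ≈-trans (turn 0) (neg-cong (≈-sym (flip₀ (β ℤ.+ + 14))))

  turn₁ : Θ β 1 ≈ Θ (ℤ.- (β ℤ.+ + 14)) 1
  turn₁ = ≈-trans (turn 1) (≈-sym (flip₁ (β ℤ.+ + 14)))

-- Reflection and shift both relate the index -7 to 7. For an even derivative they disagree in sign:
-- the index -7 belongs to the zero of the odd sigma function.
t-even : ∀ r → sgℕ r ≡ 1ℤ → t r ≈ K 0ℤ
t-even r even = coeffs (λ n → trans (x≡-x⇒x≡0 (t r n) (begin
  t r n                     ≡⟨ sym (ℤP.*-identityˡ (t r n)) ⟩
  1ℤ ℤ.* t r n              ≡⟨ cong (λ e → e ℤ.* t r n) (sym even) ⟩
  sgℕ r ℤ.* t r n           ≡⟨ sym (coeff (Θ-neg (ℤ.- + 7) r) n) ⟩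
  Θ (+ 7) r n               ≡⟨ coeff (≈-trans (Θ-shift (ℤ.- + 7) r tt tt) (⋆-1 (t r))) n ⟩
  ℤ.- t r n                 ∎)) (sym (ℤP.*-zeroˡ (one n))))
  where
  open ≡-Reasoning
  x≡-x⇒x≡0 : ∀ x → x ≡ ℤ.- x → x ≡ 0ℤ
  x≡-x⇒x≡0 (+ zero)   _  = refl
  x≡-x⇒x≡0 (+ suc n)  ()
  x≡-x⇒x≡0 (-[1+ n ]) ()

t₀ : t 0 ≈ K 0ℤ
t₀ = t-even 0 refl
t₂ : t 2 ≈ K 0ℤ
t₂ = t-even 2 refl
t₄ : t 4 ≈ K 0ℤ
t₄ = t-even 4 refl
t₆ : t 6 ≈ K 0ℤ
t₆ = t-even 6 refl

rfl : ∀ f → f ≈ f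
rfl f = ≈-refl {f}

module B (s d : ℤ) {p₁ p₂ p₃ p₄ p₅ p₆} = Bilinear s d {p₁} {p₂} {p₃} {p₄} {p₅} {p₆}

-- The two components of the vector at the point α, measured in sevenths of the quasi-period. The
-- bracket of the vectors at α and α′ is `Θ` at -7 + 2(α + α′) times `Θ` at -7 + 2(α - α′), the
-- analogue of σ(α + α′) σ(α - α′).
Φ⁻ Φ⁺ : ℕ → ℕ → FPS
Φ⁻ α = Φ (ℤ.- + 7 ℤ.+ + (2 ℕ.* α))
Φ⁺ α = Φ (+ (2 ℕ.* α))

pattern -7' = -[1+ 6 ]
pattern -5' = -[1+ 4 ]
pattern -3' = -[1+ 2 ]
pattern -1' = -[1+ 0 ]

-- Weierstrass's three-term relation at the points 0, 1, 2, 3. Modulo 7 and up to sign all their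
-- sums and differences are 1, 2 or 3, which leaves Klein's quartic in the three theta constants.
klein : a 0 ⊗ a 0 ⊗ a 0 ⊗ b 0 ⊕ d 0 ⊗ d 0 ⊗ d 0 ⊗ a 0 ≈ b 0 ⊗ b 0 ⊗ b 0 ⊗ d 0
klein = by-zero
  (plücker (Φ⁻ 0 0) (Φ⁺ 0 0) (Φ⁻ 1 0) (Φ⁺ 1 0) (Φ⁻ 2 0) (Φ⁺ 2 0) (Φ⁻ 3 0) (Φ⁺ 3 0)
    (B.bracket₀₀ -7' (+ 2) (rfl (a 0)) (turn₀ -[1+ 8 ]))
    (B.bracket₀₀ -3' (+ 6) (flip₀ -3') (turn₀ -[1+ 8 ]))
    (B.bracket₀₀ -7' (+ 4) (rfl (b 0)) (turn₀ -[1+ 10 ]))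
    (B.bracket₀₀ -5' (+ 6) (flip₀ -1') (turn₀ -[1+ 10 ]))
    (B.bracket₀₀ -7' (+ 6) (rfl (d 0)) (turn₀ -[1+ 12 ]))
    (B.bracket₀₀ -5' (+ 4) (rfl (d 0)) (turn₀ -[1+ 8 ])))
  (identity 3 (λ a b d → a :* a :* a :* b :+ d :* d :* d :* a :=
      b :* b :* b :* d :+ ((a :* :- a) :* (b :* :- a) :- (b :* :- b) :* (d :* :- b) :+ (d :* :- d) :* (d :* :- a)))
    (a 0) (b 0) (d 0))

-- The addition formula for ζ(u) + ζ(v) + ζ(w) - ζ(u + v + w), cleared of denominators.
zeta₁ : K (+ 2) ⊗ a 0 ⊗ a 1 ⊗ b 0 ⊗ d 0 ⊕ a 0 ⊗ a 0 ⊗ (b 0 ⊗ d 1 ⊕ b 1 ⊗ d 0) ≈ b 0 ⊗ d 0 ⊗ (t 1 ⊗ d 0)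
zeta₁ = by-zero
  (plücker (Φ⁻ 1 1) (Φ⁺ 1 1) (Φ⁻ 1 0) (Φ⁺ 1 0) (Φ⁻ 0 0) (Φ⁺ 0 0) (Φ⁻ 3 0) (Φ⁺ 3 0)
    (B.bracket₁₀ -5' (+ 2) (rfl (b 1)) (rfl (b 0)) (rfl (t 1)) t₀)
    (B.bracket₀₀ -7' (+ 6) (rfl (d 0)) (turn₀ -[1+ 12 ]))
    (B.bracket₁₀ -5' (+ 0) (rfl (a 1)) (rfl (a 0)) (rfl (a 1)) (rfl (a 0)))
    (B.bracket₀₀ -5' (+ 6) (flip₀ -1') (turn₀ -[1+ 10 ]))
    (B.bracket₁₀ -5' (+ 6) (flip₁ -1') (flip₀ -1') (turn₁ -[1+ 10 ]) (turn₀ -[1+ 10 ]))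
    (B.bracket₀₀ -5' (+ 0) (rfl (a 0)) (rfl (a 0))))
  (identity 7 (λ a a₁ b b₁ d d₁ t₁ →
      con (+ 2) :* a :* a₁ :* b :* d :+ a :* a :* (b :* d₁ :+ b₁ :* d) :=
      b :* d :* (t₁ :* d) :+
      ((b₁ :* con 0ℤ :+ b :* t₁) :* (d :* :- d) :- (a₁ :* a :+ a :* a₁) :* (d :* :- b) :+
       (:- d₁ :* :- b :+ d :* b₁) :* (a :* a)))
    (a 0) (a 1) (b 0) (b 1) (d 0) (d 1) (t 1))

-- As in `zeta₁`, two of the four points collide: the vector at α, its derivative and the vectors at
-- 0 and γ give 2ζ(α) - ζ(α + γ) - ζ(α - γ). Here α = 2 and γ = 1; `zeta₁` has α = 1, γ = 3 and
-- `zeta₃` has α = 3, γ = 2.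
zeta₂ : b 0 ⊗ b 0 ⊗ (a 1 ⊗ d 0 ⊕ a 0 ⊗ d 1) ≈ K (+ 2) ⊗ a 0 ⊗ b 0 ⊗ b 1 ⊗ d 0 ⊕ a 0 ⊗ d 0 ⊗ (t 1 ⊗ a 0)
zeta₂ = by-zero
  (plücker (Φ⁻ 2 1) (Φ⁺ 2 1) (Φ⁻ 2 0) (Φ⁺ 2 0) (Φ⁻ 0 0) (Φ⁺ 0 0) (Φ⁻ 1 0) (Φ⁺ 1 0)
    (B.bracket₁₀ -3' (+ 4) (flip₁ -1') (flip₀ -1') (rfl (t 1)) t₀)
    (B.bracket₀₀ -7' (+ 2) (rfl (a 0)) (turn₀ -[1+ 8 ]))
    (B.bracket₁₀ -3' (+ 0) (rfl (b 1)) (rfl (b 0)) (rfl (b 1)) (rfl (b 0)))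
    (B.bracket₀₀ -3' (+ 2) (rfl (d 0)) (rfl (a 0)))
    (B.bracket₁₀ -3' (+ 2) (rfl (d 1)) (rfl (d 0)) (rfl (a 1)) (rfl (a 0)))
    (B.bracket₀₀ -3' (+ 0) (rfl (b 0)) (rfl (b 0))))
  (identity 7 (λ a a₁ b b₁ d d₁ t₁ →
      b :* b :* (a₁ :* d :+ a :* d₁) :=
      con (+ 2) :* a :* b :* b₁ :* d :+ a :* d :* (t₁ :* a) :+
      ((:- d₁ :* con 0ℤ :+ d :* t₁) :* (a :* :- a) :- (b₁ :* b :+ b :* b₁) :* (d :* a) :+
       (d₁ :* a :+ d :* a₁) :* (b :* b)))
    (a 0) (a 1) (b 0) (b 1) (d 0) (d 1) (t 1))

zeta₃ : a 1 ⊗ b 0 ⊗ d 0 ⊗ d 0 ≈ K (+ 2) ⊗ a 0 ⊗ b 0 ⊗ d 0 ⊗ d 1 ⊕ a 0 ⊗ b 1 ⊗ d 0 ⊗ d 0 ⊕ a 0 ⊗ b 0 ⊗ (t 1 ⊗ b 0)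
zeta₃ = by-zero
  (plücker (Φ⁻ 3 1) (Φ⁺ 3 1) (Φ⁻ 3 0) (Φ⁺ 3 0) (Φ⁻ 0 0) (Φ⁺ 0 0) (Φ⁻ 2 0) (Φ⁺ 2 0)
    (B.bracket₁₀ -1' (+ 6) (flip₁ -5') (flip₀ -5') (rfl (t 1)) t₀)
    (B.bracket₀₀ -7' (+ 4) (rfl (b 0)) (turn₀ -[1+ 10 ]))
    (B.bracket₁₀ -1' (+ 0) (rfl (d 1)) (rfl (d 0)) (rfl (d 1)) (rfl (d 0)))
    (B.bracket₀₀ -1' (+ 4) (flip₀ -3') (rfl (a 0)))
    (B.bracket₁₀ -1' (+ 4) (flip₁ -3') (flip₀ -3') (rfl (a 1)) (rfl (a 0)))
    (B.bracket₀₀ -1' (+ 0) (rfl (d 0)) (rfl (d 0))))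
  (identity 7 (λ a a₁ b b₁ d d₁ t₁ →
      a₁ :* b :* d :* d :=
      con (+ 2) :* a :* b :* d :* d₁ :+ a :* b₁ :* d :* d :+ a :* b :* (t₁ :* b) :+
      ((:- a₁ :* con 0ℤ :+ a :* t₁) :* (b :* :- b) :- (d₁ :* d :+ d :* d₁) :* (b :* a) :+
       (:- b₁ :* a :+ b :* a₁) :* (d :* d)))
    (a 0) (a 1) (b 0) (b 1) (d 0) (d 1) (t 1))

-- Three points collide: the vector at α enters with its first two derivatives, next to the vector
-- at 0. Brackets at α alone give the series `g` at 2α times derivatives of `t`, those with 0 give
-- products of the series `f` at α. The entries `K 0ℤ` are `t 0` and `t 2`.
duplication : ∀ v₂ u₂ v₁ u₁ v₀ u₀ {f₀ f₁ f₂ g₀ g₁ g₂ g₃} →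
  v₂ ⊗ u₁ ⊕ neg (u₂ ⊗ v₁) ≈ g₃ ⊗ K 0ℤ ⊕ g₂ ⊗ t 1 ⊕ neg (g₁ ⊗ K 0ℤ) ⊕ neg (g₀ ⊗ t 3) →
  v₂ ⊗ u₀ ⊕ neg (u₂ ⊗ v₀) ≈ g₂ ⊗ K 0ℤ ⊕ K (+ 2) ⊗ g₁ ⊗ t 1 ⊕ g₀ ⊗ K 0ℤ →
  v₁ ⊗ u₀ ⊕ neg (u₁ ⊗ v₀) ≈ g₁ ⊗ K 0ℤ ⊕ g₀ ⊗ t 1 →
  v₀ ⊗ Φ⁺ 0 0 ⊕ neg (u₀ ⊗ Φ⁻ 0 0) ≈ f₀ ⊗ f₀ →
  v₁ ⊗ Φ⁺ 0 0 ⊕ neg (u₁ ⊗ Φ⁻ 0 0) ≈ f₁ ⊗ f₀ ⊕ f₀ ⊗ f₁ →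
  v₂ ⊗ Φ⁺ 0 0 ⊕ neg (u₂ ⊗ Φ⁻ 0 0) ≈ f₂ ⊗ f₀ ⊕ K (+ 2) ⊗ f₁ ⊗ f₁ ⊕ f₀ ⊗ f₂ →
  Duplication (t 1) (t 3) f₀ f₁ f₂ g₀ g₁ g₂
duplication v₂ u₂ v₁ u₁ v₀ u₀ {f₀} {f₁} {f₂} {g₀} {g₁} {g₂} {g₃} h₂₁ h₂₀ h₁₀ h₀ h₁ h₂ = by-zero
  (plücker v₂ u₂ v₁ u₁ v₀ u₀ (Φ⁻ 0 0) (Φ⁺ 0 0) h₂₁ h₀ h₂₀ h₁ h₂ h₁₀)
  (identity 9 (λ f₀ f₁ f₂ g₀ g₁ g₂ g₃ t₁ t₃ →
      (g₂ :* t₁ :- g₀ :* t₃) :* (f₀ :* f₀) :+ con (+ 2) :* (f₂ :* f₀ :+ f₁ :* f₁) :* (g₀ :* t₁) :=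
      con (+ 4) :* (f₁ :* f₀) :* (g₁ :* t₁) :+
      ((g₃ :* con 0ℤ :+ g₂ :* t₁ :- g₁ :* con 0ℤ :- g₀ :* t₃) :* (f₀ :* f₀) :-
       (g₂ :* con 0ℤ :+ con (+ 2) :* g₁ :* t₁ :+ g₀ :* con 0ℤ) :* (f₁ :* f₀ :+ f₀ :* f₁) :+
       (f₂ :* f₀ :+ con (+ 2) :* f₁ :* f₁ :+ f₀ :* f₂) :* (g₁ :* con 0ℤ :+ g₀ :* t₁)))
    f₀ f₁ f₂ g₀ g₁ g₂ g₃ (t 1) (t 3))

duplication₁ : Duplication (t 1) (t 3) (a 0) (a 1) (a 2) (b 0) (b 1) (b 2)
duplication₁ = duplication (Φ⁻ 1 2) (Φ⁺ 1 2) (Φ⁻ 1 1) (Φ⁺ 1 1) (Φ⁻ 1 0) (Φ⁺ 1 0)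
  {a 0} {a 1} {a 2} {b 0} {b 1} {b 2} {b 3}
  (B.bracket₂₁ -5' (+ 2) (rfl (b 3)) (rfl (b 2)) (rfl (b 1)) (rfl (b 0)) (rfl (t 3)) t₂ (rfl (t 1)) t₀)
  (B.bracket₂₀ -5' (+ 2) (rfl (b 2)) (rfl (b 1)) (rfl (b 0)) t₂ (rfl (t 1)) t₀)
  (B.bracket₁₀ -5' (+ 2) (rfl (b 1)) (rfl (b 0)) (rfl (t 1)) t₀)
  (B.bracket₀₀ -5' (+ 0) (rfl (a 0)) (rfl (a 0)))
  (B.bracket₁₀ -5' (+ 0) (rfl (a 1)) (rfl (a 0)) (rfl (a 1)) (rfl (a 0)))
  (B.bracket₂₀ -5' (+ 0) (rfl (a 2)) (rfl (a 1)) (rfl (a 0)) (rfl (a 2)) (rfl (a 1)) (rfl (a 0)))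

duplication₂ : Duplication (t 1) (t 3) (b 0) (b 1) (b 2) (d 0) (neg (d 1)) (d 2)
duplication₂ = duplication (Φ⁻ 2 2) (Φ⁺ 2 2) (Φ⁻ 2 1) (Φ⁺ 2 1) (Φ⁻ 2 0) (Φ⁺ 2 0)
  {b 0} {b 1} {b 2} {d 0} {neg (d 1)} {d 2} {Θ (+ 1) 3}
  (B.bracket₂₁ -3' (+ 4) (rfl (Θ (+ 1) 3)) (flip₂ -1') (flip₁ -1') (flip₀ -1') (rfl (t 3)) t₂ (rfl (t 1)) t₀)
  (B.bracket₂₀ -3' (+ 4) (flip₂ -1') (flip₁ -1') (flip₀ -1') t₂ (rfl (t 1)) t₀)
  (B.bracket₁₀ -3' (+ 4) (flip₁ -1') (flip₀ -1') (rfl (t 1)) t₀)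
  (B.bracket₀₀ -3' (+ 0) (rfl (b 0)) (rfl (b 0)))
  (B.bracket₁₀ -3' (+ 0) (rfl (b 1)) (rfl (b 0)) (rfl (b 1)) (rfl (b 0)))
  (B.bracket₂₀ -3' (+ 0) (rfl (b 2)) (rfl (b 1)) (rfl (b 0)) (rfl (b 2)) (rfl (b 1)) (rfl (b 0)))

duplication₃ : Duplication (t 1) (t 3) (d 0) (d 1) (d 2) (a 0) (neg (a 1)) (a 2)
duplication₃ = duplication (Φ⁻ 3 2) (Φ⁺ 3 2) (Φ⁻ 3 1) (Φ⁺ 3 1) (Φ⁻ 3 0) (Φ⁺ 3 0)
  {d 0} {d 1} {d 2} {a 0} {neg (a 1)} {a 2} {Θ (+ 5) 3}
  (B.bracket₂₁ -1' (+ 6) (rfl (Θ (+ 5) 3)) (flip₂ -5') (flip₁ -5') (flip₀ -5') (rfl (t 3)) t₂ (rfl (t 1)) t₀)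
  (B.bracket₂₀ -1' (+ 6) (flip₂ -5') (flip₁ -5') (flip₀ -5') t₂ (rfl (t 1)) t₀)
  (B.bracket₁₀ -1' (+ 6) (flip₁ -5') (flip₀ -5') (rfl (t 1)) t₀)
  (B.bracket₀₀ -1' (+ 0) (rfl (d 0)) (rfl (d 0)))
  (B.bracket₁₀ -1' (+ 0) (rfl (d 1)) (rfl (d 0)) (rfl (d 1)) (rfl (d 0)))
  (B.bracket₂₀ -1' (+ 0) (rfl (d 2)) (rfl (d 1)) (rfl (d 0)) (rfl (d 2)) (rfl (d 1)) (rfl (d 0)))

-- The counterpart of ℘″ = 6 ℘² - g₂ / 2.
quartic : K (+ 4) ⊗ (t 3 ⊗ t 3 ⊕ neg (t 1 ⊗ t 5)) ⊗ (a 0 ⊗ a 0) ⊕ K (+ 16) ⊗ (t 1 ⊗ t 3) ⊗ (a 2 ⊗ a 0 ⊕ neg (a 1 ⊗ a 1))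
        ≈ K (+ 4) ⊗ (t 1 ⊗ t 1) ⊗ (a 4 ⊗ a 0 ⊕ neg (K (+ 4) ⊗ a 3 ⊗ a 1) ⊕ K (+ 3) ⊗ a 2 ⊗ a 2)
quartic = by-zero
  -- At the point 0 both components are even in the elliptic variable, so the derivatives of order
  -- 0, 2 and 4 are the first three that do not vanish.
  (plücker (Φ⁻ 1 0) (Φ⁺ 1 0) (Φ⁻ 0 0) (Φ⁺ 0 0) (Φ⁻ 0 2) (Φ⁺ 0 2) (Φ⁻ 0 4) (Φ⁺ 0 4)
    (B.bracket₀₀ -5' (+ 0) (rfl (a 0)) (rfl (a 0)))
    (B.bracket₂₄ -7' (+ 0) t₆ (rfl (t 5)) t₄ (rfl (t 3)) t₂ (rfl (t 1)) t₀ t₆ (rfl (t 5)) t₄ (rfl (t 3)) t₂ (rfl (t 1)) t₀)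
    (B.bracket₀₂ -5' (+ 0) (rfl (a 2)) (rfl (a 1)) (rfl (a 0)) (rfl (a 2)) (rfl (a 1)) (rfl (a 0)))
    (B.bracket₀₄ -7' (+ 0) t₄ (rfl (t 3)) t₂ (rfl (t 1)) t₀ t₄ (rfl (t 3)) t₂ (rfl (t 1)) t₀)
    (B.bracket₀₄ -5' (+ 0) (rfl (a 4)) (rfl (a 3)) (rfl (a 2)) (rfl (a 1)) (rfl (a 0)) (rfl (a 4)) (rfl (a 3)) (rfl (a 2)) (rfl (a 1)) (rfl (a 0)))
    (B.bracket₀₂ -7' (+ 0) t₂ (rfl (t 1)) t₀ t₂ (rfl (t 1)) t₀))
  (identity 8 (λ a₀ a₁ a₂ a₃ a₄ t₁ t₃ t₅ →
      con (+ 4) :* (t₃ :* t₃ :- t₁ :* t₅) :* (a₀ :* a₀) :+ con (+ 16) :* (t₁ :* t₃) :* (a₂ :* a₀ :- a₁ :* a₁) :=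
      con (+ 4) :* (t₁ :* t₁) :* (a₄ :* a₀ :- con (+ 4) :* a₃ :* a₁ :+ con (+ 3) :* a₂ :* a₂) :+
      ((a₀ :* a₀) :* (con 0ℤ :* con 0ℤ :- con (+ 2) :* t₅ :* t₁ :- con 0ℤ :* con 0ℤ :+ con (+ 4) :* t₃ :* t₃ :- con 0ℤ :* con 0ℤ :- con (+ 2) :* t₁ :* t₅ :+ con 0ℤ :* con 0ℤ) :-
       (a₂ :* a₀ :- con (+ 2) :* a₁ :* a₁ :+ a₀ :* a₂) :* (con 0ℤ :* con 0ℤ :- con (+ 4) :* t₃ :* t₁ :+ con (+ 6) :* con 0ℤ :* con 0ℤ :- con (+ 4) :* t₁ :* t₃ :+ con 0ℤ :* con 0ℤ) :+
       (a₄ :* a₀ :- con (+ 4) :* a₃ :* a₁ :+ con (+ 6) :* a₂ :* a₂ :- con (+ 4) :* a₁ :* a₃ :+ a₀ :* a₄) :* (con 0ℤ :* con 0ℤ :- con (+ 2) :* t₁ :* t₁ :+ con 0ℤ :* con 0ℤ)))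
    (a 0) (a 1) (a 2) (a 3) (a 4) (t 1) (t 3) (t 5))

-- The triple product identity

K1≈one : K 1ℤ ≈ one
K1≈one = coeffs (λ n → ℤP.*-identityˡ (one n))

sumF : ℕ → (ℕ → FPS) → FPS
sumF zero    f = K 0ℤ
sumF (suc n) f = sumF n f ⊕ f n

sumF-cong : ∀ n {f g} → (∀ k → k ℕ.< n → f k ≈ g k) → sumF n f ≈ sumF n g
sumF-cong zero    h = ≈-refl
sumF-cong (suc n) h = ⊕-cong (sumF-cong n (λ k k<n → h k (ℕP.m<n⇒m<1+n k<n))) (h n ℕP.≤-refl)

sumF-⊕ : ∀ n f g → sumF n (λ k → f k ⊕ g k) ≈ sumF n f ⊕ sumF n g
sumF-⊕ zero    f g = identity 0 (con 0ℤ := con 0ℤ :+ con 0ℤ)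
sumF-⊕ (suc n) f g = ≈-trans (⊕-cong (sumF-⊕ n f g) (rfl (f n ⊕ g n)))
  (identity 4 (λ a b c d → (a :+ b) :+ (c :+ d) := (a :+ c) :+ (b :+ d)) (sumF n f) (sumF n g) (f n) (g n))

sumF-⊗ : ∀ n h f → sumF n (λ k → h ⊗ f k) ≈ h ⊗ sumF n f
sumF-⊗ zero    h f = identity 1 (λ h → con 0ℤ := h :* con 0ℤ) h
sumF-⊗ (suc n) h f = ≈-trans (⊕-cong (sumF-⊗ n h f) (rfl (h ⊗ f n)))
  (identity 3 (λ h a b → h :* a :+ h :* b := h :* (a :+ b)) h (sumF n f) (f n))

sumF-shift : ∀ n f → sumF (suc n) f ≈ f 0 ⊕ sumF n (λ k → f (suc k))
sumF-shift zero    f = identity 1 (λ x → con 0ℤ :+ x := x :+ con 0ℤ) (f 0)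
sumF-shift (suc n) f = ≈-trans (⊕-cong (sumF-shift n f) (rfl (f (suc n))))
  (identity 3 (λ a b c → (a :+ b) :+ c := a :+ (b :+ c)) (f 0) (sumF n (λ k → f (suc k))) (f (suc n)))

sumF-coeff : ∀ n f i → sumF n f i ≡ sumℤ n (λ k → f k i)
sumF-coeff zero    f i = K0 i
sumF-coeff (suc n) f i = cong (λ e → e ℤ.+ f n i) (sumF-coeff n f i)

-- gauss m k is the Gaussian binomial coefficient [m + k choose k] in base q^e.
module Gauss (e : ℕ) .{{_ : NonZero e}} where

  pow : ℕ → FPS
  pow k = mono (e ℕ.* k)

  gauss : ℕ → ℕ → FPS
  gauss m       zero    = one
  gauss zero    (suc k) = one
  gauss (suc m) (suc k) = pow (suc k) ⊗ gauss m (suc k) ⊕ gauss (suc m) k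

  gauss-0 : ∀ k → gauss 0 k ≈ one
  gauss-0 zero    = ≈-refl
  gauss-0 (suc k) = ≈-refl

  rising : ℕ → ℕ → FPS
  rising m k = pochT (e ℕ.* suc m) e k

  fac : ℕ → FPS
  fac k = pochT e e k

  pow-+ : ∀ i j → pow i ⊗ pow j ≈ pow (i ℕ.+ j)
  pow-+ i j = ≈-trans (mono-mono (e ℕ.* i) (e ℕ.* j)) (≡⇒≈ (cong mono (sym (ℕP.*-distribˡ-+ e i j))))

  pow-index : ∀ {i j} → i ≡ j → mono i ≈ mono j
  pow-index p = ≡⇒≈ (cong mono p)

  fac-suc : ∀ k → fac (suc k) ≈ fac k ⊗ (one ⊕ neg (pow (suc k)))
  fac-suc k = ⊗-cong (rfl (fac k)) (⊕-cong (rfl one) (neg-cong (pow-index (sym (ℕP.*-suc e k)))))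

  rising-suc : ∀ m k → rising m (suc k) ≈ rising m k ⊗ (one ⊕ neg (pow (suc m ℕ.+ k)))
  rising-suc m k = ⊗-cong (rfl (rising m k)) (⊕-cong (rfl one) (neg-cong (pow-index (sym (ℕP.*-distribˡ-+ e (suc m) k)))))

  rising-pre : ∀ m k → rising m (suc k) ≈ (one ⊕ neg (pow (suc m))) ⊗ rising (suc m) k
  rising-pre m zero    = ≈-trans (rising-suc m 0) (≈-trans (⊗-comm one (one ⊕ neg (pow (suc m ℕ.+ 0))))
    (⊗-cong (⊕-cong (rfl one) (neg-cong (pow-index (cong (e ℕ.*_) (ℕP.+-identityʳ (suc m)))))) (rfl one)))
  rising-pre m (suc k) = begin
    rising m (suc (suc k))
      ≈⟨ rising-suc m (suc k) ⟩
    rising m (suc k) ⊗ (one ⊕ neg (pow (suc m ℕ.+ suc k)))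
      ≈⟨ ⊗-cong (rising-pre m k) (⊕-cong (rfl one) (neg-cong (pow-index (cong (e ℕ.*_) (ℕP.+-suc (suc m) k))))) ⟩
    (one ⊕ neg (pow (suc m))) ⊗ rising (suc m) k ⊗ (one ⊕ neg (pow (suc (suc m) ℕ.+ k)))
      ≈⟨ ⊗-assoc (one ⊕ neg (pow (suc m))) (rising (suc m) k) (one ⊕ neg (pow (suc (suc m) ℕ.+ k))) ⟩
    (one ⊕ neg (pow (suc m))) ⊗ (rising (suc m) k ⊗ (one ⊕ neg (pow (suc (suc m) ℕ.+ k))))
      ≈⟨ ⊗-cong (rfl (one ⊕ neg (pow (suc m)))) (≈-sym (rising-suc (suc m) k)) ⟩
    (one ⊕ neg (pow (suc m))) ⊗ rising (suc m) (suc k) ∎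
    where open ≈-Reasoning

  rising-0 : ∀ k → rising 0 k ≈ fac k
  rising-0 k = ≡⇒≈ (cong (λ a → pochT a e k) (ℕP.*-identityʳ e))

  -- The closed form without quotients. It yields the second Pascal rule as well as the limit of the
  -- binomials.
  gauss-fac : ∀ m k → gauss m k ⊗ fac k ≈ rising m k
  gauss-fac m       zero    = ⊗-identityˡ one
  gauss-fac zero    (suc k) = ≈-trans (⊗-identityˡ (fac (suc k))) (≈-sym (rising-0 (suc k)))
  gauss-fac (suc m) (suc k) = begin
    (pow (suc k) ⊗ gauss m (suc k) ⊕ gauss (suc m) k) ⊗ fac (suc k)
      ≈⟨ by-zero
           (pow (suc k) · gauss-fac m (suc k) ⊞ pow (suc k) · rising-pre m k
             ⊞ gauss (suc m) k · fac-suc k ⊞ (one ⊕ neg (pow (suc k))) · gauss-fac (suc m) k)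
           (identity 9 (λ u p g g′ f f′ r r′ p′ →
               (p :* g :+ g′) :* f′ := r :* ((u :- p) :+ p :* (u :- p′)) :+
               (p :* (g :* f′ :- r′) :+ (p :* (r′ :- (u :- p′) :* r) :+
               (g′ :* (f′ :- f :* (u :- p)) :+ (u :- p) :* (g′ :* f :- r)))))
             one (pow (suc k)) (gauss m (suc k)) (gauss (suc m) k) (fac k) (fac (suc k)) (rising (suc m) k) (rising m (suc k)) (pow (suc m))) ⟩
    rising (suc m) k ⊗ ((one ⊕ neg (pow (suc k))) ⊕ pow (suc k) ⊗ (one ⊕ neg (pow (suc m))))
      ≈⟨ by-zero
           (rising (suc m) k · ⊗-identityʳ (pow (suc k)) ⊞ neg (rising (suc m) k) · pow-+ (suc k) (suc m))
           (identity 5 (λ r u p p′ p″ →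
               r :* ((u :- p) :+ p :* (u :- p′)) := r :* (u :- p″) :+
               (r :* (p :* u :- p) :+ :- r :* (p :* p′ :- p″)))
             (rising (suc m) k) one (pow (suc k)) (pow (suc m)) (pow (suc k ℕ.+ suc m))) ⟩
    rising (suc m) k ⊗ (one ⊕ neg (pow (suc k ℕ.+ suc m)))
      ≈⟨ ⊗-cong (rfl (rising (suc m) k)) (⊕-cong (rfl one) (neg-cong (pow-index (cong (e ℕ.*_) (lem m k))))) ⟩
    rising (suc m) k ⊗ (one ⊕ neg (pow (suc (suc m) ℕ.+ k)))
      ≈⟨ ≈-sym (rising-suc (suc m) k) ⟩
    rising (suc m) (suc k) ∎
    where
    open ≈-Reasoning
    lem : ∀ m k → suc k ℕ.+ suc m ≡ suc (suc m) ℕ.+ k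
    lem = solveℕ-∀

  Cancellable-fac : ∀ k → Cancellable (fac k)
  Cancellable-fac k = Cancellable-unit {fac k} (λ p → 1≢0 (trans (sym (pochT-0 e e k)) p))
    where
    1≢0 : ¬ (1ℤ ≡ 0ℤ)
    1≢0 ()

  -- The definition is one of the two Pascal rules; this other one follows from the closed form
  -- after multiplication by `fac`.
  gauss-pascal : ∀ m k → gauss (suc m) (suc k) ≈ gauss m (suc k) ⊕ pow (suc m) ⊗ gauss (suc m) k
  gauss-pascal m k = cancelˡ (Cancellable-fac (suc k)) (by-zero
    (K 1ℤ · gauss-fac (suc m) (suc k) ⊞ K -1ℤ · gauss-fac m (suc k)
      ⊞ neg (gauss (suc m) k ⊗ pow (suc m)) · fac-suc k
      ⊞ neg (pow (suc m) ⊗ (one ⊕ neg (pow (suc k)))) · gauss-fac (suc m) k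
      ⊞ K 1ℤ · rising-suc (suc m) k ⊞ K -1ℤ · rising-pre m k
      ⊞ rising (suc m) k · pow-+ (suc m) (suc k) ⊞ neg (rising (suc m) k) · ⊗-identityʳ (pow (suc m))
      ⊞ neg (rising (suc m) k) · pow-index (cong (e ℕ.*_) (lem m k)))
    (identity 13 (λ u p g g′ h f f′ r r′ p′ p″ r″ p‴ →
        f′ :* h := f′ :* (g :+ p :* g′) :+
        (con 1ℤ :* (h :* f′ :- r″) :+ (con -1ℤ :* (g :* f′ :- r′) :+
        (:- (g′ :* p) :* (f′ :- f :* (u :- p′)) :+ (:- (p :* (u :- p′)) :* (g′ :* f :- r) :+
        (con 1ℤ :* (r″ :- r :* (u :- p‴)) :+ (con -1ℤ :* (r′ :- (u :- p) :* r) :+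
        (r :* (p :* p′ :- p″) :+ (:- r :* (p :* u :- p) :+ :- r :* (p‴ :- p″))))))))))
      one (pow (suc m)) (gauss m (suc k)) (gauss (suc m) k) (gauss (suc m) (suc k)) (fac k) (fac (suc k))
      (rising (suc m) k) (rising m (suc k)) (pow (suc k)) (pow (suc m ℕ.+ suc k)) (rising (suc m) (suc k)) (pow (suc (suc m) ℕ.+ k))))
    where
    lem : ∀ m k → suc (suc m) ℕ.+ k ≡ suc m ℕ.+ suc k
    lem = solveℕ-∀

  gaussSum : ℕ → (ℕ → FPS) → FPS
  gaussSum L σ = sumF (suc L) (λ k → gauss (L ∸ k) k ⊗ σ k)

  gaussSum-cong : ∀ L {σ τ} → (∀ k → k ℕ.≤ L → σ k ≈ τ k) → gaussSum L σ ≈ gaussSum L τ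
  gaussSum-cong L h = sumF-cong (suc L) (λ { k (s≤s k≤L) → ⊗-cong (rfl (gauss (L ∸ k) k)) (h k k≤L) })

  gaussSum-⊗ : ∀ L h σ → gaussSum L (λ k → h ⊗ σ k) ≈ h ⊗ gaussSum L σ
  gaussSum-⊗ L h σ = ≈-trans
    (sumF-cong (suc L) (λ k _ → identity 3 (λ g h s → g :* (h :* s) := h :* (g :* s)) (gauss (L ∸ k) k) h (σ k)))
    (sumF-⊗ (suc L) h (λ k → gauss (L ∸ k) k ⊗ σ k))

  gaussSum-⊕ : ∀ L σ τ → gaussSum L (λ k → σ k ⊕ τ k) ≈ gaussSum L σ ⊕ gaussSum L τ
  gaussSum-⊕ L σ τ = ≈-trans
    (sumF-cong (suc L) (λ k _ → identity 3 (λ g s t → g :* (s :+ t) := g :* s :+ g :* t) (gauss (L ∸ k) k) (σ k) (τ k)))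
    (sumF-⊕ (suc L) (λ k → gauss (L ∸ k) k ⊗ σ k) (λ k → gauss (L ∸ k) k ⊗ τ k))

  sumF-split : ∀ L h f g → h 0 ≈ f 0 → (∀ k → k ℕ.< L → h (suc k) ≈ f (suc k) ⊕ g k) → h (suc L) ≈ g L →
               sumF (suc (suc L)) h ≈ sumF (suc L) f ⊕ sumF (suc L) g
  sumF-split L h f g first middle last = begin
    sumF (suc (suc L)) h
      ≈⟨ sumF-shift (suc L) h ⟩
    h 0 ⊕ (sumF L (λ k → h (suc k)) ⊕ h (suc L))
      ≈⟨ ⊕-cong first (⊕-cong (≈-trans (sumF-cong L middle) (sumF-⊕ L (λ k → f (suc k)) g)) last) ⟩
    f 0 ⊕ ((sumF L (λ k → f (suc k)) ⊕ sumF L g) ⊕ g L)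
      ≈⟨ identity 4 (λ a b c d → a :+ ((b :+ c) :+ d) := (a :+ b) :+ (c :+ d)) (f 0) (sumF L (λ k → f (suc k))) (sumF L g) (g L) ⟩
    (f 0 ⊕ sumF L (λ k → f (suc k))) ⊕ sumF (suc L) g
      ≈⟨ ⊕-cong (≈-sym (sumF-shift L f)) (rfl (sumF (suc L) g)) ⟩
    sumF (suc L) f ⊕ sumF (suc L) g ∎
    where open ≈-Reasoning

  pow-0 : ∀ f → pow 0 ⊗ f ≈ f
  pow-0 f = ≈-trans (⊗-cong (pow-index (ℕP.*-zeroʳ e)) (rfl f)) (⊗-identityˡ f)

  ∸-suc : ∀ {k L} → k ℕ.< L → L ∸ k ≡ suc (L ∸ suc k)
  ∸-suc {k} {suc L} (s≤s k≤L) = ℕP.+-∸-assoc 1 k≤L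

  gauss-L∸L : ∀ L k → gauss (L ∸ L) k ≈ one
  gauss-L∸L L k = ≈-trans (≡⇒≈ (cong (λ m → gauss m k) (ℕP.n∸n≡0 L))) (gauss-0 k)

  -- The two Pascal rules give two recursions in L, with weights `pow (L ∸ k)` and `pow k`. Each
  -- weight compensates the dependence on k of the difference of consecutive theta exponents, so
  -- that one binomial factor comes out of the whole sum.
  gaussSum-sucᴬ : ∀ L σ → gaussSum (suc L) σ ≈ gaussSum L σ ⊕ gaussSum L (λ k → pow (L ∸ k) ⊗ σ (suc k))
  gaussSum-sucᴬ L σ = sumF-split L
    (λ k → gauss (suc L ∸ k) k ⊗ σ k) (λ k → gauss (L ∸ k) k ⊗ σ k) (λ k → gauss (L ∸ k) k ⊗ (pow (L ∸ k) ⊗ σ (suc k)))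
    ≈-refl
    (λ k k<L → middle k (L ∸ suc k) (∸-suc k<L))
    (≈-trans (⊗-cong (gauss-L∸L L (suc L)) (rfl (σ (suc L))))
      (≈-sym (⊗-cong (gauss-L∸L L L)
        (≈-trans (⊗-cong (pow-index (cong (e ℕ.*_) (ℕP.n∸n≡0 L))) (rfl (σ (suc L)))) (pow-0 (σ (suc L)))))))
    where
    middle : ∀ k m {l} → l ≡ suc m → gauss l (suc k) ⊗ σ (suc k) ≈ gauss m (suc k) ⊗ σ (suc k) ⊕ gauss l k ⊗ (pow l ⊗ σ (suc k))
    middle k m refl = by-zero (σ (suc k) · gauss-pascal m k)
      (identity 5 (λ g g₁ g₂ p s → g :* s := g₁ :* s :+ g₂ :* (p :* s) :+ s :* (g :- (g₁ :+ p :* g₂)))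
        (gauss (suc m) (suc k)) (gauss m (suc k)) (gauss (suc m) k) (pow (suc m)) (σ (suc k)))

  gaussSum-sucᴮ : ∀ L σ → gaussSum (suc L) σ ≈ gaussSum L (λ k → pow k ⊗ σ k) ⊕ gaussSum L (λ k → σ (suc k))
  gaussSum-sucᴮ L σ = sumF-split L
    (λ k → gauss (suc L ∸ k) k ⊗ σ k) (λ k → gauss (L ∸ k) k ⊗ (pow k ⊗ σ k)) (λ k → gauss (L ∸ k) k ⊗ σ (suc k))
    (⊗-cong (rfl one) (≈-sym (pow-0 (σ 0))))
    (λ k k<L → middle k (L ∸ suc k) (∸-suc k<L))
    (⊗-cong (≈-trans (gauss-L∸L L (suc L)) (≈-sym (gauss-L∸L L L))) (rfl (σ (suc L))))
    where
    middle : ∀ k m {l} → l ≡ suc m → gauss l (suc k) ⊗ σ (suc k) ≈ gauss m (suc k) ⊗ (pow (suc k) ⊗ σ (suc k)) ⊕ gauss l k ⊗ σ (suc k)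
    middle k m refl = identity 4 (λ g₁ g₂ p s → (p :* g₁ :+ g₂) :* s := g₁ :* (p :* s) :+ g₂ :* s)
      (gauss m (suc k)) (gauss (suc m) k) (pow (suc k)) (σ (suc k))

  pochT-mod : ∀ a d k {n} → n ℕ.< a → pochT a d k n ≡ one n
  pochT-mod a d zero    n<a = refl
  pochT-mod a d (suc k) n<a = trans (pochT-suc a d k (ℕP.<-≤-trans n<a (ℕP.m≤m+n a (d ℕ.* k)))) (pochT-mod a d k n<a)

  -- For large m and k the binomial tends to the reciprocal of `(q^e ; q^e)_∞`; a coefficient has
  -- reached its limit once both m and k exceed its index.
  poch-gauss : ∀ m k n → n ℕ.< m → n ℕ.< k → (poch e e ⊗ gauss m k) n ≡ one n
  poch-gauss m k n n<m n<k = begin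
    (poch e e ⊗ gauss m k) n  ≡⟨ sym (coeff-< (⊗-cong-mod (poch-mod e e k) (≈⇒≈[] (rfl (gauss m k)))) n n<k) ⟩
    (fac k ⊗ gauss m k) n     ≡⟨ coeff (⊗-comm (fac k) (gauss m k)) n ⟩
    (gauss m k ⊗ fac k) n     ≡⟨ coeff (gauss-fac m k) n ⟩
    rising m k n              ≡⟨ pochT-mod (e ℕ.* suc m) e k (ℕP.<-≤-trans n<m
                                   (ℕP.≤-trans (ℕP.n≤1+n m) (ℕP.m≤n*m (suc m) e))) ⟩
    one n                     ∎
    where open ≡-Reasoning

-- The number 392 is also 2 · 14², the second difference of the exponents (14ν + β)².
open Gauss 392

term : ℤ → (ℤ → ℤ) → ℤ → FPS
term β c ν = c ν ⋆ mono (sq (lin β ν))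

mono-⋆-mono : ∀ a c b → mono a ⊗ (c ⋆ mono b) ≈ c ⋆ mono (a ℕ.+ b)
mono-⋆-mono a c b = ≈-trans (⊗-comm (mono a) (c ⋆ mono b)) (≈-trans (⋆-⊗ c (mono b) (mono a))
  (⋆-cong c (≈-trans (⊗-comm (mono b) (mono a)) (mono-mono a b))))

neg-⋆ : ∀ c f → neg (c ⋆ f) ≈ (ℤ.- c) ⋆ f
neg-⋆ c f = coeffs (λ n → ℤP.neg-distribˡ-* c (f n))

center : ℕ → ℤ → (ℤ → ℤ) → ℕ → FPS
center N β c k = term β c (+ k ℤ.- + N)

-- q^u and q^v stand for z and q^392 / z.
module TripleProduct (β : ℤ) (u v : ℕ) (hu : + u ≡ + 28 ℤ.* (β ℤ.+ + 7)) (hv : + v ≡ + 28 ℤ.* (+ 7 ℤ.- β)) where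

  -- Rows 2N and 2N + 1 of the Gaussian triangle. The passages between them alternately produce the
  -- factors `1 - z q^(392 N)` and `1 - q^(392 (N + 1)) / z`.
  even odd : ℕ → (ℤ → ℤ) → FPS
  even N c = gaussSum (N ℕ.+ N) (center N β c)
  odd  N c = gaussSum (suc (N ℕ.+ N)) (center N β c)

  move : ∀ {a a′ c c′ x y} → c ≡ ℤ.- c′ → a ℕ.+ sq x ≡ a′ ℕ.+ sq y →
         mono a ⊗ (c ⋆ mono (sq x)) ≈ neg (mono a′) ⊗ (c′ ⋆ mono (sq y))
  move {a} {a′} {c} {c′} {x} {y} refl eq = begin
    mono a ⊗ ((ℤ.- c′) ⋆ mono (sq x))   ≈⟨ mono-⋆-mono a (ℤ.- c′) (sq x) ⟩
    (ℤ.- c′) ⋆ mono (a ℕ.+ sq x)        ≈⟨ ≡⇒≈ (cong (λ e → (ℤ.- c′) ⋆ mono e) eq) ⟩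
    (ℤ.- c′) ⋆ mono (a′ ℕ.+ sq y)       ≈⟨ ≈-sym (neg-⋆ c′ (mono (a′ ℕ.+ sq y))) ⟩
    neg (c′ ⋆ mono (a′ ℕ.+ sq y))       ≈⟨ neg-cong (≈-sym (mono-⋆-mono a′ c′ (sq y))) ⟩
    neg (mono a′ ⊗ (c′ ⋆ mono (sq y)))  ≈⟨ identity 2 (λ m t → :- (m :* t) := :- m :* t) (mono a′) (c′ ⋆ mono (sq y)) ⟩
    neg (mono a′) ⊗ (c′ ⋆ mono (sq y))  ∎
    where open ≈-Reasoning

  +exponent : ∀ j x → + (392 ℕ.* j ℕ.+ sq x) ≡ + 392 ℤ.* + j ℤ.+ x ℤ.* x
  +exponent j x = trans (ℤP.pos-+ (392 ℕ.* j) (sq x)) (cong₂ ℤ._+_ (ℤP.pos-* 392 j) (+sq x))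

  +exponent′ : ∀ {w W} → + w ≡ W → ∀ N x → + (w ℕ.+ 392 ℕ.* N ℕ.+ sq x) ≡ W ℤ.+ + 392 ℤ.* + N ℤ.+ x ℤ.* x
  +exponent′ {w} hw N x = trans (ℤP.pos-+ (w ℕ.+ 392 ℕ.* N) (sq x)) (cong₂ ℤ._+_
    (trans (ℤP.pos-+ w (392 ℕ.* N)) (cong₂ ℤ._+_ hw (ℤP.pos-* 392 N))) (+sq x))

  index-suc : ∀ k N → + suc k ℤ.- + N ≡ (+ k ℤ.- + N) ℤ.+ 1ℤ
  index-suc k N = lem (+ k) (+ N)
    where
    lem : ∀ k N → 1ℤ ℤ.+ k ℤ.- N ≡ k ℤ.- N ℤ.+ 1ℤ
    lem = solve-∀

  index-pred : ∀ k N → + k ℤ.- + suc N ≡ (+ k ℤ.- + N) ℤ.- 1ℤ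
  index-pred k N = lem (+ k) (+ N)
    where
    lem : ∀ k N → k ℤ.- (1ℤ ℤ.+ N) ≡ k ℤ.- N ℤ.- 1ℤ
    lem = solve-∀

  -- For c′ = c = sg this is multiplication by 1 - z q^(392 N); for the weight k = lin β ν of Jacobi's identity
  -- the defect c′ - c is a multiple of sg.
  odd-even : ∀ N {c c′} → (∀ ν → c (ν ℤ.+ 1ℤ) ≡ ℤ.- c′ ν) →
             odd N c ≈ even N c ⊕ neg (mono (u ℕ.+ 392 ℕ.* N)) ⊗ even N c′
  odd-even N {c} {c′} h = ≈-trans (gaussSum-sucᴬ (N ℕ.+ N) (center N β c))
    (⊕-cong (rfl (even N c)) (≈-trans
      (gaussSum-cong (N ℕ.+ N) {τ = λ k → neg (mono (u ℕ.+ 392 ℕ.* N)) ⊗ center N β c′ k} pointwise)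
      (gaussSum-⊗ (N ℕ.+ N) (neg (mono (u ℕ.+ 392 ℕ.* N))) (center N β c′))))
    where
    lem : ∀ β k N → + 392 ℤ.* (N ℤ.+ N ℤ.- k) ℤ.+ (+ 14 ℤ.* (1ℤ ℤ.+ k ℤ.- N) ℤ.+ β) ℤ.* (+ 14 ℤ.* (1ℤ ℤ.+ k ℤ.- N) ℤ.+ β)
        ≡ + 28 ℤ.* (β ℤ.+ + 7) ℤ.+ + 392 ℤ.* N ℤ.+ (+ 14 ℤ.* (k ℤ.- N) ℤ.+ β) ℤ.* (+ 14 ℤ.* (k ℤ.- N) ℤ.+ β)
    lem = solve-∀
    pointwise : ∀ k → k ℕ.≤ N ℕ.+ N → pow (N ℕ.+ N ∸ k) ⊗ center N β c (suc k) ≈ neg (mono (u ℕ.+ 392 ℕ.* N)) ⊗ center N β c′ k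
    pointwise k k≤2N = move {x = x} {y = y}
      (trans (cong c (index-suc k N)) (h (+ k ℤ.- + N)))
      (+-sum (trans (+exponent (N ℕ.+ N ∸ k) x) (trans (cong (λ j → + 392 ℤ.* j ℤ.+ x ℤ.* x) complement) (lem β (+ k) (+ N))))
             (+exponent′ hu N y))
      where
      x y : ℤ
      x = lin β (+ suc k ℤ.- + N)
      y = lin β (+ k ℤ.- + N)
      complement : + (N ℕ.+ N ∸ k) ≡ + N ℤ.+ + N ℤ.- + k
      complement = trans (sym (ℤP.⊖-≥ k≤2N)) (trans (sym (ℤP.m-n≡m⊖n (N ℕ.+ N) k)) (cong (λ M → M ℤ.- + k) (ℤP.pos-+ N N)))

  even-odd : ∀ N {c c″} → (∀ ν → c (ν ℤ.- 1ℤ) ≡ ℤ.- c″ ν) →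
             even (suc N) c ≈ odd N c ⊕ neg (mono (v ℕ.+ 392 ℕ.* N)) ⊗ odd N c″
  even-odd N {c} {c″} h = ≈-trans
    (≡⇒≈ (cong (λ L → gaussSum (suc L) (center (suc N) β c)) (ℕP.+-suc N N)))
    (≈-trans (gaussSum-sucᴮ (suc (N ℕ.+ N)) (center (suc N) β c)) (≈-trans
      (⊕-cong
        (≈-trans (gaussSum-cong (suc (N ℕ.+ N)) {τ = λ k → neg (mono (v ℕ.+ 392 ℕ.* N)) ⊗ center N β c″ k} (λ k _ → move
            {x = lin β (+ k ℤ.- + suc N)} {y = lin β (+ k ℤ.- + N)}
            (trans (cong c (index-pred k N)) (h (+ k ℤ.- + N)))
            (+-sum (trans (+exponent k (lin β (+ k ℤ.- + suc N))) (lem β (+ k) (+ N)))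
                   (+exponent′ hv N (lin β (+ k ℤ.- + N))))))
          (gaussSum-⊗ (suc (N ℕ.+ N)) (neg (mono (v ℕ.+ 392 ℕ.* N))) (center N β c″)))
        (gaussSum-cong (suc (N ℕ.+ N)) {τ = center N β c} (λ k _ → ≡⇒≈ (cong (term β c) (lem′ (+ k) (+ N))))))
      (identity 2 (λ x y → x :+ y := y :+ x) (neg (mono (v ℕ.+ 392 ℕ.* N)) ⊗ odd N c″) (odd N c))))
    where
    lem : ∀ β k N → + 392 ℤ.* k ℤ.+ (+ 14 ℤ.* (k ℤ.- (1ℤ ℤ.+ N)) ℤ.+ β) ℤ.* (+ 14 ℤ.* (k ℤ.- (1ℤ ℤ.+ N)) ℤ.+ β)
        ≡ + 28 ℤ.* (+ 7 ℤ.- β) ℤ.+ + 392 ℤ.* N ℤ.+ (+ 14 ℤ.* (k ℤ.- N) ℤ.+ β) ℤ.* (+ 14 ℤ.* (k ℤ.- N) ℤ.+ β)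
    lem = solve-∀
    lem′ : ∀ k N → (1ℤ ℤ.+ k) ℤ.- (1ℤ ℤ.+ N) ≡ k ℤ.- N
    lem′ = solve-∀

  sg-pred : ∀ ν → sg (ν ℤ.- 1ℤ) ≡ ℤ.- sg ν
  sg-pred ν = trans (sym (ℤP.neg-involutive (sg (ν ℤ.- 1ℤ)))) (cong ℤ.-_
    (trans (sym (sg-suc (ν ℤ.- 1ℤ))) (cong sg (lem ν))))
    where
    lem : ∀ ν → ν ℤ.- 1ℤ ℤ.+ 1ℤ ≡ ν
    lem = solve-∀

  even-0 : ∀ c → even 0 c ≈ term β c 0ℤ
  even-0 c = ≈-trans (identity 2 (λ o x → con 0ℤ :+ o :* x := o :* x) one (term β c 0ℤ)) (⊗-identityˡ (term β c 0ℤ))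

  -- The finite form of Jacobi's triple product, `term β sg 0ℤ` being the monomial `q^(β²)`.
  finite : ∀ N → even N sg ≈ pochT u 392 N ⊗ pochT v 392 N ⊗ term β sg 0ℤ
  finite zero    = ≈-trans (even-0 sg) (≈-sym (≈-trans (⊗-cong (⊗-identityˡ one) (rfl (term β sg 0ℤ))) (⊗-identityˡ (term β sg 0ℤ))))
  finite (suc N) = by-zero
    (K 1ℤ · even-odd N {sg} {sg} sg-pred ⊞ (one ⊕ neg V) · odd-even N {sg} {sg} sg-suc
      ⊞ (one ⊕ neg V) ⊗ (one ⊕ neg U) · finite N
      ⊞ odd N sg · K1≈one ⊞ (one ⊕ neg V) ⊗ even N sg · K1≈one)
    (identity 9 (λ e′ o e U V p q t i →
        e′ := p :* (i :- U) :* (q :* (i :- V)) :* t :+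
        (con 1ℤ :* (e′ :- (o :+ :- V :* o)) :+ ((i :- V) :* (o :- (e :+ :- U :* e)) :+
        ((i :- V) :* (i :- U) :* (e :- p :* q :* t) :+ (o :* (con 1ℤ :- i) :+ (i :- V) :* e :* (con 1ℤ :- i))))))
      (even (suc N) sg) (odd N sg) (even N sg) U V (pochT u 392 N) (pochT v 392 N) (term β sg 0ℤ) one)
    where
    U V : FPS
    U = mono (u ℕ.+ 392 ℕ.* N)
    V = mono (v ℕ.+ 392 ℕ.* N)

sum-center : ∀ N h → sumℤ (suc (N ℕ.+ N)) (λ k → h (+ k ℤ.- + N)) ≡ sumZ N h
sum-center zero    h = ℤP.+-identityˡ (h 0ℤ)
sum-center (suc N) h = begin
  sumℤ (suc (suc N ℕ.+ suc N)) (λ k → h (+ k ℤ.- + suc N))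
    ≡⟨ cong (λ L → sumℤ (suc (suc L)) (λ k → h (+ k ℤ.- + suc N))) (ℕP.+-suc N N) ⟩
  sumℤ (suc (suc (N ℕ.+ N))) (λ k → h (+ k ℤ.- + suc N)) ℤ.+ h (+ suc (suc (N ℕ.+ N)) ℤ.- + suc N)
    ≡⟨ cong₂ ℤ._+_ (sum-shift (suc (N ℕ.+ N)) (λ k → h (+ k ℤ.- + suc N))) (cong h (trans (cong (λ x → (1ℤ ℤ.+ (1ℤ ℤ.+ x)) ℤ.- + suc N) (ℤP.pos-+ N N)) (lem (+ N)))) ⟩
  h -[1+ N ] ℤ.+ sumℤ (suc (N ℕ.+ N)) (λ k → h (+ suc k ℤ.- + suc N)) ℤ.+ h (+ suc N)
    ≡⟨ cong (λ S → h -[1+ N ] ℤ.+ S ℤ.+ h (+ suc N)) (trans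
         (sum-cong (suc (N ℕ.+ N)) (λ k _ → cong h (lem′ (+ k) (+ N)))) (sum-center N h)) ⟩
  h -[1+ N ] ℤ.+ sumZ N h ℤ.+ h (+ suc N)
    ≡⟨ lem″ (h -[1+ N ]) (sumZ N h) (h (+ suc N)) ⟩
  sumZ (suc N) h ∎
  where
  open ≡-Reasoning
  lem : ∀ N → 1ℤ ℤ.+ (1ℤ ℤ.+ (N ℤ.+ N)) ℤ.- (1ℤ ℤ.+ N) ≡ 1ℤ ℤ.+ N
  lem = solve-∀
  lem′ : ∀ k N → (1ℤ ℤ.+ k) ℤ.- (1ℤ ℤ.+ N) ≡ k ℤ.- N
  lem′ = solve-∀
  lem″ : ∀ a s b → a ℤ.+ s ℤ.+ b ≡ s ℤ.+ (b ℤ.+ a)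
  lem″ = solve-∀

mono-⊗-mod : ∀ a f g n → (∀ r → a ℕ.+ r ≡ n → f r ≡ g r) → (mono a ⊗ f) n ≡ (mono a ⊗ g) n
mono-⊗-mod a f g n h with a ℕ.≤? n
... | no a≰n = trans (mono-⊗-< a f (ℕP.≰⇒> a≰n)) (sym (mono-⊗-< a g (ℕP.≰⇒> a≰n)))
... | yes a≤n = go (n ∸ a) (ℕP.m+[n∸m]≡n a≤n)
  where
  go : ∀ r → a ℕ.+ r ≡ n → (mono a ⊗ f) n ≡ (mono a ⊗ g) n
  go r refl = trans (mono-⊗-+ a f r) (trans (h r refl) (sym (mono-⊗-+ a g r)))

distance : ∀ k N → k ℕ.≤ N ℕ.+ ∣ + k ℤ.- + N ∣ × N ℕ.≤ k ℕ.+ ∣ + k ℤ.- + N ∣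
distance k N =
  subst (λ x → ∣ x ∣ ℕ.≤ N ℕ.+ ∣ + k ℤ.- + N ∣) (lem (+ k) (+ N)) (ℤP.∣i+j∣≤∣i∣+∣j∣ (+ N) (+ k ℤ.- + N)) ,
  subst (λ x → ∣ x ∣ ℕ.≤ k ℕ.+ ∣ + k ℤ.- + N ∣) (lem′ (+ k) (+ N)) (ℤP.∣i-j∣≤∣i∣+∣j∣ (+ k) (+ k ℤ.- + N))
  where
  lem : ∀ k N → N ℤ.+ (k ℤ.- N) ≡ k
  lem = solve-∀
  lem′ : ∀ k N → k ℤ.- (k ℤ.- N) ≡ N
  lem′ = solve-∀

-- Properness gives |ν| ≤ e for the exponent e at ν. A coefficient r = n - e of the binomial
-- therefore has r + |ν| < N, so both indices k and 2N - k exceed r and `poch-gauss` applies. Terms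
-- with e > n vanish.
gaussSum-limit : ∀ {β} → Small β → ∀ c N n → n ℕ.< N →
  (poch 392 392 ⊗ gaussSum (N ℕ.+ N) (center N β c)) n ≡ series (λ ν → sq (lin β ν)) c n
gaussSum-limit {β} small c N n n<N = begin
  (poch 392 392 ⊗ gaussSum (N ℕ.+ N) (center N β c)) n
    ≡⟨ coeff (≈-sym (sumF-⊗ (suc (N ℕ.+ N)) (poch 392 392) (λ k → gauss (N ℕ.+ N ∸ k) k ⊗ center N β c k))) n ⟩
  sumF (suc (N ℕ.+ N)) (λ k → poch 392 392 ⊗ (gauss (N ℕ.+ N ∸ k) k ⊗ center N β c k)) n
    ≡⟨ sumF-coeff (suc (N ℕ.+ N)) (λ k → poch 392 392 ⊗ (gauss (N ℕ.+ N ∸ k) k ⊗ center N β c k)) n ⟩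
  sumℤ (suc (N ℕ.+ N)) (λ k → (poch 392 392 ⊗ (gauss (N ℕ.+ N ∸ k) k ⊗ center N β c k)) n)
    ≡⟨ sum-cong (suc (N ℕ.+ N)) (λ { k (s≤s k≤2N) → summand k k≤2N }) ⟩
  sumℤ (suc (N ℕ.+ N)) (λ k → term β c (+ k ℤ.- + N) n)
    ≡⟨ sum-center N (λ ν → term β c ν n) ⟩
  sumZ N (λ ν → term β c ν n)
    ≡⟨ sym (series-window (sq-proper small) c (ℕP.<⇒≤ n<N)) ⟩
  series (λ ν → sq (lin β ν)) c n ∎
  where
  open ≡-Reasoning
  summand : ∀ k → k ℕ.≤ N ℕ.+ N → (poch 392 392 ⊗ (gauss (N ℕ.+ N ∸ k) k ⊗ center N β c k)) n ≡ term β c (+ k ℤ.- + N) n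
  summand k k≤2N = begin
    (poch 392 392 ⊗ (gauss (N ℕ.+ N ∸ k) k ⊗ (x ⋆ mono e))) n
      ≡⟨ coeff (≈-trans (≈-sym (⊗-assoc (poch 392 392) (gauss (N ℕ.+ N ∸ k) k) (x ⋆ mono e)))
           (≈-trans (⊗-comm (poch 392 392 ⊗ gauss (N ℕ.+ N ∸ k) k) (x ⋆ mono e)) (⋆-⊗ x (mono e) (poch 392 392 ⊗ gauss (N ℕ.+ N ∸ k) k)))) n ⟩
    x ℤ.* (mono e ⊗ (poch 392 392 ⊗ gauss (N ℕ.+ N ∸ k) k)) n
      ≡⟨ cong (λ y → x ℤ.* y) (trans (mono-⊗-mod e (poch 392 392 ⊗ gauss (N ℕ.+ N ∸ k) k) one n
           (λ r e+r≡n → poch-gauss (N ℕ.+ N ∸ k) k r (proj₁ (inside r e+r≡n)) (proj₂ (inside r e+r≡n))))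
           (coeff (⊗-identityʳ (mono e)) n)) ⟩
    x ℤ.* mono e n ∎
    where
    ν : ℤ
    ν = + k ℤ.- + N
    x : ℤ
    x = c ν
    e : ℕ
    e = sq (lin β ν)
    inside : ∀ r → e ℕ.+ r ≡ n → r ℕ.< N ℕ.+ N ∸ k × r ℕ.< k
    inside r e+r≡n = ℕP.m+n≤o⇒m≤o∸n (suc r) (ℕP.≤-trans (ℕP.+-monoʳ-≤ (suc r) (proj₁ (distance k N)))
        (subst (ℕ._≤ N ℕ.+ N) (lem r N ∣ ν ∣) (ℕP.+-monoˡ-≤ N near)))
      , ℕP.+-cancelʳ-≤ ∣ ν ∣ (suc r) k (ℕP.≤-trans near (proj₂ (distance k N)))
      where
      near : suc r ℕ.+ ∣ ν ∣ ℕ.≤ N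
      near = ℕP.≤-trans (ℕP.≤-reflexive (ℕP.+-comm (suc r) ∣ ν ∣)) (ℕP.≤-trans
        (ℕP.+-monoˡ-≤ (suc r) (sq-proper small ν)) (ℕP.≤-trans (ℕP.≤-reflexive (ℕP.+-suc e r)) (ℕP.≤-trans (s≤s (ℕP.≤-reflexive e+r≡n)) n<N)))
      lem : ∀ r N v → suc r ℕ.+ v ℕ.+ N ≡ suc r ℕ.+ (N ℕ.+ v)
      lem = solveℕ-∀

triple-product : ∀ β u v .{{_ : NonZero u}} .{{_ : NonZero v}} → Small β →
  + u ≡ + 28 ℤ.* (β ℤ.+ + 7) → + v ≡ + 28 ℤ.* (+ 7 ℤ.- β) →
  Θ β 0 ≈ poch 392 392 ⊗ (poch u 392 ⊗ poch v 392 ⊗ term β sg 0ℤ)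
triple-product β u v small hu hv = coeffs λ n → begin
  Θ β 0 n
    ≡⟨ coeff (series-cong {e′ = λ ν → sq (lin β ν)} {c′ = sg} (λ ν → refl) (λ ν → ℤP.*-identityʳ (sg ν))) n ⟩
  series (λ ν → sq (lin β ν)) sg n
    ≡⟨ sym (gaussSum-limit small sg (suc n) n ℕP.≤-refl) ⟩
  (poch 392 392 ⊗ even (suc n) sg) n
    ≡⟨ coeff (⊗-cong (rfl (poch 392 392)) (finite (suc n))) n ⟩
  (poch 392 392 ⊗ (pochT u 392 (suc n) ⊗ pochT v 392 (suc n) ⊗ term β sg 0ℤ)) n
    ≡⟨ coeff-< (⊗-cong-mod (≈⇒≈[] (rfl (poch 392 392))) (⊗-cong-mod
         (⊗-cong-mod (poch-mod u 392 (suc n)) (poch-mod v 392 (suc n))) (≈⇒≈[] (rfl (term β sg 0ℤ))))) n ℕP.≤-refl ⟩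
  (poch 392 392 ⊗ (poch u 392 ⊗ poch v 392 ⊗ term β sg 0ℤ)) n ∎
  where
  open ≡-Reasoning
  open TripleProduct β u v hu hv

-- Jacobi's identity is the derivative of the triple product at the zero z = 1.
module Jacobi where

  open TripleProduct (ℤ.- + 7) 0 392 refl refl

  c₁ : ℤ → ℤ
  c₁ ν = sg ν ℤ.* lin (ℤ.- + 7) ν ℤ.^ 1

  shifted : ℤ → ℤ → ℤ
  shifted k ν = c₁ ν ℤ.+ k ℤ.* sg ν

  gaussSum-shifted : ∀ N L k → gaussSum L (center N (ℤ.- + 7) (shifted k)) ≈
                     gaussSum L (center N (ℤ.- + 7) c₁) ⊕ K k ⊗ gaussSum L (center N (ℤ.- + 7) sg)
  gaussSum-shifted N L k = ≈-trans
    (gaussSum-cong L {τ = λ i → center N (ℤ.- + 7) c₁ i ⊕ K k ⊗ center N (ℤ.- + 7) sg i} (λ i _ → ≈-trans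
      (coeffs (λ n → lem (c₁ (+ i ℤ.- + N)) k (sg (+ i ℤ.- + N)) (mono (sq (lin (ℤ.- + 7) (+ i ℤ.- + N))) n)))
      (⊕-cong (rfl (center N (ℤ.- + 7) c₁ i)) (⋆-K k (center N (ℤ.- + 7) sg i)))))
    (≈-trans (gaussSum-⊕ L (center N (ℤ.- + 7) c₁) (λ i → K k ⊗ center N (ℤ.- + 7) sg i))
      (⊕-cong (rfl (gaussSum L (center N (ℤ.- + 7) c₁))) (gaussSum-⊗ L (K k) (center N (ℤ.- + 7) sg))))
    where
    lem : ∀ a k s m → (a ℤ.+ k ℤ.* s) ℤ.* m ≡ a ℤ.* m ℤ.+ k ℤ.* (s ℤ.* m)
    lem = solve-∀

  c₁-suc : ∀ ν → c₁ (ν ℤ.+ 1ℤ) ≡ ℤ.- shifted (+ 14) ν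
  c₁-suc ν = trans (cong (λ s → s ℤ.* lin (ℤ.- + 7) (ν ℤ.+ 1ℤ) ℤ.^ 1) (sg-suc ν)) (lem (sg ν) ν)
    where
    lem : ∀ s ν → (ℤ.- s) ℤ.* ((+ 14 ℤ.* (ν ℤ.+ 1ℤ) ℤ.+ (ℤ.- + 7)) ℤ.* 1ℤ) ≡
                  ℤ.- (s ℤ.* ((+ 14 ℤ.* ν ℤ.+ (ℤ.- + 7)) ℤ.* 1ℤ) ℤ.+ + 14 ℤ.* s)
    lem = solve-∀

  c₁-pred : ∀ ν → c₁ (ν ℤ.- 1ℤ) ≡ ℤ.- shifted (ℤ.- + 14) ν
  c₁-pred ν = trans (cong (λ s → s ℤ.* lin (ℤ.- + 7) (ν ℤ.- 1ℤ) ℤ.^ 1) (sg-pred ν)) (lem (sg ν) ν)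
    where
    lem : ∀ s ν → (ℤ.- s) ℤ.* ((+ 14 ℤ.* (ν ℤ.- 1ℤ) ℤ.+ (ℤ.- + 7)) ℤ.* 1ℤ) ≡
                  ℤ.- (s ℤ.* ((+ 14 ℤ.* ν ℤ.+ (ℤ.- + 7)) ℤ.* 1ℤ) ℤ.+ (ℤ.- + 14) ℤ.* s)
    lem = solve-∀

  T : FPS
  T = term (ℤ.- + 7) sg 0ℤ

  pochT-0-vanishes : ∀ N → pochT 0 392 (suc N) ≈ K 0ℤ
  pochT-0-vanishes zero    = ≈-trans (⊗-identityˡ (one ⊖ one)) (coeffs (λ n → trans (ℤP.+-inverseʳ (one n)) (sym (K0 n))))
  pochT-0-vanishes (suc N) = ≈-trans (⊗-cong (pochT-0-vanishes N) (rfl (one ⊖ mono (392 ℕ.* suc N))))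
    (identity 1 (λ x → con 0ℤ :* x := con 0ℤ) (one ⊖ mono (392 ℕ.* suc N)))

  -- At z = 1 the product contains the factor `1 - q^0`.
  even-vanishes : ∀ N → even (suc N) sg ≈ K 0ℤ
  even-vanishes N = ≈-trans (finite (suc N))
    (≈-trans (⊗-cong (⊗-cong (pochT-0-vanishes N) (rfl (pochT 392 392 (suc N)))) (rfl T))
      (identity 2 (λ x t → con 0ℤ :* x :* t := con 0ℤ) (pochT 392 392 (suc N)) T))

  odd-vanishes : ∀ N → odd N sg ≈ K 0ℤ
  odd-vanishes zero    = by-zero
    (K 1ℤ · odd-even 0 {sg} {sg} sg-suc ⊞ even 0 sg · K1≈one)
    (identity 3 (λ o e i → o := con 0ℤ :+ (con 1ℤ :* (o :- (e :+ :- i :* e)) :+ e :* (con 1ℤ :- i))) (odd 0 sg) (even 0 sg) one)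
  odd-vanishes (suc N) = by-zero
    (K 1ℤ · odd-even (suc N) {sg} {sg} sg-suc ⊞ (one ⊕ neg (mono (392 ℕ.* suc N))) · even-vanishes N ⊞ even (suc N) sg · K1≈one)
    (identity 4 (λ o e u i → o := con 0ℤ :+ (con 1ℤ :* (o :- (e :+ :- u :* e)) :+ ((i :- u) :* (e :- con 0ℤ) :+ e :* (con 1ℤ :- i))))
      (odd (suc N) sg) (even (suc N) sg) (mono (392 ℕ.* suc N)) one)

  even-suc : ∀ N → even (suc N) c₁ ≈ odd N c₁ ⊗ (one ⊕ neg (mono (392 ℕ.+ 392 ℕ.* N)))
  even-suc N = by-zero
    (K 1ℤ · even-odd N {c₁} {shifted (ℤ.- + 14)} c₁-pred ⊞ neg V · gaussSum-shifted N (suc (N ℕ.+ N)) (ℤ.- + 14)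
      ⊞ K (+ 14) ⊗ V · odd-vanishes N ⊞ odd N c₁ · K1≈one)
    (identity 6 (λ e o V s z i →
        e := o :* (i :- V) :+
        (con 1ℤ :* (e :- (o :+ :- V :* s)) :+ (:- V :* (s :- (o :+ con (ℤ.- + 14) :* z)) :+
        (con (+ 14) :* V :* (z :- con 0ℤ) :+ o :* (con 1ℤ :- i)))))
      (even (suc N) c₁) (odd N c₁) V (odd N (shifted (ℤ.- + 14))) (odd N sg) one)
    where
    V : FPS
    V = mono (392 ℕ.+ 392 ℕ.* N)

  -- At N = 0 the factor `1 - z` vanishes and only the defect 14 of the weight survives,
  -- contributing `-14 T`. From then on the defect multiplies sums that vanish, and the factors
  -- `1 - q^(392 N)` accumulate, each twice.
  odd-closed : ∀ N → odd N c₁ ≈ K (ℤ.- + 14) ⊗ T ⊗ (pochT 392 392 N ⊗ pochT 392 392 N)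
  odd-closed zero    = by-zero
    (K 1ℤ · odd-even 0 {c₁} {shifted (+ 14)} c₁-suc ⊞ neg one · gaussSum-shifted 0 0 (+ 14)
      ⊞ K (ℤ.- + 14) ⊗ one · even-0 sg ⊞ (even 0 c₁ ⊕ K (ℤ.- + 14) ⊗ T ⊗ one) · K1≈one)
    (identity 6 (λ o e s z t i →
        o := con (ℤ.- + 14) :* t :* (i :* i) :+
        (con 1ℤ :* (o :- (e :+ :- i :* s)) :+ (:- i :* (s :- (e :+ con (+ 14) :* z)) :+
        (con (ℤ.- + 14) :* i :* (z :- t) :+ (e :+ con (ℤ.- + 14) :* t :* i) :* (con 1ℤ :- i)))))
      (odd 0 c₁) (even 0 c₁) (even 0 (shifted (+ 14))) (even 0 sg) T one)
  odd-closed (suc N) = by-zero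
    (K 1ℤ · odd-even (suc N) {c₁} {shifted (+ 14)} c₁-suc
      ⊞ neg U · gaussSum-shifted (suc N) (suc N ℕ.+ suc N) (+ 14)
      ⊞ K (ℤ.- + 14) ⊗ U · even-vanishes N ⊞ even (suc N) c₁ · K1≈one
      ⊞ (one ⊕ neg U) · even-suc N ⊞ (one ⊕ neg V) ⊗ (one ⊕ neg U) · odd-closed N
      ⊞ neg (K (ℤ.- + 14) ⊗ T ⊗ (p ⊗ p) ⊗ (one ⊕ neg V)) · ≡⇒≈ (cong mono (ℕP.*-suc 392 N)))
    (identity 10 (λ o e s z t i U V p o′ →
        o := con (ℤ.- + 14) :* t :* (p :* (i :- V) :* (p :* (i :- V))) :+
        (con 1ℤ :* (o :- (e :+ :- U :* s)) :+ (:- U :* (s :- (e :+ con (+ 14) :* z)) :+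
        (con (ℤ.- + 14) :* U :* (z :- con 0ℤ) :+ (e :* (con 1ℤ :- i) :+
        ((i :- U) :* (e :- o′ :* (i :- V)) :+ ((i :- V) :* (i :- U) :* (o′ :- con (ℤ.- + 14) :* t :* (p :* p)) :+
         :- (con (ℤ.- + 14) :* t :* (p :* p) :* (i :- V)) :* (U :- V))))))))
      (odd (suc N) c₁) (even (suc N) c₁) (even (suc N) (shifted (+ 14))) (even (suc N) sg) T one U V p (odd N c₁))
    where
    U V p : FPS
    U = mono (392 ℕ.* suc N)
    V = mono (392 ℕ.+ 392 ℕ.* N)
    p = pochT 392 392 N

  even-closed : ∀ N → even (suc N) c₁ ≈ K (ℤ.- + 14) ⊗ T ⊗ (pochT 392 392 N ⊗ pochT 392 392 (suc N))
  even-closed N = by-zero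
    (K 1ℤ · even-suc N ⊞ (one ⊕ neg V) · odd-closed N)
    (identity 6 (λ e o t p V i →
        e := con (ℤ.- + 14) :* t :* (p :* (p :* (i :- V))) :+
        (con 1ℤ :* (e :- o :* (i :- V)) :+ (i :- V) :* (o :- con (ℤ.- + 14) :* t :* (p :* p))))
      (even (suc N) c₁) (odd N c₁) T (pochT 392 392 N) V one)
    where
    V : FPS
    V = mono (392 ℕ.+ 392 ℕ.* N)

  jacobi : Θ (ℤ.- + 7) 1 ≈ poch 392 392 ⊗ (K (ℤ.- + 14) ⊗ T ⊗ (poch 392 392 ⊗ poch 392 392))
  jacobi = coeffs λ n → begin
    Θ (ℤ.- + 7) 1 n
      ≡⟨ sym (gaussSum-limit tt c₁ (suc (suc n)) n (ℕP.n≤1+n (suc n))) ⟩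
    (poch 392 392 ⊗ even (suc (suc n)) c₁) n
      ≡⟨ coeff (⊗-cong (rfl (poch 392 392)) (even-closed (suc n))) n ⟩
    (poch 392 392 ⊗ (K (ℤ.- + 14) ⊗ T ⊗ (pochT 392 392 (suc n) ⊗ pochT 392 392 (suc (suc n))))) n
      ≡⟨ coeff-< (⊗-cong-mod (≈⇒≈[] (rfl (poch 392 392))) (⊗-cong-mod (≈⇒≈[] (rfl (K (ℤ.- + 14) ⊗ T)))
           (⊗-cong-mod (poch-mod 392 392 (suc n)) (≈[]-weaken (ℕP.n≤1+n (suc n)) (poch-mod 392 392 (suc (suc n))))))) n ℕP.≤-refl ⟩
    (poch 392 392 ⊗ (K (ℤ.- + 14) ⊗ T ⊗ (poch 392 392 ⊗ poch 392 392))) n ∎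
    where open ≡-Reasoning

-- The logarithmic derivative of Euler's product

ones : FPS
ones zero    = 0ℤ
ones (suc n) = 1ℤ

-- The series `q^s / (1 - q^s)`, obtained from s = 1 by dilation. The value at 0 is a placeholder,
-- `dil` being defined for positive d.
geometric : ℕ → FPS
geometric zero    = K 0ℤ
geometric (suc s) = dil (suc s) ones

geometric-law : ∀ s → (one ⊕ neg (mono (suc s))) ⊗ geometric (suc s) ≈ mono (suc s)
geometric-law s = begin
  (one ⊕ neg (mono (suc s))) ⊗ dil (suc s) ones
    ≈⟨ ⊗-cong (≈-sym (≈-trans (dil-⊕ (suc s) one (neg (mono 1))) (⊕-cong (dil-one (suc s))
         (≈-trans (dil-neg (suc s) (mono 1)) (neg-cong dil-q))))) (rfl (dil (suc s) ones)) ⟩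
  dil (suc s) (one ⊕ neg (mono 1)) ⊗ dil (suc s) ones
    ≈⟨ ≈-sym (dil-⊗ (suc s) (one ⊕ neg (mono 1)) ones) ⟩
  dil (suc s) ((one ⊕ neg (mono 1)) ⊗ ones)
    ≈⟨ dil-cong (suc s) law₁ ⟩
  dil (suc s) (mono 1)
    ≈⟨ dil-q ⟩
  mono (suc s) ∎
  where
  open ≈-Reasoning
  dil-q : dil (suc s) (mono 1) ≈ mono (suc s)
  dil-q = ≈-trans (dil-mono (suc s) 1) (≡⇒≈ (cong mono (ℕP.*-identityˡ (suc s))))
  telescope : ∀ n → ones (suc n) ℤ.- ones n ≡ mono 1 (suc n)
  telescope zero    = refl
  telescope (suc n) = refl
  law₁ : (one ⊕ neg (mono 1)) ⊗ ones ≈ mono 1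
  law₁ = ≈-trans (identity 3 (λ o m f → (o :- m) :* f := o :* f :- m :* f) one (mono 1) ones)
    (≈-trans (⊕-cong (⊗-identityˡ ones) (rfl (neg (mono 1 ⊗ ones)))) (coeffs λ
      { zero    → refl
      ; (suc n) → trans (cong (λ e → ones (suc n) ℤ.- e) (mono-⊗-+ 1 ones n)) (telescope n) }))

lambert : ℕ → FPS
lambert M = sumF M (λ j → K (+ suc j) ⊗ geometric (suc j))

-- Logarithmic differentiation: the factor `1 - q^j` contributes `- j q^j / (1 - q^j)`.
θ-pochT : ∀ M → θ (pochT 1 1 M) ≈ neg (pochT 1 1 M ⊗ lambert M)
θ-pochT zero    = ≈-trans (≈-trans (θ-cong (≈-sym K1≈one)) (θ-K 1ℤ))
  (≈-trans (coeffs (λ n → sym (K0 n))) (identity 1 (λ o → con 0ℤ := :- (o :* con 0ℤ)) one))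
θ-pochT (suc M) = begin
  θ (pochT 1 1 M ⊗ (one ⊖ mono (1 ℕ.+ 1 ℕ.* M)))
    ≈⟨ θ-cong (⊗-cong (rfl (pochT 1 1 M)) factor) ⟩
  θ (p ⊗ f)
    ≈⟨ θ-⊗ p f ⟩
  θ p ⊗ f ⊕ p ⊗ θ f
    ≈⟨ ⊕-cong (⊗-cong (θ-pochT M) (rfl f)) (⊗-cong (rfl p) θf) ⟩
  neg (p ⊗ lambert M) ⊗ f ⊕ p ⊗ neg (k ⊗ m)
    ≈⟨ by-zero (neg (p ⊗ k) · ≈-sym (geometric-law M))
         (identity 6 (λ p l i k m g →
             :- (p :* l) :* (i :- m) :+ p :* :- (k :* m) :=
             :- (p :* (i :- m) :* (l :+ k :* g)) :+ :- (p :* k) :* (m :- (i :- m) :* g))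
           p (lambert M) one k m (geometric (suc M))) ⟩
  neg (p ⊗ f ⊗ lambert (suc M))
    ≈⟨ neg-cong (⊗-cong (⊗-cong (rfl p) (≈-sym factor)) (rfl (lambert (suc M)))) ⟩
  neg (pochT 1 1 (suc M) ⊗ lambert (suc M)) ∎
  where
  open ≈-Reasoning
  p f k m : FPS
  p = pochT 1 1 M
  m = mono (suc M)
  f = one ⊕ neg m
  k = K (+ suc M)
  factor : one ⊖ mono (1 ℕ.+ 1 ℕ.* M) ≈ f
  factor = ⊕-cong (rfl one) (neg-cong (≡⇒≈ (cong (λ i → mono (suc i)) (ℕP.*-identityˡ M))))
  θf : θ f ≈ neg (k ⊗ m)
  θf = ≈-trans (θ-⊕ one (neg m)) (≈-trans (⊕-cong (≈-trans (≈-trans (θ-cong (≈-sym K1≈one)) (θ-K 1ℤ)) (coeffs (λ n → sym (K0 n))))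
         (≈-trans (θ-neg m) (neg-cong (θ-mono (suc M)))))
       (identity 1 (λ x → con 0ℤ :+ x := x) (neg (k ⊗ m))))

-- The summand with index j starts at `q^(j + 1)`, so those with j ≥ i do not reach the coefficient
-- of `q^i`, and the sum may stop where the divisor sum does.
lambert-coeff : ∀ M i → i ℕ.< M → lambert M i ≡ lambertCoeff i
lambert-coeff M i i<M = begin
  lambert M i
    ≡⟨ sumF-coeff M (λ j → K (+ suc j) ⊗ geometric (suc j)) i ⟩
  sumℤ M (λ j → (K (+ suc j) ⊗ geometric (suc j)) i)
    ≡⟨ sum-cong M (λ j _ → sym (coeff (⋆-K (+ suc j) (geometric (suc j))) i)) ⟩
  sumℤ M (λ j → + suc j ℤ.* geometric (suc j) i)
    ≡⟨ truncate (ℕP.≤⇒≤′ (ℕP.<⇒≤ i<M)) ⟩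
  sumℤ i (λ j → + suc j ℤ.* geometric (suc j) i)
    ≡⟨ sum-cong i (λ j j<i → summand j i j<i) ⟩
  lambertCoeff i ∎
  where
  open ≡-Reasoning
  beyond : ∀ j i → i ℕ.≤ j → geometric (suc j) i ≡ 0ℤ
  beyond j zero    _   = dil-* (suc j) ones 0
  beyond j (suc i) i≤j = dil-∤ (suc j) ones (Div.>⇒∤ (s≤s i≤j))
  truncate : ∀ {M} → i ℕ.≤′ M → sumℤ M (λ j → + suc j ℤ.* geometric (suc j) i) ≡ sumℤ i (λ j → + suc j ℤ.* geometric (suc j) i)
  truncate ℕ.≤′-refl = refl
  truncate {suc M} (ℕ.≤′-step p) = trans
    (cong₂ ℤ._+_ (truncate p) (trans (cong (λ e → + suc M ℤ.* e) (beyond M i (ℕP.≤′⇒≤ p))) (ℤP.*-zeroʳ (+ suc M))))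
    (ℤP.+-identityʳ _)
  summand : ∀ j i → j ℕ.< i → + suc j ℤ.* geometric (suc j) i ≡ (if ⌊ suc j Div.∣? i ⌋ then + suc j else 0ℤ)
  summand j i j<i with suc j Div.∣? i
  summand j i j<i | no _ = ℤP.*-zeroʳ (+ suc j)
  summand j .(zero ℕ.* suc j) () | yes (Div.divides zero refl)
  summand j .(suc k ℕ.* suc j) j<i | yes (Div.divides (suc k) refl) =
    trans (cong (λ q → + suc j ℤ.* ones q) (DM.m*n/n≡m (suc k) (suc j))) (ℤP.*-identityʳ (+ suc j))

θ-euler : θ (poch 1 1) ≈ neg (poch 1 1 ⊗ lambertCoeff)
θ-euler = coeffs λ n → begin
  θ (poch 1 1) n
    ≡⟨ coeff (θ-pochT (suc n)) n ⟩
  ℤ.- (pochT 1 1 (suc n) ⊗ lambert (suc n)) n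
    ≡⟨ cong ℤ.-_ (coeff-< (⊗-cong-mod (poch-mod 1 1 (suc n)) (modulo (lambert-coeff (suc n)))) n ℕP.≤-refl) ⟩
  ℤ.- (poch 1 1 ⊗ lambertCoeff) n ∎
  where open ≡-Reasoning

-- The chain rule: a logarithmic derivative acquires the factor d under the substitution of q^d for
-- q.
θ-dil : ∀ d .{{_ : NonZero d}} {f g l} → θ f ≈ neg (f ⊗ l) → dil d f ≈ g → θ g ≈ neg (K (+ d) ⊗ (g ⊗ dil d l))
θ-dil d {f} {g} {l} h p = begin
  θ g                                      ≈⟨ θ-cong (≈-sym p) ⟩
  θ (dil d f)                              ≈⟨ dil-θ d f ⟩
  (+ d) ⋆ dil d (θ f)                      ≈⟨ ⋆-K (+ d) (dil d (θ f)) ⟩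
  K (+ d) ⊗ dil d (θ f)                    ≈⟨ ⊗-cong (rfl (K (+ d))) (≈-trans (dil-cong d h)
                                                (≈-trans (dil-neg d (f ⊗ l)) (neg-cong (dil-⊗ d f l)))) ⟩
  K (+ d) ⊗ neg (dil d f ⊗ dil d l)        ≈⟨ ⊗-cong (rfl (K (+ d))) (neg-cong (⊗-cong p (rfl (dil d l)))) ⟩
  K (+ d) ⊗ neg (g ⊗ dil d l)              ≈⟨ identity 2 (λ k x → k :* :- x := :- (k :* x)) (K (+ d)) (g ⊗ dil d l) ⟩
  neg (K (+ d) ⊗ (g ⊗ dil d l))            ∎
  where open ≈-Reasoning

P Λ : FPS
P = poch 392 392
Λ = dil 56 (dil 7 lambertCoeff)

θ-P : θ P ≈ neg (K (+ 392) ⊗ (P ⊗ Λ))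
θ-P = ≈-trans (θ-dil 56 {poch 7 7} {P} {K (+ 7) ⊗ dil 7 lambertCoeff}
    (≈-trans (θ-dil 7 {poch 1 1} {poch 7 7} {lambertCoeff} θ-euler (dil-poch 7 1 1))
      (identity 3 (λ k p l → :- (k :* (p :* l)) := :- (p :* (k :* l))) (K (+ 7)) (poch 7 7) (dil 7 lambertCoeff)))
    (dil-poch 56 7 7))
  (≈-trans (neg-cong (⊗-cong (rfl (K (+ 56))) (⊗-cong (rfl P)
      (≈-trans (dil-cong 56 (≈-sym (⋆-K (+ 7) (dil 7 lambertCoeff)))) (≈-trans (dil-⋆ 56 (+ 7) (dil 7 lambertCoeff)) (⋆-K (+ 7) Λ))))))
    (identity 2 (λ p l → :- (con (+ 56) :* (p :* (con (+ 7) :* l))) := :- (con (+ 392) :* (p :* l))) P Λ))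

𝒫≈ : 𝒫 ≈ one ⊕ neg (K (+ 24) ⊗ dil 7 lambertCoeff)
𝒫≈ = ≈-trans (≈-trans (coeffs (λ n → refl)) (dil-⊖ 7 one ((+ 24) ⋆ lambertCoeff)))
  (⊖-cong (dil-one 7) (≈-trans (dil-⋆ 7 (+ 24) lambertCoeff) (⋆-K (+ 24) (dil 7 lambertCoeff))))

-- The logarithmic derivative of `t 1 = -14 q^49 P³`: the monomial gives 49, and `P³` gives
-- `-3 · 392 Λ = -49 · 24 Λ`, so that the two parts combine to 49 times the dilated Eisenstein
-- series.
C : FPS
C = K (+ 49) ⊗ dil 56 𝒫

C≈ : C ≈ K (+ 49) ⊕ neg (K (+ 1176) ⊗ Λ)
C≈ = by-zero (K (+ 49) · ≈-trans (dil-cong 56 𝒫≈) (≈-trans (dil-⊕ 56 one (neg (K (+ 24) ⊗ dil 7 lambertCoeff)))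
       (⊕-cong (dil-one 56) (≈-trans (dil-neg 56 (K (+ 24) ⊗ dil 7 lambertCoeff)) (neg-cong
         (≈-trans (dil-cong 56 (≈-sym (⋆-K (+ 24) (dil 7 lambertCoeff)))) (≈-trans (dil-⋆ 56 (+ 24) (dil 7 lambertCoeff)) (⋆-K (+ 24) Λ)))))))
     ⊞ K (ℤ.- + 49) · K1≈one)
  (identity 3 (λ x l i → con (+ 49) :* x := con (+ 49) :- con (+ 1176) :* l :+
      (con (+ 49) :* (x :- (i :- con (+ 24) :* l)) :+ con (ℤ.- + 49) :* (con 1ℤ :- i)))
    (dil 56 𝒫) Λ one)

-- Product formulas for the theta series, and x, y, z as quotients of them

term-mono : ∀ e → 1ℤ ⋆ mono e ≈ mono e
term-mono e = coeffs (λ n → ℤP.*-identityˡ (mono e n))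

t₁≈ : t 1 ≈ K (ℤ.- + 14) ⊗ mono 49 ⊗ (P ⊗ P ⊗ P)
t₁≈ = ≈-trans Jacobi.jacobi (≈-trans (⊗-cong (rfl P) (⊗-cong (⊗-cong (rfl (K (ℤ.- + 14))) (term-mono 49)) (rfl (P ⊗ P))))
  (identity 3 (λ p k m → p :* (k :* m :* (p :* p)) := k :* m :* (p :* p :* p)) P (K (ℤ.- + 14)) (mono 49)))

dilate : ℕ → FPS
dilate i = dil 56 (poch i 7)

theta-product : ∀ β i j .{{_ : NonZero i}} .{{_ : NonZero j}} → Small β →
  + (i ℕ.* 56) ≡ + 28 ℤ.* (β ℤ.+ + 7) → + (j ℕ.* 56) ≡ + 28 ℤ.* (+ 7 ℤ.- β) →
  Θ β 0 ≈ P ⊗ (dilate i ⊗ dilate j ⊗ term β sg 0ℤ)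
theta-product β i j small hi hj = ≈-trans
  (triple-product β (i ℕ.* 56) (j ℕ.* 56) {{ℕP.m*n≢0 i 56}} {{ℕP.m*n≢0 j 56}} small hi hj)
  (⊗-cong (rfl P) (⊗-cong (⊗-cong (≈-sym (dil-poch 56 i 7)) (≈-sym (dil-poch 56 j 7))) (rfl (term β sg 0ℤ))))

a₀≈ : a 0 ≈ P ⊗ (dilate 1 ⊗ dilate 6 ⊗ mono 25)
a₀≈ = ≈-trans (theta-product (ℤ.- + 5) 1 6 tt refl refl) (⊗-cong (rfl P) (⊗-cong (rfl (dilate 1 ⊗ dilate 6)) (term-mono 25)))
b₀≈ : b 0 ≈ P ⊗ (dilate 2 ⊗ dilate 5 ⊗ mono 9)
b₀≈ = ≈-trans (theta-product (ℤ.- + 3) 2 5 tt refl refl) (⊗-cong (rfl P) (⊗-cong (rfl (dilate 2 ⊗ dilate 5)) (term-mono 9)))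
d₀≈ : d 0 ≈ P ⊗ (dilate 3 ⊗ dilate 4 ⊗ mono 1)
d₀≈ = ≈-trans (theta-product (ℤ.- + 1) 3 4 tt refl refl) (⊗-cong (rfl P) (⊗-cong (rfl (dilate 3 ⊗ dilate 4)) (term-mono 1)))

-- xS, - yS and zS have the form f ⊗ inv (g ⊗ h ⊗ g ⊗ h).
quotient : ∀ f g h → g 0 ≡ 1ℤ → h 0 ≡ 1ℤ →
           dil 56 (f ⊗ inv (g ⊗ h ⊗ g ⊗ h)) ⊗ (dil 56 g ⊗ dil 56 h) ⊗ (dil 56 g ⊗ dil 56 h) ≈ dil 56 f
quotient f g h g₀ h₀ = begin
  dil 56 (f ⊗ i) ⊗ (dil 56 g ⊗ dil 56 h) ⊗ (dil 56 g ⊗ dil 56 h)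
    ≈⟨ ⊗-cong (⊗-cong (rfl (dil 56 (f ⊗ i))) (≈-sym (dil-⊗ 56 g h))) (≈-sym (dil-⊗ 56 g h)) ⟩
  dil 56 (f ⊗ i) ⊗ dil 56 (g ⊗ h) ⊗ dil 56 (g ⊗ h)
    ≈⟨ ⊗-cong (≈-sym (dil-⊗ 56 (f ⊗ i) (g ⊗ h))) (rfl (dil 56 (g ⊗ h))) ⟩
  dil 56 (f ⊗ i ⊗ (g ⊗ h)) ⊗ dil 56 (g ⊗ h)
    ≈⟨ ≈-sym (dil-⊗ 56 (f ⊗ i ⊗ (g ⊗ h)) (g ⊗ h)) ⟩
  dil 56 (f ⊗ i ⊗ (g ⊗ h) ⊗ (g ⊗ h))
    ≈⟨ dil-cong 56 (identity 4 (λ f i g h → f :* i :* (g :* h) :* (g :* h) := f :* (g :* h :* g :* h :* i)) f i g h) ⟩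
  dil 56 (f ⊗ (g ⊗ h ⊗ g ⊗ h ⊗ i))
    ≈⟨ dil-cong 56 (≈-trans (⊗-cong (rfl f) (⊗-inv (g ⊗ h ⊗ g ⊗ h) unit)) (⊗-identityʳ f)) ⟩
  dil 56 f ∎
  where
  open ≈-Reasoning
  i : FPS
  i = inv (g ⊗ h ⊗ g ⊗ h)
  head : ∀ f g → f 0 ≡ 1ℤ → g 0 ≡ 1ℤ → (f ⊗ g) 0 ≡ 1ℤ
  head f g p q = trans (ℤP.+-identityˡ _) (cong₂ ℤ._*_ p q)
  unit : (g ⊗ h ⊗ g ⊗ h) 0 ≡ 1ℤ
  unit = head (g ⊗ h ⊗ g) h (head (g ⊗ h) g (head g h g₀ h₀) g₀) h₀

numerator : ∀ g h k → dil 56 (g ⊗ h ⊗ k ⊗ k) ≈ dil 56 g ⊗ dil 56 h ⊗ dil 56 k ⊗ dil 56 k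
numerator g h k = ≈-trans (dil-⊗ 56 (g ⊗ h ⊗ k) k) (⊗-cong (≈-trans (dil-⊗ 56 (g ⊗ h) k) (⊗-cong (dil-⊗ 56 g h) (rfl (dil 56 k)))) (rfl (dil 56 k)))

dil-P : dil 56 (poch 7 7) ≈ P
dil-P = dil-poch 56 7 7

with-q : ∀ g h → dil 56 (mono 1 ⊗ g ⊗ h ⊗ poch 7 7 ⊗ poch 7 7) ≈ mono 56 ⊗ dil 56 g ⊗ dil 56 h ⊗ P ⊗ P
with-q g h = ≈-trans (numerator (mono 1 ⊗ g) h (poch 7 7))
  (⊗-cong (⊗-cong (⊗-cong (≈-trans (dil-⊗ 56 (mono 1) g) (⊗-cong (dil-mono 56 1) (rfl (dil 56 g)))) (rfl (dil 56 h))) dil-P) dil-P)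

-- The substitution q ↦ q^56 makes the exponents of the theta series integral.
X Y Z : FPS
X = dil 56 xS
Y = dil 56 yS
Z = dil 56 zS

X≈ : X ⊗ (dilate 3 ⊗ dilate 4) ⊗ (dilate 3 ⊗ dilate 4) ≈ mono 56 ⊗ dilate 2 ⊗ dilate 5 ⊗ P ⊗ P
X≈ = ≈-trans (quotient (mono 1 ⊗ poch 2 7 ⊗ poch 5 7 ⊗ poch 7 7 ⊗ poch 7 7) (poch 3 7) (poch 4 7) refl refl)
  (with-q (poch 2 7) (poch 5 7))

Y≈ : neg Y ⊗ (dilate 2 ⊗ dilate 5) ⊗ (dilate 2 ⊗ dilate 5) ≈ mono 56 ⊗ dilate 1 ⊗ dilate 6 ⊗ P ⊗ P
Y≈ = ≈-trans (⊗-cong (⊗-cong negY (rfl (dilate 2 ⊗ dilate 5))) (rfl (dilate 2 ⊗ dilate 5)))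
  (≈-trans (quotient numeratorY (poch 2 7) (poch 5 7) refl refl) (with-q (poch 1 7) (poch 6 7)))
  where
  numeratorY y : FPS
  numeratorY = mono 1 ⊗ poch 1 7 ⊗ poch 6 7 ⊗ poch 7 7 ⊗ poch 7 7
  y = numeratorY ⊗ inv (poch 2 7 ⊗ poch 5 7 ⊗ poch 2 7 ⊗ poch 5 7)
  negY : neg Y ≈ dil 56 y
  negY = ≈-trans (neg-cong (dil-neg 56 y)) (identity 1 (λ x → :- (:- x) := x) (dil 56 y))

Z≈ : Z ⊗ (dilate 1 ⊗ dilate 6) ⊗ (dilate 1 ⊗ dilate 6) ≈ one ⊗ dilate 3 ⊗ dilate 4 ⊗ P ⊗ P
Z≈ = ≈-trans (quotient (poch 3 7 ⊗ poch 4 7 ⊗ poch 7 7 ⊗ poch 7 7) (poch 1 7) (poch 6 7) refl refl)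
  (≈-trans (numerator (poch 3 7) (poch 4 7) (poch 7 7))
    (⊗-cong (⊗-cong (⊗-cong (≈-sym (⊗-identityˡ (dilate 3))) (rfl (dilate 4))) dil-P) dil-P))

-- The infinite products match by the definitions of x, y, z; what remains is a balance of
-- monomials. It holds because 56 + 2 · 1 = 49 + 9, 56 + 2 · 9 = 49 + 25 and 0 + 2 · 25 = 49 + 1.
cleared : ∀ {W g h g′ h′ n m s f₀ g₀} →
  W ⊗ (g ⊗ h) ⊗ (g ⊗ h) ≈ n ⊗ g′ ⊗ h′ ⊗ P ⊗ P → n ⊗ (m ⊗ m) ≈ mono 49 ⊗ s →
  f₀ ≈ P ⊗ (g ⊗ h ⊗ m) → g₀ ≈ P ⊗ (g′ ⊗ h′ ⊗ s) → K (ℤ.- + 14) ⊗ W ⊗ (f₀ ⊗ f₀) ≈ t 1 ⊗ g₀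
cleared {W} {g} {h} {g′} {h′} {n} {m} {s} hW monomials hf hg =
  ≈-trans (⊗-cong (rfl (K (ℤ.- + 14) ⊗ W)) (⊗-cong hf hf)) (≈-trans
    (by-zero (K (ℤ.- + 14) ⊗ (P ⊗ P) ⊗ (m ⊗ m) · hW ⊞ K (ℤ.- + 14) ⊗ (P ⊗ P ⊗ P ⊗ P) ⊗ (g′ ⊗ h′) · monomials)
      (identity 10 (λ W P m n r s g h g′ h′ →
          con (ℤ.- + 14) :* W :* ((P :* (g :* h :* m)) :* (P :* (g :* h :* m))) :=
          con (ℤ.- + 14) :* r :* (P :* P :* P) :* (P :* (g′ :* h′ :* s)) :+
          (con (ℤ.- + 14) :* (P :* P) :* (m :* m) :* (W :* (g :* h) :* (g :* h) :- n :* g′ :* h′ :* P :* P) :+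
           con (ℤ.- + 14) :* (P :* P :* P :* P) :* (g′ :* h′) :* (n :* (m :* m) :- r :* s)))
        W P m n (mono 49) s g h g′ h′))
    (⊗-cong (≈-sym t₁≈) (≈-sym hg)))

monomials : ∀ n m s → n ℕ.+ (m ℕ.+ m) ≡ 49 ℕ.+ s → mono n ⊗ (mono m ⊗ mono m) ≈ mono 49 ⊗ mono s
monomials n m s p = ≈-trans (⊗-cong (rfl (mono n)) (mono-mono m m))
  (≈-trans (mono-mono n (m ℕ.+ m)) (≈-trans (≡⇒≈ (cong mono p)) (≈-sym (mono-mono 49 s))))

eX : K (ℤ.- + 14) ⊗ X ⊗ (d 0 ⊗ d 0) ≈ t 1 ⊗ b 0
eX = cleared {X} {dilate 3} {dilate 4} {dilate 2} {dilate 5} {mono 56} {mono 1} {mono 9} {d 0} {b 0} X≈ (monomials 56 1 9 refl) d₀≈ b₀≈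

eY : K (+ 14) ⊗ Y ⊗ (b 0 ⊗ b 0) ≈ t 1 ⊗ a 0
eY = ≈-trans (identity 2 (λ Y b → con (+ 14) :* Y :* (b :* b) := con (ℤ.- + 14) :* :- Y :* (b :* b)) Y (b 0))
  (cleared {neg Y} {dilate 2} {dilate 5} {dilate 1} {dilate 6} {mono 56} {mono 9} {mono 25} {b 0} {a 0} Y≈ (monomials 56 9 25 refl) b₀≈ a₀≈)

eZ : K (ℤ.- + 14) ⊗ Z ⊗ (a 0 ⊗ a 0) ≈ t 1 ⊗ d 0
eZ = cleared {Z} {dilate 1} {dilate 6} {dilate 3} {dilate 4} {one} {mono 25} {mono 1} {a 0} {d 0} Z≈ (monomials 0 25 1 refl) a₀≈ d₀≈

θ-K⊗ : ∀ c f → θ (K c ⊗ f) ≈ K c ⊗ θ f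
θ-K⊗ c f = ≈-trans (θ-cong (≈-sym (⋆-K c f))) (≈-trans (θ-⋆ c f) (⋆-K c (θ f)))

et : t 3 ≈ C ⊗ t 1
et = begin
  t 3
    ≈⟨ ≈-sym (θ-Θ (ℤ.- + 7) 1) ⟩
  θ (t 1)
    ≈⟨ θ-cong (≈-trans t₁≈ (⊗-assoc (K (ℤ.- + 14)) (mono 49) (P ⊗ P ⊗ P))) ⟩
  θ (K (ℤ.- + 14) ⊗ (mono 49 ⊗ (P ⊗ P ⊗ P)))
    ≈⟨ ≈-trans (θ-K⊗ (ℤ.- + 14) (mono 49 ⊗ (P ⊗ P ⊗ P))) (⊗-cong (rfl (K (ℤ.- + 14)))
         (≈-trans (θ-⊗ (mono 49) (P ⊗ P ⊗ P)) (⊕-cong (⊗-cong (θ-mono 49) (rfl (P ⊗ P ⊗ P)))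
           (⊗-cong (rfl (mono 49)) (≈-trans (θ-⊗ (P ⊗ P) P) (⊕-cong
             (⊗-cong (≈-trans (θ-⊗ P P) (⊕-cong (⊗-cong θ-P (rfl P)) (⊗-cong (rfl P) θ-P))) (rfl P))
             (⊗-cong (rfl (P ⊗ P)) θ-P))))))) ⟩
  K (ℤ.- + 14) ⊗ (K (+ 49) ⊗ mono 49 ⊗ (P ⊗ P ⊗ P) ⊕ mono 49 ⊗ ((P′ ⊗ P ⊕ P ⊗ P′) ⊗ P ⊕ P ⊗ P ⊗ P′))
    ≈⟨ identity 3 (λ m P l → let P′ = :- (con (+ 392) :* (P :* l)) in
         con (ℤ.- + 14) :* (con (+ 49) :* m :* (P :* P :* P) :+ m :* ((P′ :* P :+ P :* P′) :* P :+ P :* P :* P′)) :=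
         (con (+ 49) :- con (+ 1176) :* l) :* (con (ℤ.- + 14) :* m :* (P :* P :* P))) (mono 49) P Λ ⟩
  (K (+ 49) ⊕ neg (K (+ 1176) ⊗ Λ)) ⊗ (K (ℤ.- + 14) ⊗ mono 49 ⊗ (P ⊗ P ⊗ P))
    ≈⟨ ⊗-cong (≈-sym C≈) (≈-sym t₁≈) ⟩
  C ⊗ t 1 ∎
  where
  open ≈-Reasoning
  P′ : FPS
  P′ = neg (K (+ 392) ⊗ (P ⊗ Λ))

Cancellable-one₀ : ∀ {f} → f 0 ≡ 1ℤ → Cancellable f
Cancellable-one₀ {f} p = Cancellable-unit {f} (λ q → 1≢0 (trans (sym p) q))
  where
  1≢0 : ¬ (1ℤ ≡ 0ℤ)
  1≢0 ()

Cancellable-theta : ∀ {f g h e} → g 0 ≡ 1ℤ → h 0 ≡ 1ℤ → f ≈ P ⊗ (g ⊗ h ⊗ mono e) → Cancellable f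
Cancellable-theta {f} {g} {h} {e} g₀ h₀ p = Cancellable-≈ (≈-sym p) (Cancellable-* (Cancellable-one₀ {P} refl)
  (Cancellable-* (Cancellable-* (Cancellable-one₀ {g} g₀) (Cancellable-one₀ {h} h₀)) (Cancellable-mono e)))

Cancellable-t₁ : Cancellable (t 1)
Cancellable-t₁ = Cancellable-≈ (≈-sym t₁≈) (Cancellable-* (Cancellable-* (Cancellable-K {ℤ.- + 14} (λ ())) (Cancellable-mono 49))
  (Cancellable-* (Cancellable-* (Cancellable-one₀ {P} refl) (Cancellable-one₀ {P} refl)) (Cancellable-one₀ {P} refl)))

module System = ODE (λ c c≢0 → Cancellable-K {c} c≢0)
  θ θ-cong θ-⊕ θ-⊗ θ-K⊗
  (a 0) (a 1) (a 2) (a 3) (a 4) (b 0) (b 1) (b 2) (d 0) (d 1) (d 2) (t 1) (t 3) (t 5)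
  (θ-Θ (ℤ.- + 5) 0) (θ-Θ (ℤ.- + 5) 1) (θ-Θ (ℤ.- + 5) 2) (θ-Θ (ℤ.- + 3) 0) (θ-Θ (ℤ.- + 1) 0) (θ-Θ (ℤ.- + 7) 1) (θ-Θ (ℤ.- + 7) 3)
  klein zeta₁ zeta₂ zeta₃ duplication₁ duplication₂ duplication₃ quartic
  X Y Z C
  (Cancellable-theta {a 0} {dilate 1} {dilate 6} {25} refl refl a₀≈) (Cancellable-theta {b 0} {dilate 2} {dilate 5} {9} refl refl b₀≈)
  (Cancellable-theta {d 0} {dilate 3} {dilate 4} {1} refl refl d₀≈) Cancellable-t₁
  eX eY eZ et

-- Descent from q^56 to q

infix 4 _↦_
-- With a combinator for each operation of the statement, the dilated form of a whole side is
-- assembled by copying its syntax.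
record _↦_ (f f′ : FPS) : Set where
  constructor dilates
  field dilation : dil 56 f ≈ f′
open _↦_

infixl 6 _⟨⊕⟩_ _⟨⊖⟩_
infixl 7 _⟨⊗⟩_ _⟨⋆⟩_

_⟨⊕⟩_ : ∀ {f f′ g g′} → f ↦ f′ → g ↦ g′ → f ⊕ g ↦ f′ ⊕ g′
_⟨⊕⟩_ {f} {f′} {g} p q = dilates (≈-trans (dil-⊕ 56 f g) (⊕-cong (dilation p) (dilation q)))

_⟨⊖⟩_ : ∀ {f f′ g g′} → f ↦ f′ → g ↦ g′ → f ⊖ g ↦ f′ ⊕ neg g′
_⟨⊖⟩_ {f} {f′} {g} p q = dilates (≈-trans (dil-⊖ 56 f g) (⊕-cong (dilation p) (neg-cong (dilation q))))

_⟨⊗⟩_ : ∀ {f f′ g g′} → f ↦ f′ → g ↦ g′ → f ⊗ g ↦ f′ ⊗ g′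
_⟨⊗⟩_ {f} {f′} {g} p q = dilates (≈-trans (dil-⊗ 56 f g) (⊗-cong (dilation p) (dilation q)))

_⟨⋆⟩_ : ∀ {f f′} c → f ↦ f′ → c ⋆ f ↦ K c ⊗ f′
_⟨⋆⟩_ {f} {f′} c p = dilates (≈-trans (dil-⋆ 56 c f) (≈-trans (⋆-K c (dil 56 f)) (⊗-cong (rfl (K c)) (dilation p))))

dilate-back : ∀ {f f′ g g′} → f ↦ f′ → g ↦ g′ → f′ ≈ g′ → f ≐ g
dilate-back p q h = coeff (dil-injective 56 (≈-trans (dilation p) (≈-trans h (≈-sym (dilation q)))))

leaf : ∀ f → f ↦ dil 56 f
leaf f = dilates (rfl (dil 56 f))

Q Q′ X′ Y′ Z′ : FPS
Q  = dil 56 𝒫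
Q′ = dil 56 (θ 𝒫)
X′ = dil 56 (θ xS)
Y′ = dil 56 (θ yS)
Z′ = dil 56 (θ zS)

θ-dil-56 : ∀ f → θ (dil 56 f) ≈ K (+ 56) ⊗ dil 56 (θ f)
θ-dil-56 f = ≈-trans (dil-θ 56 f) (⋆-K (+ 56) (dil 56 (θ f)))

θC : θ C ≈ K (+ 49) ⊗ (K (+ 56) ⊗ Q′)
θC = ≈-trans (θ-K⊗ (+ 49) Q) (⊗-cong (rfl (K (+ 49))) (θ-dil-56 𝒫))

open System using (form; tX; tY; tZ; :form; :F; ode-X; ode-Y; ode-Z; ode-C)

-- With `C = 49 Q` and `θ` producing the factor 56, the coefficients become 3 · 56 = 14 · 12 and 2 ·
-- 49 = 14 · 7.
rescale : ∀ {W W′ θW p} → K (+ 3) ⊗ θW ≈ W ⊗ (K (+ 2) ⊗ C ⊕ K (+ 14) ⊗ p) → θW ≈ K (+ 56) ⊗ W′ →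
          K (+ 12) ⊗ W′ ≈ W ⊗ (p ⊕ K (+ 7) ⊗ Q)
rescale {W} {W′} {θW} {p} h h′ = cancelˡ (Cancellable-K {+ 14} (λ ())) (by-zero
  (K 1ℤ · h ⊞ K (ℤ.- + 3) · h′)
  (identity 5 (λ W W′ V p q →
      con (+ 14) :* (con (+ 12) :* W′) := con (+ 14) :* (W :* (p :+ con (+ 7) :* q)) :+
      (con 1ℤ :* (con (+ 3) :* V :- W :* (con (+ 2) :* (con (+ 49) :* q) :+ con (+ 14) :* p)) :+ con (ℤ.- + 3) :* (V :- con (+ 56) :* W′)))
    W W′ θW p Q))

theorem1p4 : ((+ 12) ⋆ θ xS ≐ xS ⊗ ((+ 5) ⋆ yS ⊗ yS ⊕ (+ 5) ⋆ zS ⊗ zS ⊖ (+ 7) ⋆ xS ⊗ xS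
    ⊕ (+ 20) ⋆ yS ⊗ zS ⊕ (+ 52) ⋆ xS ⊗ yS ⊕ (+ 7) ⋆ 𝒫))
    × ((+ 12) ⋆ θ yS ≐ yS ⊗ ((+ 5) ⋆ zS ⊗ zS ⊕ (+ 5) ⋆ xS ⊗ xS ⊖ (+ 7) ⋆ yS ⊗ yS
    ⊕ (+ 20) ⋆ xS ⊗ zS ⊕ (+ 52) ⋆ yS ⊗ zS ⊕ (+ 7) ⋆ 𝒫))
    × ((+ 12) ⋆ θ zS ≐ zS ⊗ ((+ 5) ⋆ xS ⊗ xS ⊕ (+ 5) ⋆ yS ⊗ yS ⊖ (+ 7) ⋆ zS ⊗ zS
    ⊕ (+ 20) ⋆ xS ⊗ yS ⊕ (+ 52) ⋆ xS ⊗ zS ⊕ (+ 7) ⋆ 𝒫))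
    × ((+ 12) ⋆ θ 𝒫 ≐ (+ 7) ⋆ (𝒫 ⊗ 𝒫 ⊖ xS ⊗ xS ⊗ xS ⊗ xS ⊖ (+ 4) ⋆ xS ⊗ xS ⊗ xS ⊗ yS
    ⊖ (+ 12) ⋆ xS ⊗ yS ⊗ yS ⊗ yS ⊖ yS ⊗ yS ⊗ yS ⊗ yS
    ⊖ (+ 12) ⋆ xS ⊗ xS ⊗ xS ⊗ zS ⊖ (+ 4) ⋆ yS ⊗ yS ⊗ yS ⊗ zS
    ⊖ (+ 4) ⋆ xS ⊗ zS ⊗ zS ⊗ zS ⊖ (+ 12) ⋆ yS ⊗ zS ⊗ zS ⊗ zS
    ⊖ zS ⊗ zS ⊗ zS ⊗ zS))
theorem1p4 =
    dilate-back ((+ 12) ⟨⋆⟩ leaf (θ xS))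
      (x ⟨⊗⟩ ((+ 5) ⟨⋆⟩ y ⟨⊗⟩ y ⟨⊕⟩ (+ 5) ⟨⋆⟩ z ⟨⊗⟩ z ⟨⊖⟩ (+ 7) ⟨⋆⟩ x ⟨⊗⟩ x
        ⟨⊕⟩ (+ 20) ⟨⋆⟩ y ⟨⊗⟩ z ⟨⊕⟩ (+ 52) ⟨⋆⟩ x ⟨⊗⟩ y ⟨⊕⟩ (+ 7) ⟨⋆⟩ p))
      (≈-trans (rescale {X} {X′} {θ X} {tX} ode-X (θ-dil-56 xS)) (regroup X Y Z Y Z X Y))
  , dilate-back ((+ 12) ⟨⋆⟩ leaf (θ yS))
      (y ⟨⊗⟩ ((+ 5) ⟨⋆⟩ z ⟨⊗⟩ z ⟨⊕⟩ (+ 5) ⟨⋆⟩ x ⟨⊗⟩ x ⟨⊖⟩ (+ 7) ⟨⋆⟩ y ⟨⊗⟩ y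
        ⟨⊕⟩ (+ 20) ⟨⋆⟩ x ⟨⊗⟩ z ⟨⊕⟩ (+ 52) ⟨⋆⟩ y ⟨⊗⟩ z ⟨⊕⟩ (+ 7) ⟨⋆⟩ p))
      (≈-trans (rescale {Y} {Y′} {θ Y} {tY} ode-Y (θ-dil-56 yS)) (regroup Y Z X X Z Y Z))
  , dilate-back ((+ 12) ⟨⋆⟩ leaf (θ zS))
      (z ⟨⊗⟩ ((+ 5) ⟨⋆⟩ x ⟨⊗⟩ x ⟨⊕⟩ (+ 5) ⟨⋆⟩ y ⟨⊗⟩ y ⟨⊖⟩ (+ 7) ⟨⋆⟩ z ⟨⊗⟩ z
        ⟨⊕⟩ (+ 20) ⟨⋆⟩ x ⟨⊗⟩ y ⟨⊕⟩ (+ 52) ⟨⋆⟩ x ⟨⊗⟩ z ⟨⊕⟩ (+ 7) ⟨⋆⟩ p))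
      (≈-trans (rescale {Z} {Z′} {θ Z} {tZ} ode-Z (θ-dil-56 zS)) (regroup Z X Y X Y X Z))
  , dilate-back ((+ 12) ⟨⋆⟩ leaf (θ 𝒫))
      ((+ 7) ⟨⋆⟩ (p ⟨⊗⟩ p ⟨⊖⟩ x ⟨⊗⟩ x ⟨⊗⟩ x ⟨⊗⟩ x ⟨⊖⟩ (+ 4) ⟨⋆⟩ x ⟨⊗⟩ x ⟨⊗⟩ x ⟨⊗⟩ y
        ⟨⊖⟩ (+ 12) ⟨⋆⟩ x ⟨⊗⟩ y ⟨⊗⟩ y ⟨⊗⟩ y ⟨⊖⟩ y ⟨⊗⟩ y ⟨⊗⟩ y ⟨⊗⟩ y
        ⟨⊖⟩ (+ 12) ⟨⋆⟩ x ⟨⊗⟩ x ⟨⊗⟩ x ⟨⊗⟩ z ⟨⊖⟩ (+ 4) ⟨⋆⟩ y ⟨⊗⟩ y ⟨⊗⟩ y ⟨⊗⟩ z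
        ⟨⊖⟩ (+ 4) ⟨⋆⟩ x ⟨⊗⟩ z ⟨⊗⟩ z ⟨⊗⟩ z ⟨⊖⟩ (+ 12) ⟨⋆⟩ y ⟨⊗⟩ z ⟨⊗⟩ z ⟨⊗⟩ z
        ⟨⊖⟩ z ⟨⊗⟩ z ⟨⊗⟩ z ⟨⊗⟩ z))
      -- The common factor: 3 · 49 · 56 = 686 · 12 and 2 · 49² = 4802 = 686 · 7.
      (cancelˡ (Cancellable-K {+ 686} (λ ())) (by-zero
        (K 1ℤ · ode-C ⊞ K (ℤ.- + 3) · θC)
        (identity 6 (λ X Y Z q q′ c′ →
            con (+ 686) :* (con (+ 12) :* q′) :=
            con (+ 686) :* (con (+ 7) :* (q :* q :- X :* X :* X :* X :- con (+ 4) :* X :* X :* X :* Y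
              :- con (+ 12) :* X :* Y :* Y :* Y :- Y :* Y :* Y :* Y
              :- con (+ 12) :* X :* X :* X :* Z :- con (+ 4) :* Y :* Y :* Y :* Z
              :- con (+ 4) :* X :* Z :* Z :* Z :- con (+ 12) :* Y :* Z :* Z :* Z
              :- Z :* Z :* Z :* Z)) :+
            (con 1ℤ :* (con (+ 3) :* c′ :- (con (+ 2) :* (con (+ 49) :* q :* (con (+ 49) :* q)) :-
              con (+ 4802) :* :F X Y Z)) :+
             con (ℤ.- + 3) :* (c′ :- con (+ 49) :* (con (+ 56) :* q′))))
          X Y Z Q Q′ (θ C))))
  where
  x : xS ↦ X
  x = leaf xS
  y : yS ↦ Y
  y = leaf yS
  z : zS ↦ Z
  z = leaf zS
  p : 𝒫 ↦ Q
  p = leaf 𝒫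
  -- `_⋆_` and `_⊗_` associate to the left at the same level, so the statement has `((+ 5) ⋆ y) ⊗ y`
  -- where `form` has 5 times a square.
  regroup : ∀ U V W f g h k → U ⊗ (form U V W (f ⊗ g) (h ⊗ k) ⊕ K (+ 7) ⊗ Q) ≈
    U ⊗ (K (+ 5) ⊗ V ⊗ V ⊕ K (+ 5) ⊗ W ⊗ W ⊕ neg (K (+ 7) ⊗ U ⊗ U) ⊕ K (+ 20) ⊗ f ⊗ g ⊕ K (+ 52) ⊗ h ⊗ k ⊕ K (+ 7) ⊗ Q)
  regroup U V W f g h k = identity 8 (λ U V W f g h k q → U :* (:form U V W (f :* g) (h :* k) :+ con (+ 7) :* q) :=
      U :* (con (+ 5) :* V :* V :+ con (+ 5) :* W :* W :- con (+ 7) :* U :* U :+ con (+ 20) :* f :* g :+ con (+ 52) :* h :* k :+ con (+ 7) :* q))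
    U V W f g h k Q
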